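{- Let $q\ge 4$ and let $H_1$ be a hyperplane of $\mathrm{PG}(U_1)$ with $|H_1\cap\mathcal O_1|=q^2-q+1$. Then $H_1\cap\mathcal O_1$ is a $(6,4)$-set of $H_1\cong\mathrm{PG}(6,q)$.
   Context: $q$ is a prime power. Let $U_1\subset\mathbb F_{q^3}^8$ be the set of vectors $(a,b^{q^2},b^{q},c,b,c^{q},c^{q^2},d)$ with $a,d\in\mathbb F_q$, $b,c\in\mathbb F_{q^3}$; it is an $8$-dimensional $\mathbb F_q$-vector space, so $\mathrm{PG}(U_1)\cong\mathrm{PG}(7,q)$. For $(a,b,c,d)\ne 0$ let $P(a,b,c,d)$ be the point of $\mathrm{PG}(U_1)$ spanned by this vector. Let $\mathcal O_1=\{P(1,t,t^{q^2+q},t^{q^2+q+1}) : t\in\mathbb F_{q^3}\}\cup\{P(0,0,0,1)\}$. For integers $r,s$, an $(r,s)$-set of $\mathrm{PG}(n,q)$ is a set $\mathcal X$ of points such that: (i) every $s$-dimensional projective subspace contains at most $r$ points of $\mathcal X$; (ii) $\mathcal X$ spans $\mathrm{PG}(n,q)$; (iii) some $(s+1)$-dimensional projective subspace contains $r+2$ points of $\mathcal X$. -}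

module Defs where

open import Algebra.Bundles using (CommutativeRing; Ring)
open import Algebra.Module.Bundles using (LeftModule)
open import Algebra.Morphism.Structures using (module RingMorphisms)
import Algebra.Construct.Pointwise as Pointwise
import Algebra.Properties.Monoid.Sum as Sum
import Algebra.Properties.Semiring.Exp as Exp
open import Data.Fin.Base using (Fin)
open import Data.Nat.Base as ℕ using (ℕ; suc)
open import Data.Nat.Primality using (Prime)
open import Data.Product.Base using (∃; ∃₂; _×_; _,_)
open import Data.Sum.Base using (_⊎_)
open import Data.Vec.Functional using (Vector; []; _∷_)
open import Function.Base using (_∘_)
open import Function.Bundles using (Inverse)
open import Level using (Level; _⊔_)
open import Relation.Binary.Core using (Rel)
open import Relation.Binary.PropositionalEquality as ≡ using (_≡_)
open import Relation.Unary using (Pred; _∈_; _⊆_; _∩_)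

private
  variable
    c ℓ c′ ℓ′ r ℓr m ℓm ℓx : Level

IsPrimePower : ℕ → Set
IsPrimePower q = ∃₂ λ p k → Prime p × 1 ℕ.≤ k × q ≡ p ℕ.^ k

record IsFiniteField (n : ℕ) (F : CommutativeRing c ℓ) : Set (c ⊔ ℓ) where
  open CommutativeRing F
  field
    1≉0     : 1# ≉ 0#
    inverse : ∀ x → x ≉ 0# → ∃ λ y → x * y ≈ 1#
    order   : Inverse setoid (≡.setoid (Fin n))

-- Projective geometry of a vector space M; R is only ever instantiated with
-- a field.
module Projective {R : Ring r ℓr} (M : LeftModule R m ℓm) where
  open Ring R using () renaming (Carrier to Scalar; _≈_ to _≈ˢ_; 0# to 0ˢ)
  open LeftModule M
  open Sum +ᴹ-monoid using (sum)

  combination : ∀ {n} → Vector Scalar n → Vector Carrierᴹ n → Carrierᴹ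
  combination k v = sum (λ i → k i *ₗ v i)

  LinearlyIndependent : ∀ {n} → Vector Carrierᴹ n → Set (r ⊔ ℓr ⊔ ℓm)
  LinearlyIndependent v = ∀ k → combination k v ≈ᴹ 0ᴹ → ∀ i → k i ≈ˢ 0ˢ

  Span : ∀ {n} → Vector Carrierᴹ n → Pred Carrierᴹ (r ⊔ ℓm)
  Span v x = ∃ λ k → combination k v ≈ᴹ x

  record Point : Set (m ⊔ ℓm) where
    field
      vec     : Carrierᴹ
      nonzero : vec ≉ᴹ 0ᴹ

  open Point public

  -- The scalar is automatically nonzero, as vec p is.
  _IsSpannedBy_ : Point → Carrierᴹ → Set (r ⊔ ℓm)
  p IsSpannedBy v = ∃ λ k → k *ₗ v ≈ᴹ vec p

  _≈ₚ_ : Rel Point (r ⊔ ℓm)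
  p ≈ₚ q = p IsSpannedBy vec q

  Points : Pred Carrierᴹ ℓx → Pred Point ℓx
  Points W p = W (vec p)

  -- A subspace of projective dimension d, given by one of its bases; only its
  -- set of points ⟦_⟧ is ever used, so the choice of basis is immaterial.
  record Subspace (d : ℕ) : Set (r ⊔ ℓr ⊔ m ⊔ ℓm) where
    field
      basis       : Vector Carrierᴹ (suc d)
      independent : LinearlyIndependent basis

    ⟦_⟧ : Pred Point (r ⊔ ℓm)
    ⟦_⟧ = Points (Span basis)

  open Subspace public

  DistinctPointsOf : ∀ {n} → Pred Point ℓx → Vector Point n → Set (r ⊔ ℓm ⊔ ℓx)
  DistinctPointsOf X p = (∀ i → p i ∈ X) × (∀ i j → p i ≈ₚ p j → i ≡ j)

  HasAtLeast : ℕ → Pred Point ℓx → Set (r ⊔ m ⊔ ℓm ⊔ ℓx)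
  HasAtLeast n X = ∃ λ (p : Vector Point n) → DistinctPointsOf X p

  HasAtMost : ℕ → Pred Point ℓx → Set (r ⊔ m ⊔ ℓm ⊔ ℓx)
  HasAtMost n X = ∀ {k} (p : Vector Point k) → DistinctPointsOf X p → k ℕ.≤ n

  HasExactly : ℕ → Pred Point ℓx → Set (r ⊔ m ⊔ ℓm ⊔ ℓx)
  HasExactly n X = ∃ λ (p : Vector Point n) →
    DistinctPointsOf X p × (∀ x → x ∈ X → ∃ λ i → x ≈ₚ p i)

  SpannedByPointsOf : Pred Point ℓx → Pred Point (r ⊔ m ⊔ ℓm ⊔ ℓx)
  SpannedByPointsOf X x = ∃₂ λ n (p : Vector Point n) →
    (∀ i → p i ∈ X) × x ∈ Points (Span (vec ∘ p))

  -- X is an (a , s)-set of the n-dimensional projective space W.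
  record Is⟨_,_⟩-SetOf (a s : ℕ) {n} (W : Subspace n) (X : Pred Point ℓx)
      : Set (r ⊔ ℓr ⊔ m ⊔ ℓm ⊔ ℓx) where
    field
      within   : X ⊆ ⟦ W ⟧
      atMost   : ∀ (S : Subspace s) → ⟦ S ⟧ ⊆ ⟦ W ⟧ → HasAtMost a (⟦ S ⟧ ∩ X)
      spanning : ⟦ W ⟧ ⊆ SpannedByPointsOf X
      attained : ∃ λ (S : Subspace (suc s)) →
                   ⟦ S ⟧ ⊆ ⟦ W ⟧ × HasAtLeast (a ℕ.+ 2) (⟦ S ⟧ ∩ X)

-- K and L stand for 𝔽_q and 𝔽_{q³}, with 𝔽_q embedded in 𝔽_{q³} through ι.
module Extension
  (K : CommutativeRing c ℓ) (L : CommutativeRing c′ ℓ′)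
  where

  private
    module K = CommutativeRing K
    module L = CommutativeRing L
  open RingMorphisms K.rawRing L.rawRing using (IsRingHomomorphism)

  IsEmbedding : (K.Carrier → L.Carrier) → Set (c ⊔ ℓ ⊔ ℓ′)
  IsEmbedding = IsRingHomomorphism

  module WithEmbedding
    {ι : K.Carrier → L.Carrier} (ι-hom : IsEmbedding ι) (q : ℕ)
    where

    open IsRingHomomorphism ι-hom
    open Exp L.semiring using (_^_)

    -- Lⁿ with scalars restricted to K.
    space : ℕ → LeftModule K.ring c′ ℓ′
    space n = record
      { Carrierᴹ = Vector L.Carrier n
      ; _≈ᴹ_ = λ v w → ∀ i → v i L.≈ w i
      ; _+ᴹ_ = λ v w i → v i L.+ w i
      ; _*ₗ_ = λ k v i → ι k L.* v i
      ; 0ᴹ   = λ _ → L.0#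
      ; -ᴹ_  = λ v i → L.- v i
      ; isLeftModule = record
        { isLeftSemimodule = record
          { +ᴹ-isCommutativeMonoid =
              Pointwise.isCommutativeMonoid (Fin n) L.+-isCommutativeMonoid
          ; isPreleftSemimodule = record
            { *ₗ-cong      = λ k≈l v≈w i → L.*-cong (⟦⟧-cong k≈l) (v≈w i)
            ; *ₗ-zeroˡ     = λ v i → L.trans (L.*-congʳ 0#-homo) (L.zeroˡ (v i))
            ; *ₗ-distribʳ  = λ v k l i →
                L.trans (L.*-congʳ (+-homo k l)) (L.distribʳ (v i) (ι k) (ι l))
            ; *ₗ-identityˡ = λ v i → L.trans (L.*-congʳ 1#-homo) (L.*-identityˡ (v i))
            ; *ₗ-assoc     = λ k l v i →
                L.trans (L.*-congʳ (*-homo k l)) (L.*-assoc (ι k) (ι l) (v i))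
            ; *ₗ-zeroʳ     = λ k i → L.zeroʳ (ι k)
            ; *ₗ-distribˡ  = λ k v w i → L.distribˡ (ι k) (v i) (w i)
            }
          }
        ; -ᴹ‿cong    = λ v≈w i → L.-‿cong (v≈w i)
        ; -ᴹ‿inverse = (λ v i → L.-‿inverseˡ (v i)) , (λ v i → L.-‿inverseʳ (v i))
        }
      }

    open Projective (space 8) public
    open LeftModule (space 8) using (_≈ᴹ_)

    coordinates : L.Carrier → L.Carrier → L.Carrier → L.Carrier → Vector L.Carrier 8
    coordinates a b c d =
      a ∷ b ^ (q ℕ.^ 2) ∷ b ^ q ∷ c ∷ b ∷ c ^ q ∷ c ^ (q ℕ.^ 2) ∷ d ∷ []

    U₁ : Pred (Vector L.Carrier 8) (c ⊔ c′ ⊔ ℓ′)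
    U₁ v = ∃₂ λ a d → ∃₂ λ b c → v ≈ᴹ coordinates (ι a) b c (ι d)

    -- The last coordinate t ^ (q² + q + 1) is the norm of t, hence in the image
    -- of ι, so these points do lie in PG(U₁).
    O₁ : Pred Point (c ⊔ c′ ⊔ ℓ′)
    O₁ p =
      (∃ λ t → p IsSpannedBy
        coordinates L.1# t (t ^ (q ℕ.^ 2 ℕ.+ q)) (t ^ (q ℕ.^ 2 ℕ.+ q ℕ.+ 1)))
      ⊎ p IsSpannedBy coordinates L.0# L.0# L.0# L.1#

{-# OPTIONS --safe #-}
module Submission where

-- A hyperplane of PG(U₁) is annihilated by a Frobenius-invariant trilinear form
-- on 𝔽_{q³}², that is by a 2×2×2 tensor, and such a tensor has a binary quadratic
-- covariant over 𝔽_{q³}.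
-- If the covariant has a root in PG(1, q³), a change of coordinates turns the
-- section into N(s) = const or Tr(βs) = const. Since q³ > q (q² - q + 1), some
-- fibre of N or Tr(β ·) has more than q² - q + 1 elements, and scaling or
-- translation moves it into the section.
-- Otherwise the roots ρ, ρ^(q³) lie in 𝔽_{q⁶} and diagonalise the form. The
-- hyperplane becomes 𝔽_q ⊕ 𝔽_{q⁶}, its functionals α + Tr(βw), and its points of
-- O₁ elements w with w w^(q²) = ν w^q: rational points of a form of the toric del
-- Pezzo surface of degree 6, the q-conjugates of w being its hexagon of
-- coordinates.
-- Two functionals vanishing at seven points have a resultant of degree 6 with
-- seven roots; its leading coefficient is a product of conjugate 2×2 minors, so
-- the functionals are proportional. A functional has at most 2q + 1 zeros, which
-- gives the spanning property. Hyperplanes with eight points come from pigeonhole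
-- in a pencil through five points if q ≥ 5, and from the quadratic residue code of
-- length 13 if q = 4.

open import Defs
open import Algebra.Bundles using (CommutativeRing)
open import Algebra.Module.Bundles using (LeftModule)
import Algebra.Morphism.Construct.Composition as MorphismComposition
open import Algebra.Morphism.Structures using (module RingMorphisms)
import Algebra.Properties.CommutativeMonoid.Sum as CommutativeMonoidSum
import Algebra.Properties.CommutativeSemiring.Binomial as Binomial
import Algebra.Properties.CommutativeSemiring.Exp as CommutativeExp
import Algebra.Properties.Ring as RingProperties
import Algebra.Properties.Semiring.Exp as Exp
import Algebra.Properties.Semiring.Mult as SemiringMult
import Algebra.Properties.Semiring.Mult.TCOptimised as OptimisedMult
import Algebra.Properties.Semiring.Sum as SemiringSum
import Algebra.Solver.Ring as RingSolver
open import Algebra.Solver.Ring.AlmostCommutativeRing using (fromCommutativeRing; _-Raw-AlmostCommutative⟶_)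
import Data.Bool.Base as Bool
open import Data.Empty using (⊥)
open import Data.Fin.Base as Fin using (Fin; zero; suc)
open import Data.Fin.Patterns using (0F; 1F; 2F; 3F; 4F; 5F; 6F; 7F)
import Data.Fin.Permutation as Permutation
import Data.Fin.Properties as Finₚ
open import Data.Integer.Base as ℤ using (ℤ; +_; -[1+_]; _⊖_)
import Data.Integer.Properties as ℤₚ
open import Data.Maybe.Base using (Maybe; just; nothing; is-just)
open import Data.Nat.Base as ℕ using (ℕ; zero; suc; _≤_; _<_; s≤s; z≤n)
open import Data.Nat.Combinatorics using (_C_; nCk+nC[k+1]≡[n+1]C[k+1]; nCk≡nC[n∸k]; nCn≡1; nC1≡n; k>n⇒nCk≡0)
open import Data.Nat.Coprimality using (coprime-Bézout; prime⇒coprime)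
open import Data.Nat.Divisibility using (_∣_; divides; ∣⇒≤)
open import Data.Nat.GCD using (module Bézout)
open import Data.Nat.Primality using (Prime; euclidsLemma; prime?; prime⇒nonZero)
import Data.Nat.Properties as ℕₚ
open import Data.Nat.Solver using (module +-*-Solver)
open import Data.Product.Base using (∃; ∃₂; _×_; _,_; proj₁; proj₂)
open import Data.Product.Function.NonDependent.Setoid using (_×-inverse_)
open import Data.Product.Relation.Binary.Pointwise.NonDependent using (_×ₛ_; Pointwise-≡↔≡)
open import Data.Sum.Base as Sum using (_⊎_; inj₁; inj₂; [_,_]′)
import Data.Sum.Properties as Sumₚ
open import Data.Unit.Base using (tt)
import Data.Vec.Base as Vec
open import Data.Vec.Functional using (Vector; []; _∷_; insertAt; removeAt)
open import Data.Vec.Functional.Properties using (insertAt-lookup; insertAt-punchIn)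
open import Data.Vec.N-ary using (N-ary; Eq; _$ⁿ_; curryⁿ; curryⁿ-cong; Eq-to-Eqʰ)
open import Function.Base using (_∘_; id)
open import Function.Bundles using (Inverse)
import Function.Construct.Composition as Compose
open import Level using (Level)
open import Relation.Binary.Bundles using (Setoid)
open import Relation.Binary.Definitions using (tri<; tri≈; tri>)
open import Relation.Binary.PropositionalEquality as ≡ using (_≡_; _≢_)
import Relation.Binary.Reasoning.Setoid as SetoidReasoning
open import Relation.Nullary using (¬_; Dec; yes; no; contradiction)
import Relation.Nullary.Decidable as Dec
open import Relation.Unary using (Pred; Decidable; _⊆_; _∩_)

-- The prescribed number of points works in both directions. A covariant with a root allows only
-- sections with at most one point or with more than q² - q + 1 points, so the upper bound forces
-- irreducibility; the lower bound then supplies the points needed for spanning and for hyperplanes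
-- with eight points. Tensors enter because the entries of a vector of U₁, in the given order,
-- satisfy T_ijk^q = T_kij, and the points of O₁ are x ⊗ x^q ⊗ x^(q²) for x in PG(1, q³). The
-- covariant at x is the determinant of the 2×2 matrix obtained by contracting the annihilating
-- tensor with x; having no root means that no such contraction drops rank. The bound 6 is the
-- degree of the surface: a 4-dimensional subspace of H is cut out by two independent functionals,
-- which have at most six common points. Most dimension arguments are comparisons of cardinalities:
-- two elements with the same image under an additive map differ by a nonzero solution of the
-- homogeneous system.

private
  variable
    c ℓ c′ ℓ′ ℓa ℓb ℓp ℓm ℓm′ ℓx : Level

-- Counting in finite sets

FiniteSetoid : ℕ → Setoid c ℓ → Set _
FiniteSetoid n S = Inverse S (≡.setoid (Fin n))

Injectiveᵥ : ∀ {A : Set ℓa} {n} → Vector A n → Set ℓa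
Injectiveᵥ v = ∀ i j → v i ≡ v j → i ≡ j

-- A ring solver with integer coefficients

module IntegerCoefficients (R : CommutativeRing c ℓ) where
  open CommutativeRing R
  open OptimisedMult semiring renaming (_×_ to infixl 8 _×ᴿ_)
  open RingProperties ring
  open SetoidReasoning setoid

  fromℤ : ℤ → Carrier
  fromℤ (+ n)    = n ×ᴿ 1#
  fromℤ -[1+ n ] = - (suc n ×ᴿ 1#)

  fromℤ-⊖ : ∀ m n → fromℤ (m ⊖ n) ≈ m ×ᴿ 1# - n ×ᴿ 1#
  fromℤ-⊖ m zero = sym (trans (+-congˡ -0#≈0#) (+-identityʳ _))
  fromℤ-⊖ zero (suc n) = sym (+-identityˡ _)
  fromℤ-⊖ (suc m) (suc n) = begin
    fromℤ (suc m ⊖ suc n)  ≡⟨ ≡.cong fromℤ (ℤₚ.[1+m]⊖[1+n]≡m⊖n m n) ⟩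
    fromℤ (m ⊖ n)  ≈⟨ fromℤ-⊖ m n ⟩
    m ×ᴿ 1# - n ×ᴿ 1# ≈⟨ +-congʳ (trans (+-congʳ (-‿inverseʳ 1#)) (+-identityˡ (m ×ᴿ 1#))) ⟨
    1# - 1# + m ×ᴿ 1# - n ×ᴿ 1# ≈⟨ +-congʳ (trans (+-assoc _ _ _) (trans (+-congˡ (+-comm _ _)) (sym (+-assoc _ _ _)))) ⟩
    1# + m ×ᴿ 1# - 1# - n ×ᴿ 1# ≈⟨ trans (+-assoc _ _ _) (+-congˡ (-‿+-comm 1# (n ×ᴿ 1#))) ⟩
    1# + m ×ᴿ 1# - (1# + n ×ᴿ 1#) ≈⟨ +-cong (1+× m 1#) (-‿cong (1+× n 1#)) ⟨
    suc m ×ᴿ 1# - suc n ×ᴿ 1# ∎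

  fromℤ-+ : ∀ i j → fromℤ (i ℤ.+ j) ≈ fromℤ i + fromℤ j
  fromℤ-+ (+ m) (+ n) = ×-homo-+ 1# m n
  fromℤ-+ (+ m) -[1+ n ] = fromℤ-⊖ m (suc n)
  fromℤ-+ -[1+ m ] (+ n) = trans (fromℤ-⊖ n (suc m)) (+-comm _ _)
  fromℤ-+ -[1+ m ] -[1+ n ] = begin
    - (suc (suc (m ℕ.+ n)) ×ᴿ 1#) ≡⟨ ≡.cong (λ k → - (k ×ᴿ 1#)) (≡.cong suc (ℕₚ.+-suc m n)) ⟨
    - ((suc m ℕ.+ suc n) ×ᴿ 1#) ≈⟨ -‿cong (×-homo-+ 1# (suc m) (suc n)) ⟩
    - (suc m ×ᴿ 1# + suc n ×ᴿ 1#) ≈⟨ -‿+-comm _ _ ⟨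
    - (suc m ×ᴿ 1#) - suc n ×ᴿ 1# ∎

  fromℤ-neg : ∀ i → fromℤ (ℤ.- i) ≈ - fromℤ i
  fromℤ-neg (+ zero) = sym -0#≈0#
  fromℤ-neg (+ suc n) = refl
  fromℤ-neg -[1+ n ] = sym (-‿involutive _)

  fromℤ-*⁺ : ∀ m j → fromℤ (+ m ℤ.* j) ≈ fromℤ (+ m) * fromℤ j
  fromℤ-*⁺ zero j = sym (zeroˡ _)
  fromℤ-*⁺ (suc m) j = begin
    fromℤ (+ suc m ℤ.* j)                 ≡⟨ ≡.cong fromℤ (ℤₚ.suc-* (+ m) j) ⟩
    fromℤ (j ℤ.+ + m ℤ.* j)               ≈⟨ fromℤ-+ j (+ m ℤ.* j) ⟩
    fromℤ j + fromℤ (+ m ℤ.* j)           ≈⟨ +-cong (sym (*-identityˡ _)) (fromℤ-*⁺ m j) ⟩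
    1# * fromℤ j + fromℤ (+ m) * fromℤ j  ≈⟨ distribʳ _ _ _ ⟨
    (1# + fromℤ (+ m)) * fromℤ j          ≈⟨ *-congʳ (1+× m 1#) ⟨
    fromℤ (+ suc m) * fromℤ j             ∎

  fromℤ-* : ∀ i j → fromℤ (i ℤ.* j) ≈ fromℤ i * fromℤ j
  fromℤ-* (+ m) j = fromℤ-*⁺ m j
  fromℤ-* -[1+ m ] j = begin
    fromℤ (-[1+ m ] ℤ.* j)         ≡⟨ ≡.cong fromℤ (ℤₚ.neg-distribˡ-* (+ suc m) j) ⟨
    fromℤ (ℤ.- (+ suc m ℤ.* j))    ≈⟨ fromℤ-neg (+ suc m ℤ.* j) ⟩
    - fromℤ (+ suc m ℤ.* j)        ≈⟨ -‿cong (fromℤ-*⁺ (suc m) j) ⟩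
    - (fromℤ (+ suc m) * fromℤ j)  ≈⟨ -‿distribˡ-* _ _ ⟩
    fromℤ -[1+ m ] * fromℤ j       ∎

  morphism : ℤ.+-*-rawRing -Raw-AlmostCommutative⟶ fromCommutativeRing R
  morphism = record { ⟦_⟧ = fromℤ ; +-homo = fromℤ-+ ; *-homo = fromℤ-* ; -‿homo = fromℤ-neg
                    ; 0-homo = refl ; 1-homo = refl }

  weaklyDecidable : ∀ i j → Maybe (fromℤ i ≈ fromℤ j)
  weaklyDecidable i j with i ℤₚ.≟ j
  ... | yes i≡j = just (reflexive (≡.cong fromℤ i≡j))
  ... | no  _   = nothing

  open RingSolver ℤ.+-*-rawRing (fromCommutativeRing R) morphism weaklyDecidable hiding (solve) public
  private module Solver = RingSolver ℤ.+-*-rawRing (fromCommutativeRing R) morphism weaklyDecidable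

  equation : ∀ n → N-ary n (Polynomial n) (Polynomial n × Polynomial n) → Polynomial n × Polynomial n
  equation n e = e $ⁿ Vec.map var (Vec.allFin n)

  -- Deciding the equality of the normal forms, instead of proving it by
  -- reflexivity, keeps their interpretations in R out of the proof terms.
  solve : ∀ n (e : N-ary n (Polynomial n) (Polynomial n × Polynomial n)) →
          let lhs , rhs = equation n e in
          {Bool.T (is-just (normalise lhs ≟N normalise rhs))} →
          Eq n _≈_ (curryⁿ ⟦ lhs ⟧) (curryⁿ ⟦ rhs ⟧)
  solve n e {decided} with normalise (proj₁ (equation n e)) ≟N normalise (proj₂ (equation n e))
  ... | just eq = Solver.solve n e (Eq-to-Eqʰ n _≈_ (curryⁿ-cong _≈_ ⟦ proj₁ (equation n e) ⟧↓ ⟦ proj₂ (equation n e) ⟧↓ (⟦ eq ⟧N-cong)))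

-- Cardinalities of setoids and pigeonhole principles

infixr 2 _×-finite_

_×-finite_ : ∀ {m n} {A : Setoid ℓa ℓ} {B : Setoid ℓb ℓ′} →
             FiniteSetoid m A → FiniteSetoid n B → FiniteSetoid (m ℕ.* n) (A ×ₛ B)
_×-finite_ {m = m} {n} f g = Compose.inverse (Compose.inverse (f ×-inverse g) Pointwise-≡↔≡) (inv (Finₚ.*↔× {m} {n}))
  where
  inv : ∀ {A : Set} {k} → Inverse (≡.setoid (Fin k)) (≡.setoid A) → Inverse (≡.setoid A) (≡.setoid (Fin k))
  inv i = record { to = from ; from = to ; to-cong = from-cong ; from-cong = to-cong
                 ; inverse = (λ { ≡.refl → strictlyInverseʳ _ }) , (λ { ≡.refl → strictlyInverseˡ _ }) }
    where open Inverse i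

vectorSetoid : Setoid c ℓ → ℕ → Setoid c ℓ
vectorSetoid S n = record
  { Carrier = Vector Carrier n
  ; _≈_ = λ v w → ∀ i → v i ≈ w i
  ; isEquivalence = record { refl = λ i → refl ; sym = λ v≈w i → sym (v≈w i)
                           ; trans = λ u≈v v≈w i → trans (u≈v i) (v≈w i) }
  }
  where open Setoid S

finite-vector : ∀ {m} {S : Setoid c ℓ} n → FiniteSetoid m S → FiniteSetoid (m ℕ.^ n) (vectorSetoid S n)
finite-vector {m = m} {S} n f = record
  { to        = λ v → Fin.funToFin (to ∘ v)
  ; from      = λ k i → from (Fin.finToFun {m} {n} k i)
  ; to-cong   = λ v≈w → funToFin-cong (λ i → to-cong (v≈w i))
  ; from-cong = λ { ≡.refl i → refl }
  ; inverse   = (λ {k} v≈ → ≡.trans (funToFin-cong λ i → ≡.trans (to-cong (v≈ i)) (strictlyInverseˡ _))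
                              (Finₚ.funToFin-finToFin {n} {m} k))
              , (λ { {v} ≡.refl i → trans (from-cong (Finₚ.finToFun-funToFin (to ∘ v) i)) (strictlyInverseʳ (v i)) })
  }
  where
  open Inverse f
  open Setoid S
  funToFin-cong : ∀ {n} {g h : Fin n → Fin m} → (∀ i → g i ≡ h i) → Fin.funToFin g ≡ Fin.funToFin h
  funToFin-cong {zero}  g≗h = ≡.refl
  funToFin-cong {suc n} g≗h = ≡.cong₂ Fin.combine (g≗h zero) (funToFin-cong (g≗h ∘ suc))

-- The substitute for rank-nullity: when f is additive, the difference of the two elements is a
-- nonzero element of its kernel.
collision : ∀ {m n} {A : Setoid ℓa ℓ} {B : Setoid ℓb ℓ′} → FiniteSetoid n A → FiniteSetoid m B → m < n →
            (f : Setoid.Carrier A → Setoid.Carrier B) →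
            ∃₂ λ x y → ¬ Setoid._≈_ A x y × Setoid._≈_ B (f x) (f y)
collision {A = A} {B} α β m<n f with Finₚ.pigeonhole m<n (B.to ∘ f ∘ A.from)
  where module A = Inverse α
        module B = Inverse β
... | i , j , i<j , fi≡fj = A.from i , A.from j
    , (λ x≈y → Finₚ.<⇒≢ i<j (≡.trans (≡.sym (A.strictlyInverseˡ i)) (≡.trans (A.to-cong x≈y) (A.strictlyInverseˡ j))))
    , trans (sym (B.strictlyInverseʳ _)) (trans (B.from-cong fi≡fj) (B.strictlyInverseʳ _))
  where module A = Inverse α
        module B = Inverse β
        open Setoid B

record Partition {A : Set ℓa} (P : Pred A ℓp) {n} (v : Vector A n) : Set (ℓa Level.⊔ ℓp) where
  field
    #in #out : ℕ
    total      : #in ℕ.+ #out ≡ n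
    in-        : Vector (Fin n) #in
    out        : Vector (Fin n) #out
    in-inj     : Injectiveᵥ in-
    out-inj    : Injectiveᵥ out
    in-P       : ∀ i → P (v (in- i))
    out-¬P     : ∀ i → ¬ P (v (out i))

partition : ∀ {A : Set ℓa} {P : Pred A ℓp} → Decidable P → ∀ {n} (v : Vector A n) → Partition P v
partition P? {zero} v = record
  { #in = 0 ; #out = 0 ; total = ≡.refl ; in- = λ () ; out = λ () ; in-inj = λ () ; out-inj = λ () ; in-P = λ () ; out-¬P = λ () }
partition P? {suc n} v with P? (v zero) | partition P? (v ∘ suc)
... | yes pv | r = record
  { #in = suc #in ; #out = #out ; total = ≡.cong suc total ; in- = λ { zero → zero ; (suc i) → suc (in- i) } ; out = suc ∘ out
  ; in-inj = λ { zero zero _ → ≡.refl ; (suc i) (suc j) eq → ≡.cong suc (in-inj i j (Finₚ.suc-injective eq)) }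
  ; out-inj = λ i j eq → out-inj i j (Finₚ.suc-injective eq)
  ; in-P = λ { zero → pv ; (suc i) → in-P i } ; out-¬P = out-¬P }
  where open Partition r
... | no ¬pv | r = record
  { #in = #in ; #out = suc #out ; total = ≡.trans (ℕₚ.+-suc #in #out) (≡.cong suc total) ; in- = suc ∘ in- ; out = λ { zero → zero ; (suc i) → suc (out i) }
  ; out-inj = λ { zero zero _ → ≡.refl ; (suc i) (suc j) eq → ≡.cong suc (out-inj i j (Finₚ.suc-injective eq)) }
  ; in-inj = λ i j eq → in-inj i j (Finₚ.suc-injective eq)
  ; out-¬P = λ { zero → ¬pv ; (suc i) → out-¬P i } ; in-P = in-P }
  where open Partition r

-- Induction on the number of colours. Either colour zero already has more than k elements, or
-- discarding its at most k elements leaves enough for the remaining colours.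
fibre-pigeonhole : ∀ {n} m k → m ℕ.* k < n → (f : Fin n → Fin m) →
                   ∃ λ (g : Vector (Fin n) (suc k)) → Injectiveᵥ g × (∀ i j → f (g i) ≡ f (g j))
fibre-pigeonhole {suc n} zero    k _    f with f zero
... | ()
fibre-pigeonhole {n} (suc m) k mk<n f with partition (Finₚ._≟ zero) f
... | record { #in = #in ; #out = #out ; total = total ; in- = in- ; out = out ; in-inj = in-inj ; out-inj = out-inj ; in-P = in-P ; out-¬P = out-¬P }
  with k ℕₚ.<? #in
... | yes k<#in = (λ i → in- (Fin.inject≤ i k<#in))
    , (λ i j eq → Finₚ.inject≤-injective k<#in k<#in i j (in-inj _ _ eq))
    , (λ i j → ≡.trans (in-P _) (≡.sym (in-P _)))
... | no k≮#in = out ∘ g , (λ i j eq → g-inj i j (out-inj _ _ eq))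
    , (λ i j → Finₚ.punchOut-injective (zero≢ (g i)) (zero≢ (g j)) (g-const i j))
  where
  mk<#out : m ℕ.* k < #out
  mk<#out = ℕₚ.+-cancelˡ-< k _ _ (ℕₚ.<-≤-trans mk<n
              (ℕₚ.≤-trans (ℕₚ.≤-reflexive (≡.sym total)) (ℕₚ.+-monoˡ-≤ #out (ℕₚ.≮⇒≥ k≮#in))))
  zero≢ : ∀ i → zero ≢ f (out i)
  zero≢ i 0≡ = out-¬P i (≡.sym 0≡)
  rest : ∃ λ (g : Vector (Fin #out) (suc k)) → Injectiveᵥ g ×
           (∀ i j → Fin.punchOut (zero≢ (g i)) ≡ Fin.punchOut (zero≢ (g j)))
  rest = fibre-pigeonhole m k mk<#out (λ i → Fin.punchOut (zero≢ i))
  g = proj₁ rest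
  g-inj = proj₁ (proj₂ rest)
  g-const = proj₂ (proj₂ rest)

-- Finite fields and polynomial functions

module FiniteField {n} (F : CommutativeRing c ℓ) (isFiniteField : IsFiniteField n F) where
  open CommutativeRing F public hiding (zero)
  open IsFiniteField isFiniteField public renaming (inverse to inverse-exists)
  open RingProperties ring public
  open IntegerCoefficients F using (solve; _:=_; _:+_; _:*_; _:-_; :-_; con) public
  open Exp semiring using (_^_; ^-congˡ) public
  open Inverse order public using () renaming
    (to to index; from to element; to-cong to index-cong; strictlyInverseˡ to index-element; strictlyInverseʳ to element-index)
  open SetoidReasoning setoid

  infix 4 _≟_
  _≟_ : ∀ x y → Dec (x ≈ y)
  x ≟ y = Dec.map′ (λ eq → trans (sym (element-index x)) (trans (reflexive (≡.cong element eq)) (element-index y)))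
                   index-cong (index x Finₚ.≟ index y)

  element-injective : ∀ {i j} → element i ≈ element j → i ≡ j
  element-injective eq = ≡.trans (≡.sym (index-element _)) (≡.trans (index-cong eq) (index-element _))

  search : ∀ {P : Carrier → Set ℓp} → (∀ {x y} → x ≈ y → P x → P y) → (∀ x → Dec (P x)) → Dec (∃ P)
  search resp P? = Dec.map′ (λ { (i , Pi) → element i , Pi }) (λ { (x , Px) → index x , resp (sym (element-index x)) Px })
                            (Finₚ.any? (λ i → P? (element i)))

  1<order : 1 < n
  1<order = go (index 0#) (index 1#) λ eq →
      1≉0 (trans (sym (element-index 1#)) (trans (reflexive (≡.cong element (≡.sym eq))) (element-index 0#)))
    where
    go : ∀ {m} (i j : Fin m) → i ≢ j → 1 < m
    go {suc zero}    zero zero i≢j = contradiction ≡.refl i≢j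
    go {suc (suc m)} _    _    _   = s≤s (s≤s z≤n)

  infixl 9 _⁻¹
  _⁻¹ : Carrier → Carrier
  x ⁻¹ with x ≟ 0#
  ... | yes _  = 0#
  ... | no x≉0 = proj₁ (inverse-exists x x≉0)

  ⁻¹-inverseʳ : ∀ {x} → x ≉ 0# → x * x ⁻¹ ≈ 1#
  ⁻¹-inverseʳ {x} x≉0 with x ≟ 0#
  ... | yes x≈0 = contradiction x≈0 x≉0
  ... | no x≉0  = proj₂ (inverse-exists x x≉0)

  ⁻¹-inverseˡ : ∀ {x} → x ≉ 0# → x ⁻¹ * x ≈ 1#
  ⁻¹-inverseˡ x≉0 = trans (*-comm _ _) (⁻¹-inverseʳ x≉0)

  *-cancelˡ : ∀ {x y z} → x ≉ 0# → x * y ≈ x * z → y ≈ z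
  *-cancelˡ {x} {y} {z} x≉0 eq = begin
    y               ≈⟨ *-identityˡ y ⟨
    1# * y          ≈⟨ *-congʳ (⁻¹-inverseˡ x≉0) ⟨
    x ⁻¹ * x * y    ≈⟨ *-assoc _ _ _ ⟩
    x ⁻¹ * (x * y)  ≈⟨ *-congˡ eq ⟩
    x ⁻¹ * (x * z)  ≈⟨ *-assoc _ _ _ ⟨
    x ⁻¹ * x * z    ≈⟨ *-congʳ (⁻¹-inverseˡ x≉0) ⟩
    1# * z          ≈⟨ *-identityˡ z ⟩
    z               ∎

  *-zero : ∀ {x y} → x * y ≈ 0# → x ≈ 0# ⊎ y ≈ 0#
  *-zero {x} {y} xy≈0 with x ≟ 0#
  ... | yes x≈0 = inj₁ x≈0
  ... | no  x≉0 = inj₂ (*-cancelˡ x≉0 (trans xy≈0 (sym (zeroʳ x))))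

  *-nonzero : ∀ {x y} → x ≉ 0# → y ≉ 0# → x * y ≉ 0#
  *-nonzero x≉0 y≉0 xy≈0 = [ x≉0 , y≉0 ]′ (*-zero xy≈0)

  *-zeroʳ⁻ : ∀ {x y} → x ≉ 0# → x * y ≈ 0# → y ≈ 0#
  *-zeroʳ⁻ x≉0 xy≈0 = [ (λ x≈0 → contradiction x≈0 x≉0) , id ]′ (*-zero xy≈0)

  x-y≈0⇒x≈y : ∀ {x y} → x - y ≈ 0# → x ≈ y
  x-y≈0⇒x≈y {x} {y} eq = begin
    x          ≈⟨ solve 2 (λ x y → x := x :- y :+ y) x y ⟩
    x - y + y  ≈⟨ +-congʳ eq ⟩
    0# + y     ≈⟨ +-identityˡ y ⟩
    y          ∎

  x≈y⇒x-y≈0 : ∀ {x y} → x ≈ y → x - y ≈ 0#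
  x≈y⇒x-y≈0 {x} {y} eq = trans (+-congʳ eq) (-‿inverseʳ y)

  private module ∏ = CommutativeMonoidSum *-commutativeMonoid

  0^[1+n]≈0 : ∀ n {x} → x ≈ 0# → x ^ suc n ≈ 0#
  0^[1+n]≈0 n x≈0 = trans (*-congʳ x≈0) (zeroˡ _)

  module _ {x} (x≉0 : x ≉ 0#) where
    private
      -- Replacing 0 by 1 makes the product over the whole field nonzero, so the permutation y ↦ x y
      -- can be applied to the given enumeration of the field without enumerating its units.
      nonzeroPart : Carrier → Carrier
      nonzeroPart y with y ≟ 0#
      ... | yes _ = 1#
      ... | no  _ = y

      factor : Carrier → Carrier
      factor y with y ≟ 0#
      ... | yes _ = 1#
      ... | no  _ = x

      nonzeroPart-cong : ∀ {y z} → y ≈ z → nonzeroPart y ≈ nonzeroPart z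
      nonzeroPart-cong {y} {z} y≈z with y ≟ 0# | z ≟ 0#
      ... | yes _   | yes _   = refl
      ... | no  _   | no  _   = y≈z
      ... | yes y≈0 | no  z≉0 = contradiction (trans (sym y≈z) y≈0) z≉0
      ... | no  y≉0 | yes z≈0 = contradiction (trans y≈z z≈0) y≉0

      nonzeroPart-nonzero : ∀ y → nonzeroPart y ≉ 0#
      nonzeroPart-nonzero y with y ≟ 0#
      ... | yes _   = 1≉0
      ... | no  y≉0 = y≉0

      nonzeroPart-* : ∀ y → nonzeroPart (x * y) ≈ factor y * nonzeroPart y
      nonzeroPart-* y with y ≟ 0# | x * y ≟ 0#
      ... | yes _   | yes _    = sym (*-identityˡ 1#)
      ... | no  _   | no  _    = refl
      ... | yes y≈0 | no  xy≉0 = contradiction (trans (*-congˡ y≈0) (zeroʳ x)) xy≉0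
      ... | no  y≉0 | yes xy≈0 = contradiction xy≈0 (*-nonzero x≉0 y≉0)

      factor-nonzero : ∀ {y} → y ≉ 0# → factor y ≈ x
      factor-nonzero {y} y≉0 with y ≟ 0#
      ... | yes y≈0 = contradiction y≈0 y≉0
      ... | no  _   = refl

      factor-zero : ∀ {y} → y ≈ 0# → factor y ≈ 1#
      factor-zero {y} y≈0 with y ≟ 0#
      ... | yes _   = refl
      ... | no  y≉0 = contradiction y≈0 y≉0

      π : Permutation.Permutation n n
      π = Permutation.permutation (λ i → index (x * element i)) (λ i → index (x ⁻¹ * element i))
            (λ i → inv (⁻¹-inverseʳ x≉0) i)
            (λ i → inv (⁻¹-inverseˡ x≉0) i)
        where
        inv : ∀ {u v} → u * v ≈ 1# → ∀ i → index (u * element (index (v * element i))) ≡ i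
        inv {u} {v} uv≈1 i = ≡.trans (index-cong (begin
          u * element (index (v * element i))  ≈⟨ *-congˡ (element-index _) ⟩
          u * (v * element i)                  ≈⟨ *-assoc _ _ _ ⟨
          u * v * element i                    ≈⟨ *-congʳ uv≈1 ⟩
          1# * element i                       ≈⟨ *-identityˡ _ ⟩
          element i                            ∎)) (index-element i)

      ∏-nonzero : ∀ {m} (f : Fin m → Carrier) → (∀ i → f i ≉ 0#) → ∏.sum f ≉ 0#
      ∏-nonzero {zero}  f f≉0 = 1≉0
      ∏-nonzero {suc m} f f≉0 = *-nonzero (f≉0 zero) (∏-nonzero (f ∘ suc) (f≉0 ∘ suc))

      -- Multiplication by x permutes the field and therefore preserves the product G of the nonzero
      -- elements; term by term it also multiplies G by the product of the factors.
      ∏-factor : ∏.sum (factor ∘ element) ≈ 1#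
      ∏-factor = *-cancelˡ (∏-nonzero (nonzeroPart ∘ element) (nonzeroPart-nonzero ∘ element)) (begin
        G * ∏.sum (factor ∘ element)                             ≈⟨ *-comm _ _ ⟩
        ∏.sum (factor ∘ element) * G                             ≈⟨ ∏.∑-distrib-+ (factor ∘ element) (nonzeroPart ∘ element) ⟨
        ∏.sum (λ i → factor (element i) * nonzeroPart (element i))
          ≈⟨ ∏.sum-cong-≋ (λ i → trans (nonzeroPart-cong (element-index _)) (nonzeroPart-* (element i))) ⟨
        ∏.sum (λ i → nonzeroPart (element (index (x * element i))))  ≈⟨ ∏.sum-permute (nonzeroPart ∘ element) π ⟨
        G                                                        ≈⟨ *-identityʳ G ⟨
        G * 1#                                                   ∎)
        where G = ∏.sum (nonzeroPart ∘ element)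

      -- The factor is x at every index except i₀, where it is 1. The additional x on the left makes
      -- up for this one, which gives the exponent m instead of m - 1.
      power : ∀ m (e : Fin m → Carrier) (i₀ : Fin m) → e i₀ ≈ 0# → (∀ i → i ≢ i₀ → e i ≉ 0#) →
              x * ∏.sum (factor ∘ e) ≈ x ^ m
      power (suc m) e i₀ e₀≈0 e≉0 = *-congˡ (begin
        ∏.sum (factor ∘ e)                                       ≈⟨ ∏.sum-remove (factor ∘ e) ⟩
        factor (e i₀) * ∏.sum (λ i → factor (e (Fin.punchIn i₀ i)))
          ≈⟨ *-cong (factor-zero e₀≈0) (∏.sum-cong-≋ λ i → factor-nonzero (e≉0 _ (Finₚ.punchInᵢ≢i i₀ i))) ⟩
        1# * ∏.sum {m} (λ _ → x)                                 ≈⟨ *-identityˡ _ ⟩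
        ∏.sum {m} (λ _ → x)                                      ≈⟨ ∏.sum-replicate m ⟩
        x ^ m                                                    ∎)

    fermat-nonzero : x ^ n ≈ x
    fermat-nonzero = begin
      x ^ n                         ≈⟨ power n element (index 0#) (element-index 0#)
                                         (λ i i≢ ei≈0 → i≢ (element-injective (trans ei≈0 (sym (element-index 0#))))) ⟨
      x * ∏.sum (factor ∘ element)  ≈⟨ *-congˡ ∏-factor ⟩
      x * 1#                        ≈⟨ *-identityʳ x ⟩
      x                             ∎

  private
    order-positive : ∀ {m} → Fin m → ∃ λ k → m ≡ suc k
    order-positive {suc m} _ = m , ≡.refl

  fermat : ∀ x → x ^ n ≈ x
  fermat x with x ≟ 0#
  ... | no  x≉0 = fermat-nonzero x≉0
  ... | yes x≈0 with order-positive (index x)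
  ...   | m , eq = trans (reflexive (≡.cong (x ^_) eq)) (trans (0^[1+n]≈0 m x≈0) (sym x≈0))

  -- f is a polynomial function of degree at most m whose coefficient in degree
  -- m is a.
  IsPoly : ℕ → Carrier → (Carrier → Carrier) → Set _
  IsPoly zero    a f = ∀ x → f x ≈ a
  IsPoly (suc m) a f = ∃₂ λ g b → IsPoly m a g × (∀ x → f x ≈ x * g x + b)

  poly-cong : ∀ m {a b f g} → a ≈ b → (∀ x → f x ≈ g x) → IsPoly m a f → IsPoly m b g
  poly-cong zero    a≈b f≈g P = λ x → trans (sym (f≈g x)) (trans (P x) a≈b)
  poly-cong (suc m) a≈b f≈g (h , c , P , eq) = h , c , poly-cong m a≈b (λ _ → refl) P , λ x → trans (sym (f≈g x)) (eq x)

  poly-+ : ∀ m {a b f g} → IsPoly m a f → IsPoly m b g → IsPoly m (a + b) (λ x → f x + g x)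
  poly-+ zero    P Q = λ x → +-cong (P x) (Q x)
  poly-+ (suc m) (f , c , P , eq) (g , d , Q , eq′) = (λ x → f x + g x) , c + d , poly-+ m P Q ,
    λ x → trans (+-cong (eq x) (eq′ x))
      (solve 5 (λ x f c g d → x :* f :+ c :+ (x :* g :+ d) := x :* (f :+ g) :+ (c :+ d)) x (f x) c (g x) d)

  poly-scale : ∀ m {a f} k → IsPoly m a f → IsPoly m (k * a) (λ x → k * f x)
  poly-scale zero    k P = λ x → *-congˡ (P x)
  poly-scale (suc m) k (f , c , P , eq) = (λ x → k * f x) , k * c , poly-scale m k P ,
    λ x → trans (*-congˡ (eq x)) (solve 4 (λ k x f c → k :* (x :* f :+ c) := x :* (k :* f) :+ k :* c) k x (f x) c)

  poly-neg : ∀ m {a f} → IsPoly m a f → IsPoly m (- a) (λ x → - f x)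
  poly-neg m {a} {f} P = poly-cong m (-1*x≈-x a) (λ x → -1*x≈-x (f x)) (poly-scale m (- 1#) P)

  poly-x* : ∀ m {a f} → IsPoly m a f → IsPoly (suc m) a (λ x → x * f x)
  poly-x* m P = _ , 0# , P , λ x → sym (+-identityʳ _)

  poly-raise : ∀ m {k a f} → IsPoly m a f → m < k → IsPoly k 0# f
  poly-raise zero    {suc zero}    {a} P _ = (λ _ → 0#) , a , (λ _ → refl) , λ x →
    trans (P x) (sym (trans (+-congʳ (zeroʳ x)) (+-identityˡ a)))
  poly-raise zero    {suc (suc k)} {a} P _ = (λ _ → 0#) , a , poly-raise zero {a = 0#} (λ _ → refl) (s≤s z≤n) , λ x →
    trans (P x) (sym (trans (+-congʳ (zeroʳ x)) (+-identityˡ a)))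
  poly-raise (suc m) {suc k} (f , c , P , eq) (s≤s m<k) = f , c , poly-raise m P m<k , eq

  poly-const : ∀ a → IsPoly 0 a (λ _ → a)
  poly-const a = λ _ → refl

  poly-linear : ∀ a b → IsPoly 1 a (λ x → a * x + b)
  poly-linear a b = (λ _ → a) , b , poly-const a , λ x → +-congʳ (*-comm a x)

  poly-* : ∀ m k {a b f g} → IsPoly m a f → IsPoly k b g → IsPoly (m ℕ.+ k) (a * b) (λ x → f x * g x)
  poly-* zero    k P Q = poly-cong k refl (λ x → *-congʳ (sym (P x))) (poly-scale k _ Q)
  poly-* (suc m) k {a} {b} {_} {g} (f , c , P , eq) Q = poly-cong (suc m ℕ.+ k) (+-identityʳ _)
    (λ x → sym (trans (*-congʳ (eq x)) (trans (distribʳ (g x) _ c) (+-congʳ (*-assoc x (f x) (g x))))))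
    (poly-+ (suc m ℕ.+ k) (poly-x* (m ℕ.+ k) (poly-* m k P Q)) (poly-raise k (poly-scale k c Q) (s≤s (ℕₚ.m≤n+m k m))))

  poly-^ : ∀ m → IsPoly m 1# (_^ m)
  poly-^ zero    = poly-const 1#
  poly-^ (suc m) = poly-x* m (poly-^ m)

  -- Horner's scheme: if k is the quotient of h by x - r, then the quotient of x h + b is x k +
  -- h(r).
  poly-factor : ∀ m {a f} r → IsPoly (suc m) a f → ∃ λ g → IsPoly m a g × (∀ x → f x ≈ (x - r) * g x + f r)
  poly-factor zero {a} r (g , b , P , eq) = g , P , λ x → begin
    _                              ≈⟨ eq x ⟩
    x * g x + b                    ≈⟨ solve 4 (λ x r b g → x :* g :+ b := (x :- r) :* g :+ (r :* g :+ b)) x r b (g x) ⟩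
    (x - r) * g x + (r * g x + b)  ≈⟨ +-congˡ (+-congʳ (*-congˡ (trans (P x) (sym (P r))))) ⟩
    (x - r) * g x + (r * g r + b)  ≈⟨ +-congˡ (eq r) ⟨
    _                              ∎
  poly-factor (suc m) {a} r (h , b , P , eq) with poly-factor m r P
  ... | k , Q , eq′ = (λ x → x * k x + h r) , (k , h r , Q , λ _ → refl) , λ x → begin
    _                                               ≈⟨ eq x ⟩
    x * h x + b                                     ≈⟨ +-congʳ (*-congˡ (eq′ x)) ⟩
    x * ((x - r) * k x + h r) + b                   ≈⟨ solve 5 (λ x r b k h → x :* ((x :- r) :* k :+ h) :+ b :=
                                                         (x :- r) :* (x :* k :+ h) :+ (r :* h :+ b)) x r b (k x) (h r) ⟩
    (x - r) * (x * k x + h r) + (r * h r + b)       ≈⟨ +-congˡ (eq r) ⟨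
    _                                               ∎

  Distinct : ∀ {m} → Vector Carrier m → Set _
  Distinct v = ∀ i j → v i ≈ v j → i ≡ j

  -- Splits off one root at a time. The conclusion about the leading coefficient serves two
  -- purposes: a contradiction when it is 1, and an equation when it involves the coefficients of
  -- functionals.
  poly-roots : ∀ m {a f} → IsPoly m a f → (v : Vector Carrier (suc m)) → Distinct v → (∀ i → f (v i) ≈ 0#) → a ≈ 0#
  poly-roots zero    P v _        f≈0 = trans (sym (P (v zero))) (f≈0 zero)
  poly-roots (suc m) P v distinct f≈0 with poly-factor m (v zero) P
  ... | g , Q , eq = poly-roots m Q (v ∘ suc) (λ i j vi≈vj → Finₚ.suc-injective (distinct _ _ vi≈vj)) λ i →
    *-zeroʳ⁻ (λ d≈0 → Finₚ.0≢1+n (≡.sym (distinct (suc i) zero (x-y≈0⇒x≈y d≈0))))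
      (trans (sym (trans (eq (v (suc i))) (trans (+-congˡ (f≈0 zero)) (+-identityʳ _)))) (f≈0 (suc i)))

-- Quadratic extensions

-- L[ρ] with ρ² = rρ + s, elements a + bρ being represented as pairs (a , b).
module QuadraticExtension {n} (L : CommutativeRing c ℓ) (L-finite : IsFiniteField n L)
  (r s : CommutativeRing.Carrier L) where
  open FiniteField L L-finite

  private
    infix 4 _≈ᴹ_
    _≈ᴹ_ : Carrier × Carrier → Carrier × Carrier → Set ℓ
    (a , b) ≈ᴹ (c , d) = a ≈ c × b ≈ d

    _+ᴹ_ _*ᴹ_ : Carrier × Carrier → Carrier × Carrier → Carrier × Carrier
    (a , b) +ᴹ (c , d) = a + c , b + d
    (a , b) *ᴹ (c , d) = a * c + s * (b * d) , a * d + b * c + r * (b * d)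

    -ᴹ_ : Carrier × Carrier → Carrier × Carrier
    -ᴹ (a , b) = - a , - b

    0ᴹ 1ᴹ : Carrier × Carrier
    0ᴹ = 0# , 0#
    1ᴹ = 1# , 0#

    *ᴹ-comm : ∀ x y → x *ᴹ y ≈ᴹ y *ᴹ x
    *ᴹ-comm (a , b) (c , d) =
        solve 5 (λ s a b c d → a :* c :+ s :* (b :* d) := c :* a :+ s :* (d :* b)) s a b c d
      , solve 5 (λ r a b c d → a :* d :+ b :* c :+ r :* (b :* d) := c :* b :+ d :* a :+ r :* (d :* b)) r a b c d

    *ᴹ-identityˡ : ∀ x → 1ᴹ *ᴹ x ≈ᴹ x
    *ᴹ-identityˡ (a , b) =
        solve 3 (λ s a b → con (+ 1) :* a :+ s :* (con (+ 0) :* b) := a) s a b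
      , solve 3 (λ r a b → con (+ 1) :* b :+ con (+ 0) :* a :+ r :* (con (+ 0) :* b) := b) r a b

    *ᴹ-assoc : ∀ x y z → (x *ᴹ y) *ᴹ z ≈ᴹ x *ᴹ (y *ᴹ z)
    *ᴹ-assoc (a , b) (c , d) (e , f) =
        solve 8 (λ r s a b c d e f →
          (a :* c :+ s :* (b :* d)) :* e :+ s :* ((a :* d :+ b :* c :+ r :* (b :* d)) :* f)
          := a :* (c :* e :+ s :* (d :* f)) :+ s :* (b :* (c :* f :+ d :* e :+ r :* (d :* f)))) r s a b c d e f
      , solve 8 (λ r s a b c d e f →
          (a :* c :+ s :* (b :* d)) :* f :+ (a :* d :+ b :* c :+ r :* (b :* d)) :* e :+ r :* ((a :* d :+ b :* c :+ r :* (b :* d)) :* f)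
          := a :* (c :* f :+ d :* e :+ r :* (d :* f)) :+ b :* (c :* e :+ s :* (d :* f)) :+ r :* (b :* (c :* f :+ d :* e :+ r :* (d :* f)))) r s a b c d e f

    *ᴹ-distribˡ : ∀ x y z → x *ᴹ (y +ᴹ z) ≈ᴹ (x *ᴹ y) +ᴹ (x *ᴹ z)
    *ᴹ-distribˡ (a , b) (c , d) (e , f) =
        solve 7 (λ s a b c d e f →
          a :* (c :+ e) :+ s :* (b :* (d :+ f)) := a :* c :+ s :* (b :* d) :+ (a :* e :+ s :* (b :* f))) s a b c d e f
      , solve 7 (λ r a b c d e f →
          a :* (d :+ f) :+ b :* (c :+ e) :+ r :* (b :* (d :+ f))
          := a :* d :+ b :* c :+ r :* (b :* d) :+ (a :* f :+ b :* e :+ r :* (b :* f))) r a b c d e f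

    *ᴹ-cong : ∀ {x y u v} → x ≈ᴹ y → u ≈ᴹ v → x *ᴹ u ≈ᴹ y *ᴹ v
    *ᴹ-cong (a≈a′ , b≈b′) (c≈c′ , d≈d′) =
        +-cong (*-cong a≈a′ c≈c′) (*-congˡ (*-cong b≈b′ d≈d′))
      , +-cong (+-cong (*-cong a≈a′ d≈d′) (*-cong b≈b′ c≈c′)) (*-congˡ (*-cong b≈b′ d≈d′))

    ≈ᴹ-trans : ∀ {x y z} → x ≈ᴹ y → y ≈ᴹ z → x ≈ᴹ z
    ≈ᴹ-trans (p , q) (p′ , q′) = trans p p′ , trans q q′

    ≈ᴹ-sym : ∀ {x y} → x ≈ᴹ y → y ≈ᴹ x
    ≈ᴹ-sym (p , q) = sym p , sym q

    +ᴹ-cong : ∀ {x y u v} → x ≈ᴹ y → u ≈ᴹ v → (x +ᴹ u) ≈ᴹ (y +ᴹ v)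
    +ᴹ-cong (p , q) (p′ , q′) = +-cong p p′ , +-cong q q′

  extension : CommutativeRing c ℓ
  extension = record
    { Carrier = Carrier × Carrier
    ; _≈_ = _≈ᴹ_ ; _+_ = _+ᴹ_ ; _*_ = _*ᴹ_ ; -_ = -ᴹ_ ; 0# = 0ᴹ ; 1# = 1ᴹ
    ; isCommutativeRing = record
      { isRing = record
        { +-isAbelianGroup = record
          { isGroup = record
            { isMonoid = record
              { isSemigroup = record
                { isMagma = record
                  { isEquivalence = record { refl = refl , refl ; sym = ≈ᴹ-sym ; trans = ≈ᴹ-trans }
                  ; ∙-cong = +ᴹ-cong }
                ; assoc = λ (a , b) (c , d) (e , f) → +-assoc a c e , +-assoc b d f }
              ; identity = (λ (a , b) → +-identityˡ a , +-identityˡ b) , (λ (a , b) → +-identityʳ a , +-identityʳ b) }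
            ; inverse = (λ (a , b) → -‿inverseˡ a , -‿inverseˡ b) , (λ (a , b) → -‿inverseʳ a , -‿inverseʳ b)
            ; ⁻¹-cong = λ (p , q) → -‿cong p , -‿cong q }
          ; comm = λ (a , b) (c , d) → +-comm a c , +-comm b d }
        ; *-cong = *ᴹ-cong
        ; *-assoc = *ᴹ-assoc
        ; *-identity = *ᴹ-identityˡ , λ x → ≈ᴹ-trans (*ᴹ-comm x 1ᴹ) (*ᴹ-identityˡ x)
        ; distrib = *ᴹ-distribˡ , λ x y z → ≈ᴹ-trans (*ᴹ-comm (y +ᴹ z) x)
            (≈ᴹ-trans (*ᴹ-distribˡ x y z) (+ᴹ-cong (*ᴹ-comm x y) (*ᴹ-comm x z)))
        }
      ; *-comm = *ᴹ-comm
      }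
    }

  embed : Carrier → Carrier × Carrier
  embed a = a , 0#

  embed-hom : Extension.IsEmbedding L extension embed
  embed-hom = record
    { isSemiringHomomorphism = record
      { isNearSemiringHomomorphism = record
        { +-isMonoidHomomorphism = record
          { isMagmaHomomorphism = record
            { isRelHomomorphism = record { cong = λ a≈b → a≈b , refl }
            ; homo = λ a b → refl , sym (+-identityʳ 0#) }
          ; ε-homo = refl , refl }
        ; *-homo = λ a b →
            solve 3 (λ s a b → a :* b := a :* b :+ s :* (con (+ 0) :* con (+ 0))) s a b
          , solve 3 (λ r a b → con (+ 0) := a :* con (+ 0) :+ con (+ 0) :* b :+ r :* (con (+ 0) :* con (+ 0))) r a b }
      ; 1#-homo = refl , refl }
    ; -‿homo = λ a → refl , sym -0#≈0# }

  root : Carrier × Carrier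
  root = 0# , 1#

  root-equation : root *ᴹ root ≈ᴹ (embed r *ᴹ root) +ᴹ embed s
  root-equation =
      solve 2 (λ r s → con (+ 0) :* con (+ 0) :+ s :* (con (+ 1) :* con (+ 1))
        := r :* con (+ 0) :+ s :* (con (+ 0) :* con (+ 1)) :+ s) r s
    , solve 2 (λ r s → con (+ 0) :* con (+ 1) :+ con (+ 1) :* con (+ 0) :+ r :* (con (+ 1) :* con (+ 1))
        := r :* con (+ 1) :+ con (+ 0) :* con (+ 0) :+ r :* (con (+ 0) :* con (+ 1)) :+ con (+ 0)) r s

  root-not-embedded : ∀ a → ¬ embed a ≈ᴹ root
  root-not-embedded a (_ , 0≈1) = 1≉0 (sym 0≈1)

  module _ (irreducible : ∀ x → x * x ≉ r * x + s) where
    private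
      -- The product of a + bρ and its conjugate a + b(r - ρ).
      norm : Carrier × Carrier → Carrier
      norm (a , b) = a * a + r * (a * b) - s * (b * b)

      -- For b ≠ 0 the norm is b² times the value of X² - rX - s at -a/b, which irreducibility keeps
      -- away from zero.
      norm-nonzero : ∀ x → ¬ x ≈ᴹ 0ᴹ → norm x ≉ 0#
      norm-nonzero (a , b) x≉0 N≈0 with b ≟ 0#
      ... | yes b≈0 = x≉0 ([ id , id ]′ (*-zero (trans (sym N≈a²) N≈0)) , b≈0)
        where
        N≈a² : norm (a , b) ≈ a * a
        N≈a² = trans (+-cong (+-congˡ (*-congˡ (*-congˡ b≈0))) (-‿cong (*-congˡ (*-congˡ b≈0))))
          (solve 4 (λ r s a b → a :* a :+ r :* (a :* con (+ 0)) :- s :* (b :* con (+ 0)) := a :* a) r s a b)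
      ... | no b≉0 = irreducible x (x-y≈0⇒x≈y (*-zeroʳ⁻ (*-nonzero b≉0 b≉0) (trans eq N≈0)))
        where
        x = - (a * b ⁻¹)
        bx≈-a : b * x ≈ - a
        bx≈-a = trans (solve 3 (λ a b i → b :* (:- (a :* i)) := :- (b :* i :* a)) a b (b ⁻¹))
          (-‿cong (trans (*-congʳ (⁻¹-inverseʳ b≉0)) (*-identityˡ a)))
        eq : b * b * (x * x - (r * x + s)) ≈ norm (a , b)
        eq = trans (solve 4 (λ r s b x → b :* b :* (x :* x :- (r :* x :+ s)) :=
                     b :* x :* (b :* x) :- (r :* (b :* x :* b) :+ s :* (b :* b))) r s b x)
             (trans (+-cong (*-cong bx≈-a bx≈-a) (-‿cong (+-congʳ (*-congˡ (*-congʳ bx≈-a)))))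
             (solve 4 (λ r s a b → :- a :* (:- a) :- (r :* (:- a :* b) :+ s :* (b :* b)) :=
                     a :* a :+ r :* (a :* b) :- s :* (b :* b)) r s a b))

    isFiniteField : IsFiniteField (n ℕ.* n) extension
    isFiniteField = record
      { 1≉0 = λ (1≈0 , _) → 1≉0 1≈0
      -- The conjugate (a + rb) - bρ divided by the norm.
      ; inverse = λ (a , b) x≉0 → let i = norm (a , b) ⁻¹ in ((a + r * b) * i , - b * i) ,
            trans (solve 5 (λ r s a b i → a :* ((a :+ r :* b) :* i) :+ s :* (b :* (:- b :* i)) :=
                    (a :* a :+ r :* (a :* b) :- s :* (b :* b)) :* i) r s a b i)
              (⁻¹-inverseʳ (norm-nonzero (a , b) x≉0))
          , solve 4 (λ r a b i → a :* (:- b :* i) :+ b :* ((a :+ r :* b) :* i) :+ r :* (b :* (:- b :* i)) := con (+ 0)) r a b i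
      ; order = L-order ×-finite L-order
      }
      where L-order = IsFiniteField.order L-finite

-- Linear algebra over a finite field

module LinearAlgebra {q} (K : CommutativeRing c ℓ) (K-finite : IsFiniteField q K) where
  open FiniteField K K-finite
  open CommutativeMonoidSum +-commutativeMonoid using (sum-remove; ∑-distrib-+; ∑-comm)
  open SemiringSum semiring using (sum; sum-cong-≋; sum-replicate-zero; *-distribˡ-sum; *-distribʳ-sum)
  open SetoidReasoning setoid

  NonzeroVec : ∀ {m} → Vector Carrier m → Set _
  NonzeroVec v = ∃ λ j → v j ≉ 0#

  dot : ∀ {m} → Vector Carrier m → Vector Carrier m → Carrier
  dot v w = sum (λ i → v i * w i)

  sum-zero : ∀ {m} {v : Vector Carrier m} → (∀ i → v i ≈ 0#) → sum v ≈ 0#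
  sum-zero {m} v≈0 = trans (sum-cong-≋ v≈0) (sum-replicate-zero m)

  sum-neg : ∀ {m} (v : Vector Carrier m) → sum (λ i → - v i) ≈ - sum v
  sum-neg v = trans (sum-cong-≋ (λ i → sym (-1*x≈-x (v i)))) (trans (sym (*-distribˡ-sum (- 1#) v)) (-1*x≈-x _))

  dot-sub : ∀ {m} (c v w : Vector Carrier m) → dot c (λ i → v i - w i) ≈ dot c v - dot c w
  dot-sub c v w = begin
    dot c (λ i → v i - w i)                     ≈⟨ sum-cong-≋ (λ i → solve 3 (λ c v w → c :* (v :- w) := c :* v :+ :- (c :* w)) (c i) (v i) (w i)) ⟩
    sum (λ i → c i * v i + - (c i * w i))       ≈⟨ ∑-distrib-+ (λ i → c i * v i) (λ i → - (c i * w i)) ⟩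
    dot c v + sum (λ i → - (c i * w i))         ≈⟨ +-congˡ (sum-neg (λ i → c i * w i)) ⟩
    dot c v - dot c w                           ∎

  dot-scale : ∀ {m} (c v : Vector Carrier m) k → dot c (λ i → k * v i) ≈ k * dot c v
  dot-scale c v k = trans (sum-cong-≋ (λ i → solve 3 (λ c v k → c :* (k :* v) := k :* (c :* v)) (c i) (v i) k))
                          (sym (*-distribˡ-sum k (λ i → c i * v i)))

  dot-scaleˡ : ∀ {m} (c v : Vector Carrier m) k → dot (λ i → k * c i) v ≈ k * dot c v
  dot-scaleˡ c v k = trans (sum-cong-≋ (λ i → *-assoc k (c i) (v i))) (sym (*-distribˡ-sum k (λ i → c i * v i)))

  dot-comm : ∀ {m} (c v : Vector Carrier m) → dot c v ≈ dot v c
  dot-comm c v = sum-cong-≋ (λ i → *-comm (c i) (v i))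

  different-somewhere : ∀ {m} {v w : Vector Carrier m} → ¬ (∀ i → v i ≈ w i) → NonzeroVec (λ i → v i - w i)
  different-somewhere {v = v} {w} v≉w with Finₚ.¬∀⟶∃¬ _ (λ i → v i ≈ w i) (λ i → v i ≟ w i) v≉w
  ... | i , vi≉wi = i , λ eq → vi≉wi (x-y≈0⇒x≈y eq)

  -- There are q^m covectors but only q^k lists of values on v, so two covectors agree on v.
  annihilator : ∀ {k m} → k < m → (v : Fin k → Vector Carrier m) →
                ∃ λ c → NonzeroVec c × (∀ i → dot c (v i) ≈ 0#)
  annihilator {k} {m} k<m v with collision (finite-vector m (IsFiniteField.order K-finite)) (finite-vector k (IsFiniteField.order K-finite))
                                   (ℕₚ.^-monoʳ-< q 1<order k<m) (λ c i → dot c (v i))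
  ... | c , d , c≉d , eq = (λ i → c i - d i) , different-somewhere c≉d , λ i → begin
    dot (λ j → c j - d j) (v i)  ≈⟨ dot-comm (λ j → c j - d j) (v i) ⟩
    dot (v i) (λ j → c j - d j)  ≈⟨ dot-sub (v i) c d ⟩
    dot (v i) c - dot (v i) d    ≈⟨ x≈y⇒x-y≈0 (trans (dot-comm (v i) c) (trans (eq i) (dot-comm d (v i)))) ⟩
    0#                           ∎

  Kronecker : ∀ {n} → Fin n → Vector Carrier n
  Kronecker zero    zero    = 1#
  Kronecker zero    (suc j) = 0#
  Kronecker (suc i) zero    = 0#
  Kronecker (suc i) (suc j) = Kronecker i j

  sum-Kronecker : ∀ {n} i (v : Vector Carrier n) → sum (λ j → Kronecker i j * v j) ≈ v i
  sum-Kronecker zero    v = trans (+-cong (*-identityˡ _) (sum-zero (λ j → zeroˡ (v (suc j))))) (+-identityʳ _)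
  sum-Kronecker (suc i) v = trans (+-cong (zeroˡ _) (sum-Kronecker i (v ∘ suc))) (+-identityˡ _)

  SpansAll : ∀ {n m} → (Fin n → Vector Carrier m) → Set _
  SpansAll {n} {m} p = ∀ (v : Vector Carrier m) → ∃ λ (l : Vector Carrier n) → ∀ j → sum (λ i → l i * p i j) ≈ v j

  -- Gaussian elimination. If all first coordinates vanish, the first coordinate functional
  -- annihilates. Otherwise a pivot clears the first coordinate, and both alternatives for the
  -- reduced vectors lift: a covector by choosing its value at coordinate zero, a combination by
  -- correcting the coefficient of the pivot.
  annihilated-or-spanning : ∀ m {n} (p : Fin n → Vector Carrier m) →
    (∃ λ c → NonzeroVec c × (∀ i → dot c (p i) ≈ 0#)) ⊎ SpansAll p
  annihilated-or-spanning zero    p = inj₂ (λ v → (λ _ → 0#) , λ ())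
  annihilated-or-spanning (suc m) {n} p with Finₚ.all? (λ i → p i zero ≟ 0#)
  ... | yes p₀≈0 = inj₁ (Kronecker zero , (zero , 1≉0) , λ i → trans (sum-Kronecker zero (p i)) (p₀≈0 i))
  ... | no  p₀≉0 = cases (annihilated-or-spanning m reduced)
    where
    pivot : ∃ λ i → p i zero ≉ 0#
    pivot = Finₚ.¬∀⟶∃¬ _ (λ i → p i zero ≈ 0#) (λ i → p i zero ≟ 0#) p₀≉0
    i₀ = proj₁ pivot
    u  = p i₀ zero
    μ : Fin n → Carrier
    μ i = p i zero * u ⁻¹
    μ*u : ∀ x → x * u ⁻¹ * u ≈ x
    μ*u x = trans (*-assoc x _ u) (trans (*-congˡ (⁻¹-inverseˡ (proj₂ pivot))) (*-identityʳ x))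
    reduced : Fin n → Vector Carrier m
    reduced i j = p i (suc j) - μ i * p i₀ (suc j)
    cases : (∃ λ c → NonzeroVec c × (∀ i → dot c (reduced i) ≈ 0#)) ⊎ SpansAll reduced →
            (∃ λ c → NonzeroVec c × (∀ i → dot c (p i) ≈ 0#)) ⊎ SpansAll p
    cases (inj₁ (c′ , (j , c′j≉0) , kills)) = inj₁ (extended , (suc j , c′j≉0) , λ i → begin
        - (D * u ⁻¹) * p i zero + dot c′ (p i ∘ suc)
          ≈⟨ +-congˡ (trans (solve 2 (λ x y → x := x :- y :+ y) _ (μ i * D)) (+-congʳ (reduced≈0 i))) ⟩
        - (D * u ⁻¹) * p i zero + (0# + μ i * D)
          ≈⟨ solve 3 (λ D w x → :- (D :* w) :* x :+ (con (+ 0) :+ x :* w :* D) := con (+ 0)) D (u ⁻¹) (p i zero) ⟩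
        0#  ∎)
      where
      D = dot c′ (p i₀ ∘ suc)
      extended : Vector Carrier (suc m)
      extended zero    = - (D * u ⁻¹)
      extended (suc j) = c′ j
      reduced≈0 : ∀ i → dot c′ (p i ∘ suc) - μ i * D ≈ 0#
      reduced≈0 i = trans (trans (+-congˡ (-‿cong (sym (dot-scale c′ (p i₀ ∘ suc) (μ i))))) (sym (dot-sub c′ (p i ∘ suc) (λ j → μ i * p i₀ (suc j))))) (kills i)
    cases (inj₂ spans) = inj₂ spansAll
      where
      spansAll : SpansAll p
      spansAll v = l , eq
        where
        ν = v zero * u ⁻¹
        v′ : Vector Carrier m
        v′ j = v (suc j) - ν * p i₀ (suc j)
        l′ = proj₁ (spans v′)
        -- The pivot must contribute ν in total, and the multiples μ i subtracted in `reduced` have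
        -- already used up the sum.
        t = ν - sum (λ i → l′ i * μ i)
        l : Vector Carrier n
        l i = l′ i + t * Kronecker i₀ i
        expand : ∀ j → sum (λ i → l i * p i j) ≈ sum (λ i → l′ i * p i j) + t * p i₀ j
        expand j = begin
          sum (λ i → l i * p i j)
            ≈⟨ sum-cong-≋ (λ i → solve 4 (λ l t k p → (l :+ t :* k) :* p := l :* p :+ t :* (k :* p)) (l′ i) t (Kronecker i₀ i) (p i j)) ⟩
          sum (λ i → l′ i * p i j + t * (Kronecker i₀ i * p i j))
            ≈⟨ ∑-distrib-+ (λ i → l′ i * p i j) (λ i → t * (Kronecker i₀ i * p i j)) ⟩
          sum (λ i → l′ i * p i j) + sum (λ i → t * (Kronecker i₀ i * p i j))
            ≈⟨ +-congˡ (trans (sym (*-distribˡ-sum t (λ i → Kronecker i₀ i * p i j))) (*-congˡ (sum-Kronecker i₀ (λ i → p i j)))) ⟩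
          sum (λ i → l′ i * p i j) + t * p i₀ j ∎
        eq : ∀ j → sum (λ i → l i * p i j) ≈ v j
        eq zero = begin
          sum (λ i → l i * p i zero)            ≈⟨ expand zero ⟩
          sum (λ i → l′ i * p i zero) + t * u
            ≈⟨ +-congʳ (sum-cong-≋ (λ i → trans (*-congˡ (sym (μ*u (p i zero)))) (sym (*-assoc (l′ i) (μ i) u)))) ⟩
          sum (λ i → l′ i * μ i * u) + t * u    ≈⟨ +-congʳ (sym (*-distribʳ-sum u (λ i → l′ i * μ i))) ⟩
          sum (λ i → l′ i * μ i) * u + t * u
            ≈⟨ solve 3 (λ s ν u → s :* u :+ (ν :- s) :* u := ν :* u) (sum (λ i → l′ i * μ i)) ν u ⟩
          ν * u                                 ≈⟨ μ*u (v zero) ⟩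
          v zero                                ∎
        eq (suc j) = begin
          sum (λ i → l i * p i (suc j))         ≈⟨ expand (suc j) ⟩
          sum (λ i → l′ i * p i (suc j)) + t * w
            ≈⟨ +-congʳ (sum-cong-≋ (λ i → solve 4 (λ l x μ w → l :* x := l :* (x :- μ :* w) :+ l :* μ :* w) (l′ i) (p i (suc j)) (μ i) w)) ⟩
          sum (λ i → l′ i * reduced i j + l′ i * μ i * w) + t * w
            ≈⟨ +-congʳ (∑-distrib-+ (λ i → l′ i * reduced i j) (λ i → l′ i * μ i * w)) ⟩
          sum (λ i → l′ i * reduced i j) + sum (λ i → l′ i * μ i * w) + t * w
            ≈⟨ +-congʳ (+-cong (proj₂ (spans v′) j) (sym (*-distribʳ-sum w (λ i → l′ i * μ i)))) ⟩
          v (suc j) - ν * w + sum (λ i → l′ i * μ i) * w + t * w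
            ≈⟨ solve 4 (λ x ν w s → x :- ν :* w :+ s :* w :+ (ν :- s) :* w := x) (v (suc j)) ν w (sum (λ i → l′ i * μ i)) ⟩
          v (suc j)                             ∎
          where w = p i₀ (suc j)

  -- Since d₂ vanishes at coordinate j and d₁ does not, the two are independent, and d₁ together
  -- with the d₂ - t d₁ lists the q + 1 points of a line in the dual space.
  module Pencil {m} (d₁ d₂ : Vector Carrier m) (j : Fin m) (d₁j≉0 : d₁ j ≉ 0#) (d₂j≈0 : d₂ j ≈ 0#) (d₂≉0 : NonzeroVec d₂) where
    member : Fin (suc q) → Vector Carrier m
    member zero    = d₁
    member (suc t) = λ i → d₂ i - element t * d₁ i

    dot-member : ∀ t v → dot (member (suc t)) v ≈ dot d₂ v - element t * dot d₁ v
    dot-member t v = trans (dot-comm (member (suc t)) v) (trans (dot-sub v d₂ (λ i → element t * d₁ i))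
      (+-cong (dot-comm v d₂) (-‿cong (trans (dot-scale v d₁ (element t)) (*-congˡ (dot-comm v d₁))))))

    member-nonzero : ∀ t → NonzeroVec (member t)
    member-nonzero zero    = j , d₁j≉0
    member-nonzero (suc t) with element t ≟ 0#
    ... | no  t≉0 = j , λ eq → *-nonzero t≉0 d₁j≉0 (sym (x-y≈0⇒x≈y (trans (+-congʳ (sym d₂j≈0)) eq)))
    ... | yes t≈0 = proj₁ d₂≉0 , λ eq → proj₂ d₂≉0 (trans (x-y≈0⇒x≈y eq) (trans (*-congʳ t≈0) (zeroˡ _)))

    -- Unless d₁ vanishes at v, the parameter is the quotient d₂(v) / d₁(v).
    member-through : ∀ v → ∃ λ t → dot (member t) v ≈ 0#
    member-through v with dot d₁ v ≟ 0#
    ... | yes d₁v≈0 = zero , d₁v≈0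
    ... | no  d₁v≉0 = suc (index κ) , trans (dot-member (index κ) v) (x≈y⇒x-y≈0 (sym (trans
            (*-congʳ (element-index κ)) (trans (*-assoc _ _ _) (trans (*-congˡ (⁻¹-inverseˡ d₁v≉0)) (*-identityʳ _))))))
      where κ = dot d₂ v * dot d₁ v ⁻¹

    base-point : ∀ {v} → dot d₁ v ≈ 0# → dot d₂ v ≈ 0# → ∀ t → dot (member t) v ≈ 0#
    base-point d₁v≈0 d₂v≈0 zero    = d₁v≈0
    base-point d₁v≈0 d₂v≈0 (suc t) = trans (dot-member t _) (x≈y⇒x-y≈0 (trans d₂v≈0 (sym (trans (*-congˡ d₁v≈0) (zeroʳ _)))))

  -- The q + 1 hyperplanes of a pencil through the first s points cover the
  -- other r points.
  pencil-member : ∀ {s r k m} → s ℕ.+ 2 ≤ m → suc q ℕ.* k < r → (v : Fin (s ℕ.+ r) → Vector Carrier m) →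
    ∃ λ d → NonzeroVec d × ∃ λ (e : Vector (Fin (s ℕ.+ r)) (s ℕ.+ suc k)) → Injectiveᵥ e × (∀ i → dot d (v (e i)) ≈ 0#)
  pencil-member {s} {r} {k} {m} s+2≤m qk<r v = go₁ (annihilator (ℕₚ.≤-trans (ℕₚ.n≤1+n _) 2+s≤m) (λ i → v (i Fin.↑ˡ r)))
    where
    2+s≤m : suc (suc s) ≤ m
    2+s≤m = ≡.subst (_≤ m) (ℕₚ.+-comm s 2) s+2≤m
    Result : Set _
    Result = ∃ λ d → NonzeroVec d × ∃ λ (e : Vector (Fin (s ℕ.+ r)) (s ℕ.+ suc k)) → Injectiveᵥ e × (∀ i → dot d (v (e i)) ≈ 0#)

    constraints : Fin m → Fin (suc s) → Vector Carrier m
    -- The condition d₂ j = 0, which makes d₂ independent of d₁.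
    constraints j zero    = Kronecker j
    constraints j (suc i) = v (i Fin.↑ˡ r)

    module _ (d₁ d₂ : Vector Carrier m) (j : Fin m) (d₁j≉0 : d₁ j ≉ 0#) (d₂j≈0 : d₂ j ≈ 0#) (d₂≉0 : NonzeroVec d₂)
             (d₁-kills : ∀ i → dot d₁ (v (i Fin.↑ˡ r)) ≈ 0#) (d₂-kills : ∀ i → dot d₂ (v (i Fin.↑ˡ r)) ≈ 0#) where
      open Pencil d₁ d₂ j d₁j≉0 d₂j≈0 d₂≉0

      class : Fin r → Fin (suc q)
      class i = proj₁ (member-through (v (s Fin.↑ʳ i)))

      module _ (g : Vector (Fin r) (suc k)) (g-inj : Injectiveᵥ g) (g-const : ∀ i i′ → class (g i) ≡ class (g i′)) where
        mixed : Fin s ⊎ Fin (suc k) → Fin (s ℕ.+ r)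
        mixed (inj₁ i) = i Fin.↑ˡ r
        mixed (inj₂ i) = s Fin.↑ʳ g i

        split : ∀ x → Fin.splitAt s (mixed x) ≡ Sum.map₂ g x
        split (inj₁ i) = Finₚ.splitAt-↑ˡ s i r
        split (inj₂ i) = Finₚ.splitAt-↑ʳ s r (g i)

        cancel : ∀ x y → Sum.map₂ g x ≡ Sum.map₂ g y → x ≡ y
        cancel (inj₁ i) (inj₁ .i) ≡.refl = ≡.refl
        cancel (inj₂ i) (inj₂ i′) eq = ≡.cong inj₂ (g-inj i i′ (Sumₚ.inj₂-injective eq))

        mixed-injective : ∀ x y → mixed x ≡ mixed y → x ≡ y
        mixed-injective x y eq = cancel x y (≡.trans (≡.sym (split x)) (≡.trans (≡.cong (Fin.splitAt s) eq) (split y)))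

        e : Fin (s ℕ.+ suc k) → Fin (s ℕ.+ r)
        e i = mixed (Fin.splitAt s i)

        e-injective : Injectiveᵥ e
        e-injective i i′ eq = ≡.trans (≡.sym (Finₚ.join-splitAt s (suc k) i))
          (≡.trans (≡.cong (Fin.join s (suc k)) (mixed-injective (Fin.splitAt s i) (Fin.splitAt s i′) eq)) (Finₚ.join-splitAt s (suc k) i′))

        mixed-killed : ∀ x → dot (member (class (g zero))) (v (mixed x)) ≈ 0#
        mixed-killed (inj₁ i) = base-point (d₁-kills i) (d₂-kills i) (class (g zero))
        mixed-killed (inj₂ i) = ≡.subst (λ t → dot (member t) (v (s Fin.↑ʳ g i)) ≈ 0#) (g-const i zero) (proj₂ (member-through (v (s Fin.↑ʳ g i))))

        resultFrom : Result
        resultFrom = member (class (g zero)) , member-nonzero (class (g zero)) , e , e-injective , λ i → mixed-killed (Fin.splitAt s i)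

      result : Result
      result = let g , g-inj , g-const = fibre-pigeonhole (suc q) k qk<r class in resultFrom g g-inj g-const

    go₁ : (∃ λ d → NonzeroVec d × (∀ i → dot d (v (i Fin.↑ˡ r)) ≈ 0#)) → Result
    go₁ (d₁ , (j , d₁j≉0) , d₁-kills) = go₂ (annihilator 2+s≤m (constraints j))
      where
      go₂ : (∃ λ d → NonzeroVec d × (∀ i → dot d (constraints j i) ≈ 0#)) → Result
      go₂ (d₂ , d₂≉0 , d₂-kills) = result d₁ d₂ j d₁j≉0
        (trans (sym (sum-Kronecker j d₂)) (trans (dot-comm (Kronecker j) d₂) (d₂-kills zero))) d₂≉0 d₁-kills (d₂-kills ∘ suc)

  -- Spans, linear subspaces and kernels in a module over the field

  module Module {m ℓm} (M : LeftModule ring m ℓm) where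
    open LeftModule M
    open Projective M
    open CommutativeMonoidSum +ᴹ-commutativeMonoid using () renaming
      (sum to sumᴹ; sum-cong-≋ to sumᴹ-cong; sum-remove to sumᴹ-remove; ∑-distrib-+ to sumᴹ-+; ∑-comm to sumᴹ-comm; sum-replicate-zero to sumᴹ-zero)

    *ₗ-sum : ∀ {n} k (v : Vector Carrierᴹ n) → k *ₗ sumᴹ v ≈ᴹ sumᴹ (λ i → k *ₗ v i)
    *ₗ-sum {zero}  k v = *ₗ-zeroʳ k
    *ₗ-sum {suc n} k v = ≈ᴹ-trans (*ₗ-distribˡ k _ _) (+ᴹ-congˡ (*ₗ-sum k (v ∘ suc)))

    sum-*ₗ : ∀ {n} (k : Vector Carrier n) x → sumᴹ (λ i → k i *ₗ x) ≈ᴹ sum k *ₗ x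
    sum-*ₗ {zero}  k x = ≈ᴹ-sym (*ₗ-zeroˡ x)
    sum-*ₗ {suc n} k x = ≈ᴹ-trans (+ᴹ-congˡ (sum-*ₗ (k ∘ suc) x)) (≈ᴹ-sym (*ₗ-distribʳ x (k zero) _))

    combination-cong : ∀ {n} {k l : Vector Carrier n} {v w : Vector Carrierᴹ n} →
                       (∀ i → k i ≈ l i) → (∀ i → v i ≈ᴹ w i) → combination k v ≈ᴹ combination l w
    combination-cong k≈l v≈w = sumᴹ-cong (λ i → *ₗ-cong (k≈l i) (v≈w i))

    combination-combination : ∀ {n m} (k : Vector Carrier n) (c : Fin n → Vector Carrier m) (h : Vector Carrierᴹ m) →
      combination k (λ i → combination (c i) h) ≈ᴹ combination (λ j → sum (λ i → k i * c i j)) h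
    combination-combination k c h =
      ≈ᴹ-trans (sumᴹ-cong (λ i → ≈ᴹ-trans (*ₗ-sum (k i) (λ j → c i j *ₗ h j)) (sumᴹ-cong (λ j → ≈ᴹ-sym (*ₗ-assoc (k i) (c i j) (h j))))))
      (≈ᴹ-trans (sumᴹ-comm (λ i j → (k i * c i j) *ₗ h j))
      (sumᴹ-cong (λ j → sum-*ₗ (λ i → k i * c i j) (h j))))

    combination-remove : ∀ {n} (k : Vector Carrier (suc n)) (h : Vector Carrierᴹ (suc n)) j →
      combination k h ≈ᴹ k j *ₗ h j +ᴹ combination (removeAt k j) (removeAt h j)
    combination-remove k h j = sumᴹ-remove {i = j} (λ i → k i *ₗ h i)

    combination-Kronecker : ∀ {n} i (v : Vector Carrierᴹ n) → combination (Kronecker i) v ≈ᴹ v i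
    combination-Kronecker {suc n} zero v = ≈ᴹ-trans (+ᴹ-cong (*ₗ-identityˡ _)
      (≈ᴹ-trans (sumᴹ-cong (λ j → *ₗ-zeroˡ (v (suc j)))) (sumᴹ-zero n))) (+ᴹ-identityʳ _)
    combination-Kronecker {suc n} (suc i) v = ≈ᴹ-trans (+ᴹ-cong (*ₗ-zeroˡ _) (combination-Kronecker i (v ∘ suc))) (+ᴹ-identityˡ _)

    basis∈Span : ∀ {n} (v : Vector Carrierᴹ n) i → Span v (v i)
    basis∈Span v i = Kronecker i , combination-Kronecker i v

    Span-trans : ∀ {n m} {v : Vector Carrierᴹ n} {w : Vector Carrierᴹ m} → (∀ i → Span w (v i)) → ∀ {x} → Span v x → Span w x
    Span-trans {v = v} {w} v∈w (k , eq) = _ ,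
      ≈ᴹ-trans (≈ᴹ-sym (combination-combination k (proj₁ ∘ v∈w) w))
      (≈ᴹ-trans (combination-cong (λ _ → refl) (proj₂ ∘ v∈w)) eq)

    Span-+ : ∀ {n} {v : Vector Carrierᴹ n} {x y} → Span v x → Span v y → Span v (x +ᴹ y)
    Span-+ {v = v} (k , kv≈x) (l , lv≈y) = (λ i → k i + l i) ,
      ≈ᴹ-trans (sumᴹ-cong (λ i → *ₗ-distribʳ (v i) (k i) (l i)))
      (≈ᴹ-trans (sumᴹ-+ (λ i → k i *ₗ v i) (λ i → l i *ₗ v i)) (+ᴹ-cong kv≈x lv≈y))

    Span-* : ∀ {n} {v : Vector Carrierᴹ n} {x} k → Span v x → Span v (k *ₗ x)
    Span-* {v = v} k (l , lv≈x) = (λ i → k * l i) ,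
      ≈ᴹ-trans (sumᴹ-cong (λ i → *ₗ-assoc k (l i) (v i))) (≈ᴹ-trans (≈ᴹ-sym (*ₗ-sum k (λ i → l i *ₗ v i))) (*ₗ-congˡ lv≈x))

    Span-cong : ∀ {n} {v : Vector Carrierᴹ n} {x y} → x ≈ᴹ y → Span v x → Span v y
    Span-cong x≈y (k , eq) = k , ≈ᴹ-trans eq x≈y

    combination-sub : ∀ {n} (k l : Vector Carrier n) (v : Vector Carrierᴹ n) →
      combination (λ i → k i - l i) v ≈ᴹ combination k v +ᴹ (- 1#) *ₗ combination l v
    combination-sub k l v = ≈ᴹ-trans
      (sumᴹ-cong (λ i → ≈ᴹ-trans (*ₗ-distribʳ (v i) (k i) (- l i)) (+ᴹ-congˡ (≈ᴹ-trans (*ₗ-congʳ (sym (-1*x≈-x (l i)))) (*ₗ-assoc (- 1#) (l i) (v i))))))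
      (≈ᴹ-trans (sumᴹ-+ (λ i → k i *ₗ v i) (λ i → (- 1#) *ₗ (l i *ₗ v i))) (+ᴹ-congˡ (≈ᴹ-sym (*ₗ-sum (- 1#) (λ i → l i *ₗ v i)))))

    ≈ₚ-common : ∀ {x y z : Point} → x ≈ₚ z → y ≈ₚ z → x ≈ₚ y
    ≈ₚ-common {x} {y} {z} (k , kz≈x) (l , lz≈y) = k * l ⁻¹ ,
      ≈ᴹ-trans (*ₗ-congˡ (≈ᴹ-sym lz≈y)) (≈ᴹ-trans (≈ᴹ-sym (*ₗ-assoc (k * l ⁻¹) l (vec z)))
      (≈ᴹ-trans (*ₗ-congʳ (trans (*-assoc k (l ⁻¹) l) (trans (*-congˡ (⁻¹-inverseˡ l≉0)) (*-identityʳ k)))) kz≈x))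
      where
      l≉0 : l ≉ 0#
      l≉0 l≈0 = nonzero y (≈ᴹ-trans (≈ᴹ-sym lz≈y) (≈ᴹ-trans (*ₗ-congʳ l≈0) (*ₗ-zeroˡ (vec z))))

    exactly⇒not-more : ∀ {x} {X : Pred Point x} {n} → HasExactly n X → ¬ HasAtLeast (suc n) X
    exactly⇒not-more (p , _ , complete) (r , r∈X , r-inj) with Finₚ.pigeonhole (ℕₚ.n<1+n _) (λ i → proj₁ (complete (r i) (r∈X i)))
    ... | i , j , i<j , eq = Finₚ.<⇒≢ i<j (r-inj i j (≈ₚ-common {r i} {r j} {p (proj₁ (complete (r j) (r∈X j)))}
            (≡.subst (λ k → r i ≈ₚ p k) eq (proj₂ (complete (r i) (r∈X i)))) (proj₂ (complete (r j) (r∈X j)))))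

    record IsLinearSubspace {p} (W : Pred Carrierᴹ p) : Set (c Level.⊔ m Level.⊔ ℓm Level.⊔ p) where
      field
        resp : ∀ {x y} → x ≈ᴹ y → W x → W y
        zero∈ : W 0ᴹ
        +-closed : ∀ {x y} → W x → W y → W (x +ᴹ y)
        *-closed : ∀ k {x} → W x → W (k *ₗ x)

    Span⊆ : ∀ {p} {W : Pred Carrierᴹ p} → IsLinearSubspace W → ∀ {n} {v : Vector Carrierᴹ n} → (∀ i → W (v i)) → ∀ {x} → Span v x → W x
    Span⊆ {W = W} W-sub {v = v} v∈W (k , eq) = resp eq (go k v v∈W)
      where
      open IsLinearSubspace W-sub
      go : ∀ {n} (k : Vector Carrier n) v → (∀ i → W (v i)) → W (combination k v)
      go {zero}  k v v∈W = zero∈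
      go {suc n} k v v∈W = +-closed (*-closed (k zero) (v∈W zero)) (go (k ∘ suc) (v ∘ suc) (v∈W ∘ suc))

    independent⇒nonzero : ∀ {n} {v : Vector Carrierᴹ n} → LinearlyIndependent v → ∀ i → ¬ (v i ≈ᴹ 0ᴹ)
    independent⇒nonzero {v = v} indep i vi≈0 = Kronecker-diagonal i (indep (Kronecker i) (≈ᴹ-trans (combination-Kronecker i v) vi≈0) i)
      where
      Kronecker-diagonal : ∀ {n} (i : Fin n) → Kronecker i i ≉ 0#
      Kronecker-diagonal zero    = 1≉0
      Kronecker-diagonal (suc i) = Kronecker-diagonal i

    -- A basis of the hyperplane Σ cᵢ xᵢ = 0 in coordinates with respect to h,
    -- for c j₀ = 1.
    module Kernel {n} (h : Vector Carrierᴹ (suc n)) (c : Vector Carrier (suc n)) (j₀ : Fin (suc n)) (c₀≈1 : c j₀ ≈ 1#) where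
      kernelBasis : Vector Carrierᴹ n
      kernelBasis j = h (Fin.punchIn j₀ j) +ᴹ (- c (Fin.punchIn j₀ j)) *ₗ h j₀

      private
        coefficient : Vector Carrier n → Carrier
        coefficient l = sum (λ j → l j * - c (Fin.punchIn j₀ j))

      combination-kernelBasis : ∀ l → combination l kernelBasis ≈ᴹ coefficient l *ₗ h j₀ +ᴹ combination l (removeAt h j₀)
      combination-kernelBasis l =
        ≈ᴹ-trans (sumᴹ-cong (λ j → ≈ᴹ-trans (*ₗ-distribˡ (l j) _ _) (≈ᴹ-trans (+ᴹ-congˡ (≈ᴹ-sym (*ₗ-assoc (l j) _ (h j₀)))) (+ᴹ-comm _ _))))
        (≈ᴹ-trans (sumᴹ-+ (λ j → (l j * - c (Fin.punchIn j₀ j)) *ₗ h j₀) (λ j → l j *ₗ removeAt h j₀ j))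
        (+ᴹ-congʳ (sum-*ₗ (λ j → l j * - c (Fin.punchIn j₀ j)) (h j₀))))

      -- A relation among the kernel vectors becomes a relation among the h with the same
      -- coefficients away from j₀, and some coefficient t at j₀.
      kernelBasis-independent : LinearlyIndependent h → LinearlyIndependent kernelBasis
      kernelBasis-independent indep l eq i = trans (sym (reflexive (insertAt-punchIn l j₀ t i)))
        (indep k (≈ᴹ-trans (combination-remove k h j₀)
          (≈ᴹ-trans (+ᴹ-cong (*ₗ-congʳ (reflexive (insertAt-lookup l j₀ t)))
                             (combination-cong (λ j → reflexive (insertAt-punchIn l j₀ t j)) (λ _ → ≈ᴹ-refl)))
          (≈ᴹ-trans (≈ᴹ-sym (combination-kernelBasis l)) eq))) (Fin.punchIn j₀ i))
        where
        t = coefficient l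
        k = insertAt l j₀ t

      kernelBasis∈Span : ∀ j → Span h (kernelBasis j)
      kernelBasis∈Span j = Span-+ {v = h} (basis∈Span h (Fin.punchIn j₀ j)) (Span-* {v = h} (- c (Fin.punchIn j₀ j)) (basis∈Span h j₀))

      kernel∈Span : ∀ k → dot c k ≈ 0# → Span kernelBasis (combination k h)
      kernel∈Span k ck≈0 = removeAt k j₀ , ≈ᴹ-trans (combination-kernelBasis (removeAt k j₀))
        (≈ᴹ-trans (+ᴹ-congʳ (*ₗ-congʳ (begin
          coefficient (removeAt k j₀)
            ≈⟨ sum-cong-≋ (λ j → solve 2 (λ x y → x :* (:- y) := :- (y :* x)) (removeAt k j₀ j) (c (Fin.punchIn j₀ j))) ⟩
          sum (λ j → - (removeAt c j₀ j * removeAt k j₀ j))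
            ≈⟨ sum-neg (λ j → removeAt c j₀ j * removeAt k j₀ j) ⟩
          - D                        ≈⟨ solve 3 (λ c k D → :- D := c :* k :- (c :* k :+ D)) (c j₀) (k j₀) D ⟩
          c j₀ * k j₀ - (c j₀ * k j₀ + D)
            ≈⟨ +-cong (*-congʳ c₀≈1) (-‿cong (trans (sym (sum-remove {i = j₀} (λ j → c j * k j))) ck≈0)) ⟩
          1# * k j₀ - 0#             ≈⟨ solve 1 (λ k → con (+ 1) :* k :- con (+ 0) := k) (k j₀) ⟩
          k j₀                       ∎)))
        (≈ᴹ-sym (combination-remove k h j₀)))
        where
        D = dot (removeAt c j₀) (removeAt k j₀)

-- 2×2×2 tensors

-- The coordinate T_ijk of a 2×2×2 tensor is stored at position 4i + 2j + k.
module Trilinear (R : CommutativeRing c ℓ) where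
  open CommutativeRing R hiding (zero)
  open IntegerCoefficients R
  open SetoidReasoning setoid

  contract₁ : Vector Carrier 8 → Carrier → Carrier → Vector Carrier 4
  contract₁ T x₀ x₁ = (T 0F * x₀ + T 4F * x₁) ∷ (T 1F * x₀ + T 5F * x₁) ∷ (T 2F * x₀ + T 6F * x₁) ∷ (T 3F * x₀ + T 7F * x₁) ∷ []

  contract₂ : Vector Carrier 4 → Carrier → Carrier → Vector Carrier 2
  contract₂ T y₀ y₁ = (T 0F * y₀ + T 2F * y₁) ∷ (T 1F * y₀ + T 3F * y₁) ∷ []

  contract₃ : Vector Carrier 2 → Carrier → Carrier → Carrier
  contract₃ T z₀ z₁ = T 0F * z₀ + T 1F * z₁

  tri : Vector Carrier 8 → Carrier → Carrier → Carrier → Carrier → Carrier → Carrier → Carrier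
  tri T x₀ x₁ y₀ y₁ z₀ z₁ = contract₃ (contract₂ (contract₁ T x₀ x₁) y₀ y₁) z₀ z₁

  tri-cong : ∀ {T T′ x₀ x₁ y₀ y₁ z₀ z₁ x₀′ x₁′ y₀′ y₁′ z₀′ z₁′} → (∀ i → T i ≈ T′ i) →
             x₀ ≈ x₀′ → x₁ ≈ x₁′ → y₀ ≈ y₀′ → y₁ ≈ y₁′ → z₀ ≈ z₀′ → z₁ ≈ z₁′ →
             tri T x₀ x₁ y₀ y₁ z₀ z₁ ≈ tri T′ x₀′ x₁′ y₀′ y₁′ z₀′ z₁′
  tri-cong T≈ x₀≈ x₁≈ y₀≈ y₁≈ z₀≈ z₁≈ =
    +-cong (*-cong (+-cong (*-cong (s 0F 4F) y₀≈) (*-cong (s 2F 6F) y₁≈)) z₀≈)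
           (*-cong (+-cong (*-cong (s 1F 5F) y₀≈) (*-cong (s 3F 7F) y₁≈)) z₁≈)
    where s = λ i j → +-cong (*-cong (T≈ i) x₀≈) (*-cong (T≈ j) x₁≈)

  tensor : Carrier → Carrier → Carrier → Carrier → Carrier → Carrier → Vector Carrier 8
  tensor x₀ x₁ y₀ y₁ z₀ z₁ =
    (x₀ * y₀ * z₀) ∷ (x₀ * y₀ * z₁) ∷ (x₀ * y₁ * z₀) ∷ (x₀ * y₁ * z₁) ∷
    (x₁ * y₀ * z₀) ∷ (x₁ * y₀ * z₁) ∷ (x₁ * y₁ * z₀) ∷ (x₁ * y₁ * z₁) ∷ []

  pairing : Vector Carrier 8 → Vector Carrier 8 → Carrier
  pairing S T = S 0F * T 0F + S 1F * T 1F + S 2F * T 2F + S 3F * T 3F + S 4F * T 4F + S 5F * T 5F + S 6F * T 6F + S 7F * T 7F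

  pairing₄ : Vector Carrier 4 → Vector Carrier 4 → Carrier
  pairing₄ S T = S 0F * T 0F + S 1F * T 1F + S 2F * T 2F + S 3F * T 3F

  pairing₂ : Vector Carrier 2 → Vector Carrier 2 → Carrier
  pairing₂ S T = S 0F * T 0F + S 1F * T 1F

  private
    tri′ : ∀ {n} (a b c d e f g h x₀ x₁ y₀ y₁ z₀ z₁ : Polynomial n) → Polynomial n
    tri′ a b c d e f g h x₀ x₁ y₀ y₁ z₀ z₁ =
      ((a :* x₀ :+ e :* x₁) :* y₀ :+ (c :* x₀ :+ g :* x₁) :* y₁) :* z₀ :+ ((b :* x₀ :+ f :* x₁) :* y₀ :+ (d :* x₀ :+ h :* x₁) :* y₁) :* z₁

  pairing-tensor : ∀ T x₀ x₁ y₀ y₁ z₀ z₁ → pairing T (tensor x₀ x₁ y₀ y₁ z₀ z₁) ≈ tri T x₀ x₁ y₀ y₁ z₀ z₁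
  pairing-tensor T = solve 14 (λ a b c d e f g h x₀ x₁ y₀ y₁ z₀ z₁ →
    a :* (x₀ :* y₀ :* z₀) :+ b :* (x₀ :* y₀ :* z₁) :+ c :* (x₀ :* y₁ :* z₀) :+ d :* (x₀ :* y₁ :* z₁) :+
    e :* (x₁ :* y₀ :* z₀) :+ f :* (x₁ :* y₀ :* z₁) :+ g :* (x₁ :* y₁ :* z₀) :+ h :* (x₁ :* y₁ :* z₁) :=
    tri′ a b c d e f g h x₀ x₁ y₀ y₁ z₀ z₁) (T 0F) (T 1F) (T 2F) (T 3F) (T 4F) (T 5F) (T 6F) (T 7F)

  tri-tensor : ∀ x₀ x₁ y₀ y₁ z₀ z₁ u₀ u₁ v₀ v₁ w₀ w₁ →
    tri (tensor x₀ x₁ y₀ y₁ z₀ z₁) u₀ u₁ v₀ v₁ w₀ w₁ ≈ (u₀ * x₀ + u₁ * x₁) * (v₀ * y₀ + v₁ * y₁) * (w₀ * z₀ + w₁ * z₁)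
  tri-tensor = solve 12 (λ x₀ x₁ y₀ y₁ z₀ z₁ u₀ u₁ v₀ v₁ w₀ w₁ →
    tri′ (x₀ :* y₀ :* z₀) (x₀ :* y₀ :* z₁) (x₀ :* y₁ :* z₀) (x₀ :* y₁ :* z₁)
         (x₁ :* y₀ :* z₀) (x₁ :* y₀ :* z₁) (x₁ :* y₁ :* z₀) (x₁ :* y₁ :* z₁) u₀ u₁ v₀ v₁ w₀ w₁
    := (u₀ :* x₀ :+ u₁ :* x₁) :* (v₀ :* y₀ :+ v₁ :* y₁) :* (w₀ :* z₀ :+ w₁ :* z₁))

  pairing-comm : ∀ S T → pairing S T ≈ pairing T S
  pairing-comm S T = +-cong (+-cong (+-cong (+-cong (+-cong (+-cong (+-cong (*-comm _ _) (*-comm _ _)) (*-comm _ _)) (*-comm _ _)) (*-comm _ _)) (*-comm _ _)) (*-comm _ _)) (*-comm _ _)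

  pairing-scale : ∀ S T k → pairing S (λ i → k * T i) ≈ k * pairing S T
  pairing-scale S T k = solve 17 (λ k a b c d e f g h a′ b′ c′ d′ e′ f′ g′ h′ →
    a :* (k :* a′) :+ b :* (k :* b′) :+ c :* (k :* c′) :+ d :* (k :* d′) :+ e :* (k :* e′) :+ f :* (k :* f′) :+ g :* (k :* g′) :+ h :* (k :* h′) :=
    k :* (a :* a′ :+ b :* b′ :+ c :* c′ :+ d :* d′ :+ e :* e′ :+ f :* f′ :+ g :* g′ :+ h :* h′)) k
    (S 0F) (S 1F) (S 2F) (S 3F) (S 4F) (S 5F) (S 6F) (S 7F) (T 0F) (T 1F) (T 2F) (T 3F) (T 4F) (T 5F) (T 6F) (T 7F)

  pairing-+ : ∀ S T U → pairing S (λ i → T i + U i) ≈ pairing S T + pairing S U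
  pairing-+ S T U = trans
    (+-cong (+-cong (+-cong (+-cong (+-cong (+-cong (+-cong (distribˡ _ _ _) (distribˡ _ _ _)) (distribˡ _ _ _)) (distribˡ _ _ _)) (distribˡ _ _ _)) (distribˡ _ _ _)) (distribˡ _ _ _)) (distribˡ _ _ _))
    (solve 16 (λ a a′ b b′ c c′ d d′ e e′ f f′ g g′ h h′ →
      (a :+ a′) :+ (b :+ b′) :+ (c :+ c′) :+ (d :+ d′) :+ (e :+ e′) :+ (f :+ f′) :+ (g :+ g′) :+ (h :+ h′) :=
      (a :+ b :+ c :+ d :+ e :+ f :+ g :+ h) :+ (a′ :+ b′ :+ c′ :+ d′ :+ e′ :+ f′ :+ g′ :+ h′))
      (S 0F * T 0F) (S 0F * U 0F) (S 1F * T 1F) (S 1F * U 1F) (S 2F * T 2F) (S 2F * U 2F) (S 3F * T 3F) (S 3F * U 3F)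
      (S 4F * T 4F) (S 4F * U 4F) (S 5F * T 5F) (S 5F * U 5F) (S 6F * T 6F) (S 6F * U 6F) (S 7F * T 7F) (S 7F * U 7F))

  tri-linear₁ : ∀ T s x₀ x₁ x₀′ x₁′ y₀ y₁ z₀ z₁ →
    tri T (x₀ + s * x₀′) (x₁ + s * x₁′) y₀ y₁ z₀ z₁ ≈ tri T x₀ x₁ y₀ y₁ z₀ z₁ + s * tri T x₀′ x₁′ y₀ y₁ z₀ z₁
  tri-linear₁ T = solve 17 (λ a b c d e f g h s x₀ x₁ x₀′ x₁′ y₀ y₁ z₀ z₁ →
    tri′ a b c d e f g h (x₀ :+ s :* x₀′) (x₁ :+ s :* x₁′) y₀ y₁ z₀ z₁ :=
    tri′ a b c d e f g h x₀ x₁ y₀ y₁ z₀ z₁ :+ s :* tri′ a b c d e f g h x₀′ x₁′ y₀ y₁ z₀ z₁)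
    (T 0F) (T 1F) (T 2F) (T 3F) (T 4F) (T 5F) (T 6F) (T 7F)

  tri-linear₂ : ∀ T s x₀ x₁ y₀ y₁ y₀′ y₁′ z₀ z₁ →
    tri T x₀ x₁ (y₀ + s * y₀′) (y₁ + s * y₁′) z₀ z₁ ≈ tri T x₀ x₁ y₀ y₁ z₀ z₁ + s * tri T x₀ x₁ y₀′ y₁′ z₀ z₁
  tri-linear₂ T = solve 17 (λ a b c d e f g h s x₀ x₁ y₀ y₁ y₀′ y₁′ z₀ z₁ →
    tri′ a b c d e f g h x₀ x₁ (y₀ :+ s :* y₀′) (y₁ :+ s :* y₁′) z₀ z₁ :=
    tri′ a b c d e f g h x₀ x₁ y₀ y₁ z₀ z₁ :+ s :* tri′ a b c d e f g h x₀ x₁ y₀′ y₁′ z₀ z₁)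
    (T 0F) (T 1F) (T 2F) (T 3F) (T 4F) (T 5F) (T 6F) (T 7F)

  tri-linear₃ : ∀ T s x₀ x₁ y₀ y₁ z₀ z₁ z₀′ z₁′ →
    tri T x₀ x₁ y₀ y₁ (z₀ + s * z₀′) (z₁ + s * z₁′) ≈ tri T x₀ x₁ y₀ y₁ z₀ z₁ + s * tri T x₀ x₁ y₀ y₁ z₀′ z₁′
  tri-linear₃ T = solve 17 (λ a b c d e f g h s x₀ x₁ y₀ y₁ z₀ z₁ z₀′ z₁′ →
    tri′ a b c d e f g h x₀ x₁ y₀ y₁ (z₀ :+ s :* z₀′) (z₁ :+ s :* z₁′) :=
    tri′ a b c d e f g h x₀ x₁ y₀ y₁ z₀ z₁ :+ s :* tri′ a b c d e f g h x₀ x₁ y₀ y₁ z₀′ z₁′)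
    (T 0F) (T 1F) (T 2F) (T 3F) (T 4F) (T 5F) (T 6F) (T 7F)

  det : Vector Carrier 4 → Carrier
  det A = A 0F * A 3F - A 1F * A 2F

  polar-det : Vector Carrier 4 → Vector Carrier 4 → Carrier
  polar-det A B = A 0F * B 3F + B 0F * A 3F - A 1F * B 2F - B 1F * A 2F

  bilinear : Vector Carrier 4 → Carrier → Carrier → Carrier → Carrier → Carrier
  bilinear A y₀ y₁ z₀ z₁ = contract₃ (contract₂ A y₀ y₁) z₀ z₁

  private
    bil′ : ∀ {n} (a b c d y₀ y₁ z₀ z₁ : Polynomial n) → Polynomial n
    bil′ a b c d y₀ y₁ z₀ z₁ = (a :* y₀ :+ c :* y₁) :* z₀ :+ (b :* y₀ :+ d :* y₁) :* z₁

  -- Multiplicativity of the determinant: the values of A on two pairs of vectors are the entries of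
  -- a product YᵀAZ.
  bilinear-det : ∀ A y₀ y₁ y₀′ y₁′ z₀ z₁ z₀′ z₁′ →
    bilinear A y₀ y₁ z₀ z₁ * bilinear A y₀′ y₁′ z₀′ z₁′ - bilinear A y₀ y₁ z₀′ z₁′ * bilinear A y₀′ y₁′ z₀ z₁
    ≈ (y₀ * y₁′ - y₁ * y₀′) * (z₀ * z₁′ - z₁ * z₀′) * det A
  bilinear-det A = solve 12 (λ a b c d y₀ y₁ y₀′ y₁′ z₀ z₁ z₀′ z₁′ →
    bil′ a b c d y₀ y₁ z₀ z₁ :* bil′ a b c d y₀′ y₁′ z₀′ z₁′ :- bil′ a b c d y₀ y₁ z₀′ z₁′ :* bil′ a b c d y₀′ y₁′ z₀ z₁ :=
    (y₀ :* y₁′ :- y₁ :* y₀′) :* (z₀ :* z₁′ :- z₁ :* z₀′) :* (a :* d :- b :* c)) (A 0F) (A 1F) (A 2F) (A 3F)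

  -- The polarisation of `bilinear-det` in A.
  bilinear-polar : ∀ A B y₀ y₁ y₀′ y₁′ z₀ z₁ z₀′ z₁′ →
    bilinear A y₀ y₁ z₀ z₁ * bilinear B y₀′ y₁′ z₀′ z₁′ + bilinear B y₀ y₁ z₀ z₁ * bilinear A y₀′ y₁′ z₀′ z₁′
    - bilinear A y₀ y₁ z₀′ z₁′ * bilinear B y₀′ y₁′ z₀ z₁ - bilinear B y₀ y₁ z₀′ z₁′ * bilinear A y₀′ y₁′ z₀ z₁
    ≈ (y₀ * y₁′ - y₁ * y₀′) * (z₀ * z₁′ - z₁ * z₀′) * polar-det A B
  bilinear-polar A B = solve 16 (λ a b c d a′ b′ c′ d′ y₀ y₁ y₀′ y₁′ z₀ z₁ z₀′ z₁′ →
    bil′ a b c d y₀ y₁ z₀ z₁ :* bil′ a′ b′ c′ d′ y₀′ y₁′ z₀′ z₁′ :+ bil′ a′ b′ c′ d′ y₀ y₁ z₀ z₁ :* bil′ a b c d y₀′ y₁′ z₀′ z₁′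
    :- bil′ a b c d y₀ y₁ z₀′ z₁′ :* bil′ a′ b′ c′ d′ y₀′ y₁′ z₀ z₁ :- bil′ a′ b′ c′ d′ y₀ y₁ z₀′ z₁′ :* bil′ a b c d y₀′ y₁′ z₀ z₁ :=
    (y₀ :* y₁′ :- y₁ :* y₀′) :* (z₀ :* z₁′ :- z₁ :* z₀′) :* (a :* d′ :+ a′ :* d :- b :* c′ :- b′ :* c))
    (A 0F) (A 1F) (A 2F) (A 3F) (B 0F) (B 1F) (B 2F) (B 3F)

  private
    -- (ρ - σ) ⟨S , T⟩ expanded along the basis (1 , ρ), (1 , σ) and its dual.
    pairing-step₁ : ∀ S T ρ σ → (ρ - σ) * pairing S T ≈
      pairing₄ (contract₁ S 1# ρ) (contract₁ T (- σ) 1#) - pairing₄ (contract₁ S 1# σ) (contract₁ T (- ρ) 1#)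
    pairing-step₁ S T = solve 18 (λ a b c d e f g h a′ b′ c′ d′ e′ f′ g′ h′ ρ σ →
      (ρ :- σ) :* (a :* a′ :+ b :* b′ :+ c :* c′ :+ d :* d′ :+ e :* e′ :+ f :* f′ :+ g :* g′ :+ h :* h′) :=
      ((a :* con (+ 1) :+ e :* ρ) :* (a′ :* (:- σ) :+ e′ :* con (+ 1)) :+ (b :* con (+ 1) :+ f :* ρ) :* (b′ :* (:- σ) :+ f′ :* con (+ 1)) :+
       (c :* con (+ 1) :+ g :* ρ) :* (c′ :* (:- σ) :+ g′ :* con (+ 1)) :+ (d :* con (+ 1) :+ h :* ρ) :* (d′ :* (:- σ) :+ h′ :* con (+ 1))) :-
      ((a :* con (+ 1) :+ e :* σ) :* (a′ :* (:- ρ) :+ e′ :* con (+ 1)) :+ (b :* con (+ 1) :+ f :* σ) :* (b′ :* (:- ρ) :+ f′ :* con (+ 1)) :+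
       (c :* con (+ 1) :+ g :* σ) :* (c′ :* (:- ρ) :+ g′ :* con (+ 1)) :+ (d :* con (+ 1) :+ h :* σ) :* (d′ :* (:- ρ) :+ h′ :* con (+ 1))))
      (S 0F) (S 1F) (S 2F) (S 3F) (S 4F) (S 5F) (S 6F) (S 7F) (T 0F) (T 1F) (T 2F) (T 3F) (T 4F) (T 5F) (T 6F) (T 7F)

    pairing-step₂ : ∀ S T ρ σ → (ρ - σ) * pairing₄ S T ≈
      pairing₂ (contract₂ S 1# ρ) (contract₂ T (- σ) 1#) - pairing₂ (contract₂ S 1# σ) (contract₂ T (- ρ) 1#)
    pairing-step₂ S T = solve 10 (λ a b c d a′ b′ c′ d′ ρ σ →
      (ρ :- σ) :* (a :* a′ :+ b :* b′ :+ c :* c′ :+ d :* d′) :=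
      ((a :* con (+ 1) :+ c :* ρ) :* (a′ :* (:- σ) :+ c′ :* con (+ 1)) :+ (b :* con (+ 1) :+ d :* ρ) :* (b′ :* (:- σ) :+ d′ :* con (+ 1))) :-
      ((a :* con (+ 1) :+ c :* σ) :* (a′ :* (:- ρ) :+ c′ :* con (+ 1)) :+ (b :* con (+ 1) :+ d :* σ) :* (b′ :* (:- ρ) :+ d′ :* con (+ 1))))
      (S 0F) (S 1F) (S 2F) (S 3F) (T 0F) (T 1F) (T 2F) (T 3F)

    pairing-step₃ : ∀ S T ρ σ → (ρ - σ) * pairing₂ S T ≈
      contract₃ S 1# ρ * contract₃ T (- σ) 1# - contract₃ S 1# σ * contract₃ T (- ρ) 1#
    pairing-step₃ S T = solve 6 (λ a b a′ b′ ρ σ → (ρ :- σ) :* (a :* a′ :+ b :* b′) :=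
      (a :* con (+ 1) :+ b :* ρ) :* (a′ :* (:- σ) :+ b′ :* con (+ 1)) :- (a :* con (+ 1) :+ b :* σ) :* (a′ :* (:- ρ) :+ b′ :* con (+ 1)))
      (S 0F) (S 1F) (T 0F) (T 1F)

  -- The pairing in coordinates adapted to the pairs (ρ₀, ρ₃), (ρ₁, ρ₄), (ρ₂, ρ₅), one pair for each
  -- tensor factor. Each term multiplies a coordinate of S by the dual coordinate of T. Treating the
  -- factors one after the other keeps the polynomial identities small.
  pairing-expansion : ∀ S T ρ₀ ρ₁ ρ₂ ρ₃ ρ₄ ρ₅ → (ρ₀ - ρ₃) * ((ρ₁ - ρ₄) * ((ρ₂ - ρ₅) * pairing S T)) ≈
    let b = λ x y z → tri S 1# x 1# y 1# z
        t = λ x y z → tri T (- x) 1# (- y) 1# (- z) 1#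
    in ((b ρ₀ ρ₁ ρ₂ * t ρ₃ ρ₄ ρ₅ - b ρ₀ ρ₁ ρ₅ * t ρ₃ ρ₄ ρ₂) - (b ρ₀ ρ₄ ρ₂ * t ρ₃ ρ₁ ρ₅ - b ρ₀ ρ₄ ρ₅ * t ρ₃ ρ₁ ρ₂))
     - ((b ρ₃ ρ₁ ρ₂ * t ρ₀ ρ₄ ρ₅ - b ρ₃ ρ₁ ρ₅ * t ρ₀ ρ₄ ρ₂) - (b ρ₃ ρ₄ ρ₂ * t ρ₀ ρ₁ ρ₅ - b ρ₃ ρ₄ ρ₅ * t ρ₀ ρ₁ ρ₂))
  pairing-expansion S T ρ₀ ρ₁ ρ₂ ρ₃ ρ₄ ρ₅ = begin
    (ρ₀ - ρ₃) * ((ρ₁ - ρ₄) * ((ρ₂ - ρ₅) * pairing S T))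
      ≈⟨ solve 4 (λ a b c d → a :* (b :* (c :* d)) := c :* (b :* (a :* d))) (ρ₀ - ρ₃) (ρ₁ - ρ₄) (ρ₂ - ρ₅) (pairing S T) ⟩
    (ρ₂ - ρ₅) * ((ρ₁ - ρ₄) * ((ρ₀ - ρ₃) * pairing S T))
      ≈⟨ *-congˡ (*-congˡ (pairing-step₁ S T ρ₀ ρ₃)) ⟩
    (ρ₂ - ρ₅) * ((ρ₁ - ρ₄) * (pairing₄ S₀ T₀ - pairing₄ S₃ T₃))
      ≈⟨ *-congˡ (distribˡ-sub (step₂ S₀ T₀) (step₂ S₃ T₃)) ⟩
    (ρ₂ - ρ₅) * ((pairing₂ (contract₂ S₀ 1# ρ₁) (contract₂ T₀ (- ρ₄) 1#) - pairing₂ (contract₂ S₀ 1# ρ₄) (contract₂ T₀ (- ρ₁) 1#))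
               - (pairing₂ (contract₂ S₃ 1# ρ₁) (contract₂ T₃ (- ρ₄) 1#) - pairing₂ (contract₂ S₃ 1# ρ₄) (contract₂ T₃ (- ρ₁) 1#)))
      ≈⟨ distribˡ-sub (distribˡ-sub (step₃ S₀ T₀ ρ₁ ρ₄) (step₃ S₀ T₀ ρ₄ ρ₁)) (distribˡ-sub (step₃ S₃ T₃ ρ₁ ρ₄) (step₃ S₃ T₃ ρ₄ ρ₁)) ⟩
    _ ∎
    where
    S₀ = contract₁ S 1# ρ₀
    S₃ = contract₁ S 1# ρ₃
    T₀ = contract₁ T (- ρ₃) 1#
    T₃ = contract₁ T (- ρ₀) 1#
    step₂ = λ S T → pairing-step₂ S T ρ₁ ρ₄
    step₃ = λ S T σ τ → pairing-step₃ (contract₂ S 1# σ) (contract₂ T (- τ) 1#) ρ₂ ρ₅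
    distribˡ-sub : ∀ {k x y x′ y′} → k * x ≈ x′ → k * y ≈ y′ → k * (x - y) ≈ x′ - y′
    distribˡ-sub {k} {x} {y} p q = trans (solve 3 (λ k x y → k :* (x :- y) := k :* x :- k :* y) k x y) (+-cong p (-‿cong q))

-- Numerical estimates

-- Removes the truncated subtraction: for q = r + 1 the number of points is 1 + q(q - 1).
q²-q+1≡ : ∀ r → suc r ℕ.^ 2 ℕ.∸ suc r ℕ.+ 1 ≡ suc (suc r ℕ.* r)
q²-q+1≡ r = ≡.trans (ℕₚ.+-comm _ 1) (≡.cong suc (≡.trans
  (≡.cong (ℕ._∸ suc r) (solve 1 (λ r → (con 1 :+ r) :* ((con 1 :+ r) :* con 1) := (con 1 :+ r) :+ (con 1 :+ r) :* r) ≡.refl r))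
  (ℕₚ.m+n∸m≡n (suc r) (suc r ℕ.* r))))
  where open +-*-Solver

m≤m+n≡ : ∀ {m k} n → k ≡ m ℕ.+ n → m ≤ k
m≤m+n≡ {m} n ≡.refl = ℕₚ.m≤m+n m n

-- A section has more points than the 2q + 1 zeros allowed to a nonzero functional. For q = 3 the
-- comparison would be 8 against 7 and fail.
2q+2≤q²-q+1 : ∀ {q} → 4 ≤ q → suc (suc (2 ℕ.* q)) ≤ q ℕ.^ 2 ℕ.∸ q ℕ.+ 1
2q+2≤q²-q+1 4≤q with ℕₚ.m≤n⇒∃[o]m+o≡n 4≤q
... | r , ≡.refl = m≤m+n≡ (3 ℕ.+ 5 ℕ.* r ℕ.+ r ℕ.* r) (≡.trans (q²-q+1≡ (3 ℕ.+ r))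
  (solve 1 (λ r → con 1 :+ (con 4 :+ r) :* (con 3 :+ r) := con 2 :+ con 2 :* (con 4 :+ r) :+ (con 3 :+ con 5 :* r :+ r :* r)) ≡.refl r))
  where open +-*-Solver

-- Five base points of a pencil and 2(q + 1) + 1 further points, so that one of the q + 1 members of
-- the pencil contains three of the latter. For q = 4 this asks for 16 points where only 13 exist.
2q+8≤q²-q+1 : ∀ {q} → 5 ≤ q → 5 ℕ.+ suc (suc q ℕ.* 2) ≤ q ℕ.^ 2 ℕ.∸ q ℕ.+ 1
2q+8≤q²-q+1 5≤q with ℕₚ.m≤n⇒∃[o]m+o≡n 5≤q
... | r , ≡.refl = m≤m+n≡ (3 ℕ.+ 7 ℕ.* r ℕ.+ r ℕ.* r) (≡.trans (q²-q+1≡ (4 ℕ.+ r))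
  (solve 1 (λ r → con 1 :+ (con 5 :+ r) :* (con 4 :+ r) := con 6 :+ (con 6 :+ r) :* con 2 :+ (con 3 :+ con 7 :* r :+ r :* r)) ≡.refl r))
  where open +-*-Solver

-- The product on the right is the cardinality of the `parameters` of a cyclic tensor, in the form
-- in which `_×-finite_` computes it.
q⁷<q⁸ : ∀ {q} → 1 < q → q ℕ.^ 7 < q ℕ.* (q ℕ.^ 3 ℕ.* (q ℕ.^ 3 ℕ.* q))
q⁷<q⁸ {q} 1<q = ≡.subst (q ℕ.^ 7 <_) (solve 1 (λ q → let q³ = q :* (q :* (q :* con 1)) in
  q :* (q :* (q :* (q :* (q :* (q :* (q :* (q :* con 1))))))) := q :* (q³ :* (q³ :* q))) ≡.refl q) (ℕₚ.^-monoʳ-< q 1<q {7} {8} ℕₚ.≤-refl)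
  where open +-*-Solver

q⁸<q⁹ : ∀ {q} → 1 < q → q ℕ.* (q ℕ.^ 3 ℕ.* (q ℕ.^ 3 ℕ.* q)) < q ℕ.^ 9
q⁸<q⁹ {q} 1<q = ≡.subst (_< q ℕ.^ 9) (solve 1 (λ q → let q³ = q :* (q :* (q :* con 1)) in
  q :* (q :* (q :* (q :* (q :* (q :* (q :* (q :* con 1))))))) := q :* (q³ :* (q³ :* q))) ≡.refl q) (ℕₚ.^-monoʳ-< q 1<q {8} {9} ℕₚ.≤-refl)
  where open +-*-Solver

q*[q²-q+1]<q³ : ∀ {q} → 4 ≤ q → q ℕ.* (q ℕ.^ 2 ℕ.∸ q ℕ.+ 1) < q ℕ.^ 3
q*[q²-q+1]<q³ 4≤q with ℕₚ.m≤n⇒∃[o]m+o≡n 4≤q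
... | r , ≡.refl = m≤m+n≡ (11 ℕ.+ 7 ℕ.* r ℕ.+ r ℕ.* r) (≡.trans
  (solve 1 (λ r → let q = con 4 :+ r in q :* (q :* (q :* con 1)) :=
     con 1 :+ q :* (con 1 :+ q :* (con 3 :+ r)) :+ (con 11 :+ con 7 :* r :+ r :* r)) ≡.refl r)
  (≡.cong (λ N → suc ((4 ℕ.+ r) ℕ.* N) ℕ.+ (11 ℕ.+ 7 ℕ.* r ℕ.+ r ℕ.* r)) (≡.sym (q²-q+1≡ (3 ℕ.+ r)))))
  where open +-*-Solver

-- The Frobenius map

nC0≡1 : ∀ n → n C 0 ≡ 1
nC0≡1 n = ≡.trans (nCk≡nC[n∸k] {0} {n} z≤n) (nCn≡1 n)

-- The absorption identity, by Pascal's rule. For n + 1 = p prime and 0 < k + 1 < p it leaves the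
-- factor p no place but the binomial coefficient.
[1+k]*[1+n]C[1+k]≡[1+n]*nCk : ∀ n k → suc k ℕ.* (suc n C suc k) ≡ suc n ℕ.* (n C k)
[1+k]*[1+n]C[1+k]≡[1+n]*nCk zero zero = ≡.refl
[1+k]*[1+n]C[1+k]≡[1+n]*nCk zero (suc k) = begin
  suc (suc k) ℕ.* (1 C suc (suc k))  ≡⟨ ≡.cong (suc (suc k) ℕ.*_) (k>n⇒nCk≡0 {1} {suc (suc k)} (s≤s (s≤s z≤n))) ⟩
  suc (suc k) ℕ.* 0                  ≡⟨ ℕₚ.*-zeroʳ (suc (suc k)) ⟩
  0                                  ≡⟨ ≡.cong (1 ℕ.*_) (k>n⇒nCk≡0 {0} {suc k} (s≤s z≤n)) ⟨
  1 ℕ.* (0 C suc k)                  ∎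
  where open ≡.≡-Reasoning
[1+k]*[1+n]C[1+k]≡[1+n]*nCk (suc n) zero = begin
  1 ℕ.* (suc (suc n) C 1)      ≡⟨ ≡.cong (1 ℕ.*_) (nC1≡n (suc (suc n))) ⟩
  1 ℕ.* suc (suc n)            ≡⟨ ℕₚ.*-comm 1 (suc (suc n)) ⟩
  suc (suc n) ℕ.* 1            ≡⟨ ≡.cong (suc (suc n) ℕ.*_) (nC0≡1 (suc n)) ⟨
  suc (suc n) ℕ.* (suc n C 0)  ∎
  where open ≡.≡-Reasoning
[1+k]*[1+n]C[1+k]≡[1+n]*nCk (suc n) (suc k) = begin
  suc (suc k) ℕ.* (suc (suc n) C suc (suc k))
    ≡⟨ ≡.cong (suc (suc k) ℕ.*_) (nCk+nC[k+1]≡[n+1]C[k+1] (suc n) (suc k)) ⟨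
  suc (suc k) ℕ.* (x ℕ.+ y)
    ≡⟨ solve 3 (λ k x y → (con 2 :+ k) :* (x :+ y) := x :+ ((con 1 :+ k) :* x :+ (con 2 :+ k) :* y)) ≡.refl k x y ⟩
  x ℕ.+ (suc k ℕ.* x ℕ.+ suc (suc k) ℕ.* y)
    ≡⟨ ≡.cong (x ℕ.+_) (≡.cong₂ ℕ._+_ ([1+k]*[1+n]C[1+k]≡[1+n]*nCk n k) ([1+k]*[1+n]C[1+k]≡[1+n]*nCk n (suc k))) ⟩
  x ℕ.+ (suc n ℕ.* (n C k) ℕ.+ suc n ℕ.* (n C suc k))
    ≡⟨ ≡.cong (x ℕ.+_) (ℕₚ.*-distribˡ-+ (suc n) (n C k) (n C suc k)) ⟨
  x ℕ.+ suc n ℕ.* ((n C k) ℕ.+ (n C suc k))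
    ≡⟨ ≡.cong (λ z → x ℕ.+ suc n ℕ.* z) (nCk+nC[k+1]≡[n+1]C[k+1] n k) ⟩
  suc (suc n) ℕ.* x ∎
  where
  open ≡.≡-Reasoning
  open +-*-Solver
  x = suc n C suc k
  y = suc n C suc (suc k)

p∣pCk : ∀ {p k} → Prime (suc p) → k < p → suc p ∣ (suc p C suc k)
p∣pCk {p} {k} p-prime k<p with euclidsLemma (suc k) (suc p C suc k) p-prime
                            (divides (p C k) (≡.trans ([1+k]*[1+n]C[1+k]≡[1+n]*nCk p k) (ℕₚ.*-comm (suc p) (p C k))))
... | inj₁ p∣k = contradiction (∣⇒≤ p∣k) (ℕₚ.<⇒≱ (s≤s k<p))
... | inj₂ p∣C = p∣C

module CharacteristicP (R : CommutativeRing c ℓ) {p} (p-prime : Prime p) where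
  open CommutativeRing R hiding (zero)
  open SemiringMult semiring renaming (_×_ to infixr 8 _×ᴿ_)
  open SemiringSum semiring using (sum; sum-cong-≋; sum-init-last; sum-replicate-zero)
  open Exp semiring
  open SetoidReasoning setoid

  module _ (p×1≈0 : p ×ᴿ 1# ≈ 0#) where
    multiple-zero : ∀ {m} x → p ∣ m → m ×ᴿ x ≈ 0#
    multiple-zero {m} x (divides r eq) = begin
      m ×ᴿ x                      ≈⟨ ×-congʳ m (*-identityˡ x) ⟨
      m ×ᴿ (1# * x)               ≈⟨ ×-assoc-* m 1# x ⟨
      (m ×ᴿ 1#) * x               ≡⟨ ≡.cong (λ k → (k ×ᴿ 1#) * x) eq ⟩
      ((r ℕ.* p) ×ᴿ 1#) * x       ≈⟨ *-congʳ (×1-homo-* r p) ⟩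
      (r ×ᴿ 1#) * (p ×ᴿ 1#) * x   ≈⟨ *-congʳ (trans (*-congˡ p×1≈0) (zeroʳ _)) ⟩
      0# * x                      ≈⟨ zeroˡ x ⟩
      0#                          ∎

    frobenius-+ : ∀ x y → (x + y) ^ p ≈ x ^ p + y ^ p
    frobenius-+ x y = go p ≡.refl
      where
      go : ∀ m → m ≡ p → (x + y) ^ p ≈ x ^ p + y ^ p
      go zero 0≡p with prime⇒nonZero p-prime
      ... | nz = contradiction (≡.sym 0≡p) (ℕ.≢-nonZero⁻¹ p {{nz}})
      go (suc m) ≡.refl = begin
        (x + y) ^ suc m                ≈⟨ Binomial.theorem commutativeSemiring (suc m) x y ⟩
        term zero + sum (term ∘ suc)   ≈⟨ +-congˡ (sum-init-last (term ∘ suc)) ⟩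
        term zero + (sum (λ i → term (suc (Fin.inject₁ i))) + term (suc (Fin.fromℕ m)))
          ≈⟨ +-congˡ (+-congʳ (trans (sum-cong-≋ middle) (sum-replicate-zero m))) ⟩
        term zero + (0# + term (suc (Fin.fromℕ m)))  ≈⟨ +-cong first (trans (+-identityˡ _) last) ⟩
        y ^ suc m + x ^ suc m          ≈⟨ +-comm _ _ ⟩
        x ^ suc m + y ^ suc m          ∎
        where
        term : Fin (suc (suc m)) → Carrier
        term = Binomial.binomialTerm commutativeSemiring x y (suc m)
        first : term zero ≈ y ^ suc m
        first = begin
          (suc m C 0) ×ᴿ (1# * y ^ suc m)  ≡⟨ ≡.cong (_×ᴿ (1# * y ^ suc m)) (nC0≡1 (suc m)) ⟩
          1 ×ᴿ (1# * y ^ suc m)            ≈⟨ trans (×-homo-1 _) (*-identityˡ _) ⟩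
          y ^ suc m                        ∎
        last : term (suc (Fin.fromℕ m)) ≈ x ^ suc m
        last = begin
          term (suc (Fin.fromℕ m))
            ≡⟨ ≡.cong (λ k → (suc m C suc k) ×ᴿ (x ^ suc k * y ^ (m ℕ.∸ k))) (Finₚ.toℕ-fromℕ m) ⟩
          (suc m C suc m) ×ᴿ (x ^ suc m * y ^ (m ℕ.∸ m))
            ≡⟨ ≡.cong₂ (λ k l → k ×ᴿ (x ^ suc m * y ^ l)) (nCn≡1 (suc m)) (ℕₚ.n∸n≡0 m) ⟩
          1 ×ᴿ (x ^ suc m * 1#)  ≈⟨ trans (×-homo-1 _) (*-identityʳ _) ⟩
          x ^ suc m ∎
        middle : ∀ i → term (suc (Fin.inject₁ i)) ≈ 0#
        middle i = multiple-zero _ (p∣pCk p-prime (≡.subst (_< m) (≡.sym (Finₚ.toℕ-inject₁ i)) (Finₚ.toℕ<n i)))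

    frobenius^-+ : ∀ k x y → (x + y) ^ (p ℕ.^ k) ≈ x ^ (p ℕ.^ k) + y ^ (p ℕ.^ k)
    frobenius^-+ zero    x y = distribʳ 1# x y
    frobenius^-+ (suc k) x y = begin
      (x + y) ^ (p ℕ.* p ℕ.^ k)                    ≈⟨ ^-assocʳ (x + y) p _ ⟨
      ((x + y) ^ p) ^ (p ℕ.^ k)                    ≈⟨ ^-congˡ (p ℕ.^ k) (frobenius-+ x y) ⟩
      (x ^ p + y ^ p) ^ (p ℕ.^ k)                  ≈⟨ frobenius^-+ k (x ^ p) (y ^ p) ⟩
      (x ^ p) ^ (p ℕ.^ k) + (y ^ p) ^ (p ℕ.^ k)    ≈⟨ +-cong (^-assocʳ x p _) (^-assocʳ y p _) ⟩
      x ^ (p ℕ.* p ℕ.^ k) + y ^ (p ℕ.* p ℕ.^ k)    ∎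

module Characteristic {n} (F : CommutativeRing c ℓ) (isFiniteField : IsFiniteField n F) where
  open FiniteField F isFiniteField
  open SemiringMult semiring renaming (_×_ to infixr 8 _×ᴿ_)
  open SetoidReasoning setoid
  private module ∑ = CommutativeMonoidSum +-commutativeMonoid

  -- Translation by 1 permutes the field, so the sum S of all elements satisfies n · 1 + S = S.
  order×1≈0 : n ×ᴿ 1# ≈ 0#
  order×1≈0 = begin
    n ×ᴿ 1#                          ≈⟨ solve 2 (λ x y → x := x :+ y :- y) _ S ⟩
    n ×ᴿ 1# + S - S                  ≈⟨ +-congʳ (+-congʳ (∑.sum-replicate n)) ⟨
    ∑.sum {n} (λ _ → 1#) + S - S     ≈⟨ +-congʳ (∑.∑-distrib-+ (λ _ → 1#) element) ⟨
    ∑.sum (λ i → 1# + element i) - S ≈⟨ +-congʳ (∑.sum-cong-≋ (λ i → element-index (1# + element i))) ⟨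
    ∑.sum (λ i → element (index (1# + element i))) - S  ≈⟨ +-congʳ (∑.sum-permute element π) ⟨
    S - S                            ≈⟨ -‿inverseʳ S ⟩
    0#                               ∎
    where
    S = ∑.sum element
    shift : ∀ {u v} → u + v ≈ 0# → ∀ i → index (u + element (index (v + element i))) ≡ i
    shift {u} {v} u+v≈0 i = ≡.trans (index-cong (begin
      u + element (index (v + element i))  ≈⟨ +-congˡ (element-index _) ⟩
      u + (v + element i)                  ≈⟨ +-assoc _ _ _ ⟨
      u + v + element i                    ≈⟨ +-congʳ u+v≈0 ⟩
      0# + element i                       ≈⟨ +-identityˡ _ ⟩
      element i                            ∎)) (index-element i)
    π : Permutation.Permutation n n
    π = Permutation.permutation (λ i → index (1# + element i)) (λ i → index (- 1# + element i))
          (λ i → shift (-‿inverseʳ 1#) i)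
          (λ i → shift (-‿inverseˡ 1#) i)

  ^-zero⁻ : ∀ m {x} → x ^ m ≈ 0# → x ≈ 0#
  ^-zero⁻ zero    1≈0 = contradiction 1≈0 1≉0
  ^-zero⁻ (suc m) eq  = [ id , ^-zero⁻ m ]′ (*-zero eq)

  -- The k-th power of p · 1 is n · 1 = 0, and a field has no nilpotent elements.
  p×1≈0 : ∀ p k → n ≡ p ℕ.^ k → p ×ᴿ 1# ≈ 0#
  p×1≈0 p k eq = ^-zero⁻ k (trans (sym (power k)) (trans (reflexive (≡.cong (_×ᴿ 1#) (≡.sym eq))) order×1≈0))
    where
    power : ∀ k → (p ℕ.^ k) ×ᴿ 1# ≈ (p ×ᴿ 1#) ^ k
    power zero    = +-identityʳ 1#
    power (suc k) = trans (×1-homo-* p (p ℕ.^ k)) (*-congˡ (power k))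

-- A finite field F together with an embedding of a field K of prime power order
-- q, bundled to keep module telescopes short.
record FieldExtension (c ℓ c′ ℓ′ : Level) : Set (Level.suc (c Level.⊔ ℓ Level.⊔ c′ Level.⊔ ℓ′)) where
  field
    {q n}        : ℕ
    q-primePower : IsPrimePower q
    K            : CommutativeRing c ℓ
    K-finite     : IsFiniteField q K
    F            : CommutativeRing c′ ℓ′
    F-finite     : IsFiniteField n F
    ι            : CommutativeRing.Carrier K → CommutativeRing.Carrier F
    ι-hom        : Extension.IsEmbedding K F ι

module Frobenius (E : FieldExtension c ℓ c′ ℓ′) where

  open FieldExtension E
  open FiniteField F F-finite public
  open Characteristic F F-finite using (^-zero⁻) public
  private module K = FiniteField K K-finite
  open RingMorphisms K.rawRing rawRing using (module IsRingHomomorphism)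
  open IsRingHomomorphism ι-hom public using () renaming
    (⟦⟧-cong to ι-cong; +-homo to ι-+; *-homo to ι-*; 0#-homo to ι-0; 1#-homo to ι-1; -‿homo to ι-neg)
  open SetoidReasoning setoid
  open Trilinear F public

  ι-nonzero : ∀ {k} → ι k ≉ 0# → k K.≉ K.0#
  ι-nonzero ιk≉0 k≈0 = ιk≉0 (trans (ι-cong k≈0) ι-0)

  ι-zero⁻ : ∀ {k} → ι k ≈ 0# → k K.≈ K.0#
  ι-zero⁻ {k} ιk≈0 with k K.≟ K.0#
  ... | yes k≈0 = k≈0
  ... | no  k≉0 = contradiction (begin
    1#                    ≈⟨ ι-1 ⟨
    ι K.1#                ≈⟨ ι-cong (K.⁻¹-inverseʳ k≉0) ⟨
    ι (k K.* k K.⁻¹)      ≈⟨ ι-* k _ ⟩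
    ι k * ι (k K.⁻¹)      ≈⟨ *-congʳ ιk≈0 ⟩
    0# * ι (k K.⁻¹)       ≈⟨ zeroˡ _ ⟩
    0#                    ∎) 1≉0

  ι-sub : ∀ k l → ι (k K.- l) ≈ ι k - ι l
  ι-sub k l = trans (ι-+ k (K.- l)) (+-congˡ (ι-neg l))

  ι-injective : ∀ {k l} → ι k ≈ ι l → k K.≈ l
  ι-injective {k} {l} eq = K.x-y≈0⇒x≈y (ι-zero⁻ (trans (ι-sub k l) (x≈y⇒x-y≈0 eq)))

  ι-^ : ∀ k m → ι (k K.^ m) ≈ ι k ^ m
  ι-^ k zero    = ι-1
  ι-^ k (suc m) = trans (ι-* k _) (*-congˡ (ι-^ k m))

  φ : Carrier → Carrier
  φ x = x ^ q

  φ-cong : ∀ {x y} → x ≈ y → φ x ≈ φ y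
  φ-cong = ^-congˡ q

  φ-* : ∀ x y → φ (x * y) ≈ φ x * φ y
  φ-* x y = CommutativeExp.^-distrib-* commutativeSemiring x y q

  φ-ι : ∀ k → φ (ι k) ≈ ι k
  φ-ι k = trans (sym (ι-^ k q)) (ι-cong (K.fermat k))

  φ-0 : φ 0# ≈ 0#
  φ-0 = trans (φ-cong (sym ι-0)) (trans (φ-ι K.0#) ι-0)

  φ-1 : φ 1# ≈ 1#
  φ-1 = trans (φ-cong (sym ι-1)) (trans (φ-ι K.1#) ι-1)

  φ-+ : ∀ x y → φ (x + y) ≈ φ x + φ y
  φ-+ x y = go q-primePower
    where
    open SemiringMult semiring renaming (_×_ to infixr 8 _×ᴿ_)
    open SemiringMult K.semiring using () renaming (_×_ to infixr 8 _×ᴷ_)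
    ι-× : ∀ m → ι (m ×ᴷ K.1#) ≈ m ×ᴿ 1#
    ι-× zero    = ι-0
    ι-× (suc m) = trans (ι-+ _ _) (+-cong ι-1 (ι-× m))
    go : IsPrimePower q → φ (x + y) ≈ φ x + φ y
    go (p , k , p-prime , _ , q≡p^k) = ≡.subst (λ m → (x + y) ^ m ≈ x ^ m + y ^ m) (≡.sym q≡p^k)
      (CharacteristicP.frobenius^-+ F p-prime
        (trans (sym (ι-× p)) (trans (ι-cong (Characteristic.p×1≈0 K K-finite p k q≡p^k)) ι-0)) k x y)

  φ-neg : ∀ x → φ (- x) ≈ - φ x
  φ-neg x = begin
    φ (- x)                ≈⟨ solve 2 (λ a b → a := a :+ b :- b) _ (φ x) ⟩
    φ (- x) + φ x - φ x    ≈⟨ +-congʳ (φ-+ (- x) x) ⟨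
    φ (- x + x) - φ x      ≈⟨ +-congʳ (trans (φ-cong (-‿inverseˡ x)) φ-0) ⟩
    0# - φ x               ≈⟨ +-identityˡ _ ⟩
    - φ x                  ∎

  φ-sub : ∀ x y → φ (x - y) ≈ φ x - φ y
  φ-sub x y = trans (φ-+ x (- y)) (+-congˡ (φ-neg y))

  φ-zero⁻ : ∀ {x} → φ x ≈ 0# → x ≈ 0#
  φ-zero⁻ = ^-zero⁻ q

  φ-nonzero : ∀ {x} → x ≉ 0# → φ x ≉ 0#
  φ-nonzero x≉0 φx≈0 = x≉0 (φ-zero⁻ φx≈0)

  φ-injective : ∀ {x y} → φ x ≈ φ y → x ≈ y
  φ-injective {x} {y} eq = x-y≈0⇒x≈y (φ-zero⁻ (trans (φ-sub x y) (x≈y⇒x-y≈0 eq)))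

  1<q : 1 < q
  1<q = K.1<order

  -- An element outside the image of K would be one root too many of X^q - X, which already has the
  -- q elements of K as roots.
  fixed : ∀ x → φ x ≈ x → ∃ λ k → ι k ≈ x
  fixed x φx≈x with K.search (λ k≈l ιk≈x → trans (ι-cong (K.sym k≈l)) ιk≈x) (λ k → ι k ≟ x)
  ... | yes found = found
  ... | no  none  = contradiction
    (trans (sym (+-identityʳ 1#)) (poly-roots q X^q-X roots distinct (λ { zero → x≈y⇒x-y≈0 φx≈x ; (suc i) → x≈y⇒x-y≈0 (φ-ι (K.element i)) })))
    1≉0
    where
    X^q-X : IsPoly q (1# + 0#) (λ y → y ^ q - y)
    X^q-X = poly-+ q (poly-^ q) (poly-raise 1 (poly-neg 1 (poly-cong 1 refl (λ y → trans (+-identityʳ _) (*-identityˡ y)) (poly-linear 1# 0#))) 1<q)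
    roots : Vector Carrier (suc q)
    roots zero    = x
    roots (suc i) = ι (K.element i)
    distinct : Distinct roots
    distinct zero    zero    _  = ≡.refl
    distinct zero    (suc j) eq = contradiction (K.element j , sym eq) none
    distinct (suc i) zero    eq = contradiction (K.element i , eq) none
    distinct (suc i) (suc j) eq = ≡.cong suc (K.element-injective (ι-injective eq))

  -- The condition φ(T_ijk) = T_kij: invariance under Frobenius combined with a rotation of the
  -- tensor factors. Over 𝔽_{q³} it describes U₁; over 𝔽_{q⁶} it is inherited by the tensors lifted
  -- from there.
  record IsCyclic (T : Vector Carrier 8) : Set ℓ′ where
    field
      φ000 : φ (T 0F) ≈ T 0F
      φ100 : φ (T 4F) ≈ T 2F
      φ010 : φ (T 2F) ≈ T 1F
      φ001 : φ (T 1F) ≈ T 4F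
      φ011 : φ (T 3F) ≈ T 5F
      φ101 : φ (T 5F) ≈ T 6F
      φ110 : φ (T 6F) ≈ T 3F
      φ111 : φ (T 7F) ≈ T 7F

  private
    φ-8 : ∀ a b c d e f g h → φ (a + b + c + d + e + f + g + h) ≈ φ a + φ b + φ c + φ d + φ e + φ f + φ g + φ h
    φ-8 a b c d e f g h = trans (φ-+ _ _) (+-congʳ (trans (φ-+ _ _) (+-congʳ (trans (φ-+ _ _) (+-congʳ (trans (φ-+ _ _) (+-congʳ
      (trans (φ-+ _ _) (+-congʳ (trans (φ-+ _ _) (+-congʳ (φ-+ _ _))))))))))))

  module _ {T} (T-cyclic : IsCyclic T) where
    open IsCyclic T-cyclic

    φ-pairing : ∀ {S} → IsCyclic S → φ (pairing S T) ≈ pairing S T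
    φ-pairing {S} S-cyclic = trans (φ-8 _ _ _ _ _ _ _ _) (trans
      (+-cong (+-cong (+-cong (+-cong (+-cong (+-cong (+-cong (p S.φ000 φ000) (p S.φ001 φ001)) (p S.φ010 φ010)) (p S.φ011 φ011)) (p S.φ100 φ100)) (p S.φ101 φ101)) (p S.φ110 φ110)) (p S.φ111 φ111))
      (solve 8 (λ a b c d e f g h → a :+ e :+ b :+ f :+ c :+ g :+ d :+ h := a :+ b :+ c :+ d :+ e :+ f :+ g :+ h)
        (S 0F * T 0F) (S 1F * T 1F) (S 2F * T 2F) (S 3F * T 3F) (S 4F * T 4F) (S 5F * T 5F) (S 6F * T 6F) (S 7F * T 7F)))
      where
      module S = IsCyclic S-cyclic
      p : ∀ {x y x′ y′} → φ x ≈ x′ → φ y ≈ y′ → φ (x * y) ≈ x′ * y′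
      p eq eq′ = trans (φ-* _ _) (*-cong eq eq′)

    -- Frobenius rotates the indices of T, hence the arguments of the form.
    φ-tri : ∀ x₀ x₁ y₀ y₁ z₀ z₁ → φ (tri T x₀ x₁ y₀ y₁ z₀ z₁) ≈ tri T (φ z₀) (φ z₁) (φ x₀) (φ x₁) (φ y₀) (φ y₁)
    φ-tri x₀ x₁ y₀ y₁ z₀ z₁ = begin
      φ (tri T x₀ x₁ y₀ y₁ z₀ z₁)   ≈⟨ φ-cong (pairing-tensor T x₀ x₁ y₀ y₁ z₀ z₁) ⟨
      φ (pairing T (tensor x₀ x₁ y₀ y₁ z₀ z₁))  ≈⟨ trans (φ-8 _ _ _ _ _ _ _ _)
        (+-cong (+-cong (+-cong (+-cong (+-cong (+-cong (+-cong (p φ000) (p φ001)) (p φ010)) (p φ011)) (p φ100)) (p φ101)) (p φ110)) (p φ111)) ⟩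
      T 0F * (X₀ * Y₀ * Z₀) + T 4F * (X₀ * Y₀ * Z₁) + T 1F * (X₀ * Y₁ * Z₀) + T 5F * (X₀ * Y₁ * Z₁) +
      T 2F * (X₁ * Y₀ * Z₀) + T 6F * (X₁ * Y₀ * Z₁) + T 3F * (X₁ * Y₁ * Z₀) + T 7F * (X₁ * Y₁ * Z₁)
        ≈⟨ solve 14 (λ a b c d e f g h x₀ x₁ y₀ y₁ z₀ z₁ →
             a :* (x₀ :* y₀ :* z₀) :+ e :* (x₀ :* y₀ :* z₁) :+ b :* (x₀ :* y₁ :* z₀) :+ f :* (x₀ :* y₁ :* z₁) :+
             c :* (x₁ :* y₀ :* z₀) :+ g :* (x₁ :* y₀ :* z₁) :+ d :* (x₁ :* y₁ :* z₀) :+ h :* (x₁ :* y₁ :* z₁) :=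
             a :* (z₀ :* x₀ :* y₀) :+ b :* (z₀ :* x₀ :* y₁) :+ c :* (z₀ :* x₁ :* y₀) :+ d :* (z₀ :* x₁ :* y₁) :+
             e :* (z₁ :* x₀ :* y₀) :+ f :* (z₁ :* x₀ :* y₁) :+ g :* (z₁ :* x₁ :* y₀) :+ h :* (z₁ :* x₁ :* y₁))
             (T 0F) (T 1F) (T 2F) (T 3F) (T 4F) (T 5F) (T 6F) (T 7F) X₀ X₁ Y₀ Y₁ Z₀ Z₁ ⟩
      pairing T (tensor Z₀ Z₁ X₀ X₁ Y₀ Y₁)   ≈⟨ pairing-tensor T Z₀ Z₁ X₀ X₁ Y₀ Y₁ ⟩
      tri T Z₀ Z₁ X₀ X₁ Y₀ Y₁ ∎
      where
      X₀ = φ x₀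
      X₁ = φ x₁
      Y₀ = φ y₀
      Y₁ = φ y₁
      Z₀ = φ z₀
      Z₁ = φ z₁
      p : ∀ {t t′ x y z} → φ t ≈ t′ → φ (t * (x * y * z)) ≈ t′ * (φ x * φ y * φ z)
      p eq = trans (φ-* _ _) (*-cong eq (trans (φ-* _ _) (*-congʳ (φ-* _ _))))

  module KLinear (V : LeftModule (CommutativeRing.ring K) ℓm ℓm′) where

    open LeftModule V
    open Projective V using (combination)
    open LinearAlgebra K K-finite using (dot)

    record IsLinear (f : Carrierᴹ → Carrier) : Set (c Level.⊔ c′ Level.⊔ ℓ′ Level.⊔ ℓm Level.⊔ ℓm′) where
      field
        resp : ∀ {u v} → u ≈ᴹ v → f u ≈ f v
        +-homo : ∀ u v → f (u +ᴹ v) ≈ f u + f v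
        *-homo : ∀ k v → f (k *ₗ v) ≈ ι k * f v

      0-homo : f 0ᴹ ≈ 0#
      0-homo = trans (resp (≈ᴹ-sym (*ₗ-zeroˡ 0ᴹ))) (trans (*-homo K.0# 0ᴹ) (trans (*-congʳ ι-0) (zeroˡ _)))

      combination-homo : ∀ {n} {d : Vector K.Carrier n} {h : Vector Carrierᴹ n} → (∀ j → ι (d j) ≈ f (h j)) →
                         ∀ k → ι (dot d k) ≈ f (combination k h)
      combination-homo {zero}  eq k = trans ι-0 (sym 0-homo)
      combination-homo {suc n} eq k = trans (ι-+ _ _) (trans
        (+-cong (trans (ι-* _ _) (trans (*-comm _ _) (trans (*-congˡ (eq zero)) (sym (*-homo (k zero) _))))) (combination-homo (eq ∘ suc) (k ∘ suc)))
        (sym (+-homo _ _)))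

  -- The toric surface of degree 6

  module Hexagon (n≡q⁶ : n ≡ q ℕ.^ 6) where

    φ₂ φ₃ φ₄ φ₅ : Carrier → Carrier
    φ₂ x = φ (φ x)
    φ₃ x = φ (φ₂ x)
    φ₄ x = φ (φ₃ x)
    φ₅ x = φ (φ₄ x)

    private
      φⁱ : ℕ → Carrier → Carrier
      φⁱ zero    x = x
      φⁱ (suc k) x = φ (φⁱ k x)

      φⁱ≈^ : ∀ k x → φⁱ k x ≈ x ^ (q ℕ.^ k)
      φⁱ≈^ zero    x = sym (*-identityʳ x)
      φⁱ≈^ (suc k) x = trans (φ-cong (φⁱ≈^ k x)) (trans (Exp.^-assocʳ semiring x (q ℕ.^ k) q)
        (reflexive (≡.cong (x ^_) (ℕₚ.*-comm (q ℕ.^ k) q))))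

    φ₆-id : ∀ x → φ (φ₅ x) ≈ x
    φ₆-id x = begin
      φ (φ₅ x)      ≈⟨ φⁱ≈^ 6 x ⟩
      x ^ (q ℕ.^ 6) ≡⟨ ≡.cong (x ^_) (≡.sym n≡q⁶) ⟩
      x ^ n         ≈⟨ fermat x ⟩
      x             ∎

    Tr : Carrier → Carrier
    Tr x = x + φ x + φ₂ x + φ₃ x + φ₄ x + φ₅ x

    φ₂-cong : ∀ {x y} → x ≈ y → φ₂ x ≈ φ₂ y
    φ₂-cong eq = φ-cong (φ-cong eq)

    φ₃-cong : ∀ {x y} → x ≈ y → φ₃ x ≈ φ₃ y
    φ₃-cong eq = φ-cong (φ₂-cong eq)

    φ₂-* : ∀ x y → φ₂ (x * y) ≈ φ₂ x * φ₂ y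
    φ₂-* x y = trans (φ-cong (φ-* x y)) (φ-* _ _)

    φ₃-* : ∀ x y → φ₃ (x * y) ≈ φ₃ x * φ₃ y
    φ₃-* x y = trans (φ-cong (φ₂-* x y)) (φ-* _ _)

    φ₄-* : ∀ x y → φ₄ (x * y) ≈ φ₄ x * φ₄ y
    φ₄-* x y = trans (φ-cong (φ₃-* x y)) (φ-* _ _)

    φ₅-* : ∀ x y → φ₅ (x * y) ≈ φ₅ x * φ₅ y
    φ₅-* x y = trans (φ-cong (φ₄-* x y)) (φ-* _ _)

    Tr-cong : ∀ {x y} → x ≈ y → Tr x ≈ Tr y
    Tr-cong x≈y = +-cong (+-cong (+-cong (+-cong (+-cong x≈y (φ-cong x≈y)) (φ₂-cong x≈y)) (φ₃-cong x≈y))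
      (φ-cong (φ₃-cong x≈y))) (φ-cong (φ-cong (φ₃-cong x≈y)))

    Tr-+ : ∀ x y → Tr (x + y) ≈ Tr x + Tr y
    Tr-+ x y = trans
      (+-cong (+-cong (+-cong (+-cong (+-congˡ (φ-+ x y)) h₂) h₃) h₄) h₅)
      (solve 12 (λ a b c d e f a′ b′ c′ d′ e′ f′ →
        a :+ a′ :+ (b :+ b′) :+ (c :+ c′) :+ (d :+ d′) :+ (e :+ e′) :+ (f :+ f′) :=
        a :+ b :+ c :+ d :+ e :+ f :+ (a′ :+ b′ :+ c′ :+ d′ :+ e′ :+ f′))
        x (φ x) (φ₂ x) (φ₃ x) (φ₄ x) (φ₅ x) y (φ y) (φ₂ y) (φ₃ y) (φ₄ y) (φ₅ y))
      where
      h₂ = trans (φ-cong (φ-+ x y)) (φ-+ _ _)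
      h₃ = trans (φ-cong h₂) (φ-+ _ _)
      h₄ = trans (φ-cong h₃) (φ-+ _ _)
      h₅ = trans (φ-cong h₄) (φ-+ _ _)

    Tr-scale : ∀ {k} x → φ k ≈ k → Tr (k * x) ≈ k * Tr x
    Tr-scale {k} x φk≈k = trans (+-cong (+-cong (+-cong (+-cong (+-congˡ h₁) h₂) h₃) h₄) h₅)
      (solve 7 (λ k a b c d e f → k :* a :+ k :* b :+ k :* c :+ k :* d :+ k :* e :+ k :* f := k :* (a :+ b :+ c :+ d :+ e :+ f))
        k x (φ x) (φ₂ x) (φ₃ x) (φ₄ x) (φ₅ x))
      where
      step : ∀ {y z} → y ≈ k * z → φ y ≈ k * φ z
      step eq = trans (φ-cong eq) (trans (φ-* _ _) (*-congʳ φk≈k))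
      h₁ = step {z = x} refl
      h₂ = step h₁
      h₃ = step h₂
      h₄ = step h₃
      h₅ = step h₄

    Tr-0 : Tr 0# ≈ 0#
    Tr-0 = trans (Tr-cong (sym (zeroˡ 0#))) (trans (Tr-scale 0# φ-0) (zeroˡ _))

    Tr-sub : ∀ x y → Tr (x - y) ≈ Tr x - Tr y
    Tr-sub x y = begin
      Tr (x - y)               ≈⟨ solve 2 (λ a b → a := a :+ b :- b) _ (Tr y) ⟩
      Tr (x - y) + Tr y - Tr y ≈⟨ +-congʳ (trans (Tr-cong (solve 2 (λ x y → x := x :- y :+ y) x y)) (Tr-+ (x - y) y)) ⟨
      Tr x - Tr y              ∎

    Tr-φ : ∀ x → Tr (φ x) ≈ Tr x
    Tr-φ x = trans (+-congˡ (φ₆-id x))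
      (solve 6 (λ a b c d e f → b :+ c :+ d :+ e :+ f :+ a := a :+ b :+ c :+ d :+ e :+ f) x (φ x) (φ₂ x) (φ₃ x) (φ₄ x) (φ₅ x))

    φ-Tr : ∀ x → φ (Tr x) ≈ Tr x
    φ-Tr x = trans (trans (φ-+ _ _) (+-congʳ (trans (φ-+ _ _) (+-congʳ (trans (φ-+ _ _) (+-congʳ (trans (φ-+ _ _) (+-congʳ (φ-+ _ _))))))))) (Tr-φ x)

    -- As a polynomial the trace is monic of degree q⁵, so it cannot vanish at q⁵ + 1 of the q⁶
    -- elements.
    Tr-nontrivial : ∃ λ θ → Tr θ ≉ 0#
    Tr-nontrivial with search (λ x≈y Tx≉0 Ty≈0 → Tx≉0 (trans (Tr-cong x≈y) Ty≈0)) (λ x → Dec.¬? (Tr x ≟ 0#))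
    ... | yes found = found
    ... | no  none  = contradiction (trans (sym lead) (poly-roots (q ℕ.^ 5) Tr-poly (λ i → element (Fin.inject≤ i q⁵<n))
          (λ i j eq → Finₚ.inject≤-injective q⁵<n q⁵<n i j (element-injective eq))
          (λ i → Dec.decidable-stable (Tr _ ≟ 0#) (λ T≉0 → none (_ , T≉0))))) 1≉0
      where
      mono : ∀ {i j} → i < j → q ℕ.^ i < q ℕ.^ j
      mono = ℕₚ.^-monoʳ-< q 1<q
      q⁵<n : q ℕ.^ 5 < n
      q⁵<n = ≡.subst (q ℕ.^ 5 <_) (≡.sym n≡q⁶) (mono {5} {6} ℕₚ.≤-refl)
      low : ∀ k → k < 5 → IsPoly (q ℕ.^ 5) 0# (φⁱ k)
      low k k<5 = poly-raise (q ℕ.^ k) (poly-cong (q ℕ.^ k) refl (λ x → sym (φⁱ≈^ k x)) (poly-^ (q ℕ.^ k))) (mono k<5)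
      Tr-poly : IsPoly (q ℕ.^ 5) (0# + 0# + 0# + 0# + 0# + 1#) Tr
      Tr-poly = poly-+ d (poly-+ d (poly-+ d (poly-+ d (poly-+ d (low 0 (s≤s z≤n)) (low 1 (s≤s (s≤s z≤n)))) (low 2 (s≤s (s≤s (s≤s z≤n))))) (low 3 (s≤s (s≤s (s≤s (s≤s z≤n))))))
          (low 4 (s≤s (s≤s (s≤s (s≤s (s≤s z≤n))))))) (poly-cong d refl (λ x → sym (φⁱ≈^ 5 x)) (poly-^ d))
        where d = q ℕ.^ 5
      lead : 0# + 0# + 0# + 0# + 0# + 1# ≈ 1#
      lead = solve 0 (con (+ 0) :+ con (+ 0) :+ con (+ 0) :+ con (+ 0) :+ con (+ 0) :+ con (+ 1) := con (+ 1))

    module Surface (ν : Carrier) (ν≉0 : ν ≉ 0#) (φ₂ν≈ν : φ₂ ν ≈ ν) where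

      OnSurface : Carrier → Set _
      OnSurface w = w ≉ 0# × w * φ₂ w ≈ ν * φ w

      functional : Carrier → Carrier → Carrier → Carrier
      functional α β w = α + Tr (β * w)

      private
        ν̄ = φ ν
        N = ν * ν̄

        φN≈N : φ N ≈ N
        φN≈N = trans (φ-* _ _) (trans (*-congˡ φ₂ν≈ν) (*-comm _ _))

      module _ {w} (w∈ : OnSurface w) where
        private
          w≉0 = proj₁ w∈
          eq = proj₂ w∈
          φw≉0 = φ-nonzero w≉0

        -- This and the next two identities, together with the surface equation, express every
        -- conjugate of w as a Laurent monomial in w and y = φ(w): the conjugates φ₂, φ₃, φ₄, φ₅ are
        -- νy/w, N/w, N/y and ν̄w/y.
        w*φ₃w≈N : w * φ₃ w ≈ N
        w*φ₃w≈N = *-cancelˡ φw≉0 (begin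
          φ w * (w * φ₃ w)  ≈⟨ solve 3 (λ a b c → a :* (b :* c) := b :* (a :* c)) (φ w) w (φ₃ w) ⟩
          w * (φ w * φ₃ w)  ≈⟨ *-congˡ (trans (sym (φ-* _ _)) (trans (φ-cong eq) (φ-* _ _))) ⟩
          w * (ν̄ * φ₂ w)    ≈⟨ solve 3 (λ a b c → a :* (b :* c) := b :* (a :* c)) w ν̄ (φ₂ w) ⟩
          ν̄ * (w * φ₂ w)    ≈⟨ *-congˡ eq ⟩
          ν̄ * (ν * φ w)     ≈⟨ solve 3 (λ a b c → a :* (b :* c) := c :* (b :* a)) ν̄ ν (φ w) ⟩
          φ w * N           ∎)

        φw*φ₄w≈N : φ w * φ₄ w ≈ N
        φw*φ₄w≈N = trans (sym (φ-* _ _)) (trans (φ-cong w*φ₃w≈N) φN≈N)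

        φw*φ₅w≈ν̄w : φ w * φ₅ w ≈ ν̄ * w
        φw*φ₅w≈ν̄w = begin
          φ w * φ₅ w            ≈⟨ *-congʳ (φ-cong (φ₆-id w)) ⟨
          φ₅ (φ₂ w) * φ₅ w      ≈⟨ trans (*-comm _ _) (sym (φ₅-* w (φ₂ w))) ⟩
          φ₅ (w * φ₂ w)         ≈⟨ φ-cong (φ-cong (φ₃-cong eq)) ⟩
          φ₅ (ν * φ w)          ≈⟨ φ₅-* ν (φ w) ⟩
          φ₅ ν * φ₅ (φ w)       ≈⟨ *-cong (φ-cong (trans (φ-cong (φ-cong φ₂ν≈ν)) φ₂ν≈ν)) (φ₆-id w) ⟩
          ν̄ * w                 ∎

      -- On the surface, w φ(w) (α + Tr (β w)) = A y² + B y + w C at y = φ(w).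
      module Curve (α β : Carrier) where
        A B C : Carrier → Carrier
        A x = φ β * x + φ₂ β * ν
        B x = x * (β * x + α) + φ₃ β * N
        C x = φ₅ β * ν̄ * x + φ₄ β * N

        A-poly : IsPoly 1 (φ β) A
        A-poly = poly-linear _ _

        B-poly : IsPoly 2 β B
        B-poly = (λ x → β * x + α) , φ₃ β * N , poly-linear β α , λ x → refl

        C-poly : IsPoly 1 (φ₅ β * ν̄) C
        C-poly = poly-linear _ _

        equation : ∀ {w} → OnSurface w → functional α β w ≈ 0# → A w * (φ w * φ w) + B w * φ w + w * C w ≈ 0#
        equation {w} w∈ f≈0 = begin
          A w * (y * y) + B w * y + w * C w
            ≈⟨ solve 12 (λ w y α β β₁ β₂ β₃ β₄ β₅ ν ν̄ N →
                 (β₁ :* w :+ β₂ :* ν) :* (y :* y) :+ (w :* (β :* w :+ α) :+ β₃ :* N) :* y :+ w :* (β₅ :* ν̄ :* w :+ β₄ :* N)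
                 := w :* y :* α :+ w :* y :* (β :* w) :+ w :* y :* (β₁ :* y) :+ β₂ :* y :* (ν :* y) :+ β₃ :* y :* N :+ β₄ :* w :* N :+ β₅ :* w :* (ν̄ :* w)) w y α β (φ β) (φ₂ β) (φ₃ β) (φ₄ β) (φ₅ β) ν ν̄ N ⟩
          w * y * α + w * y * (β * w) + w * y * (φ β * y) + φ₂ β * y * (ν * y) + φ₃ β * y * N + φ₄ β * w * N + φ₅ β * w * (ν̄ * w)
            -- The last four terms contain νy, N, N and ν̄w, which are wφ₂(w), wφ₃(w), yφ₄(w) and
            -- yφ₅(w).
            ≈⟨ +-cong (+-cong (+-cong (+-congˡ (*-congˡ (proj₂ w∈))) (*-congˡ (w*φ₃w≈N w∈))) (*-congˡ (φw*φ₄w≈N w∈))) (*-congˡ (φw*φ₅w≈ν̄w w∈)) ⟨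
          w * y * α + w * y * (β * w) + w * y * (φ β * y) + φ₂ β * y * (w * φ₂ w) + φ₃ β * y * (w * φ₃ w) + φ₄ β * w * (y * φ₄ w) + φ₅ β * w * (y * φ₅ w)
            ≈⟨ solve 13 (λ w y w₂ w₃ w₄ w₅ α β β₁ β₂ β₃ β₄ β₅ →
                 w :* y :* α :+ w :* y :* (β :* w) :+ w :* y :* (β₁ :* y) :+ β₂ :* y :* (w :* w₂) :+ β₃ :* y :* (w :* w₃) :+ β₄ :* w :* (y :* w₄) :+ β₅ :* w :* (y :* w₅)
                 := w :* y :* (α :+ (β :* w :+ β₁ :* y :+ β₂ :* w₂ :+ β₃ :* w₃ :+ β₄ :* w₄ :+ β₅ :* w₅))) w y (φ₂ w) (φ₃ w) (φ₄ w) (φ₅ w) α β (φ β) (φ₂ β) (φ₃ β) (φ₄ β) (φ₅ β) ⟩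
          w * y * (α + (β * w + φ β * y + φ₂ β * φ₂ w + φ₃ β * φ₃ w + φ₄ β * φ₄ w + φ₅ β * φ₅ w))
            ≈⟨ *-congˡ (+-congˡ (+-cong (+-cong (+-cong (+-cong (+-congˡ (φ-* β w)) (φ₂-* β w)) (φ₃-* β w)) (φ₄-* β w)) (φ₅-* β w))) ⟨
          w * y * functional α β w   ≈⟨ trans (*-congˡ f≈0) (zeroʳ _) ⟩
          0#                         ∎
          where y = φ w

      -- Substituting y = w^q into the equation of the curve gives a polynomial in w of degree 2q +
      -- 1. Its leading coefficient φ(β) comes from A y² alone, because q > 1 makes the degree q + 2
      -- of B y smaller. With β = 0 the functional is the constant α.
      zeros-bound : ∀ α β (v : Vector Carrier (suc (suc (2 ℕ.* q)))) → Distinct v →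
                    (∀ i → OnSurface (v i)) → (∀ i → functional α β (v i) ≈ 0#) → α ≈ 0# × β ≈ 0#
      zeros-bound α β v distinct v∈ f≈0 = α≈0 , β≈0
        where
        open Curve α β
        m = suc (2 ℕ.* q)
        q+q≤ : q ℕ.+ q ≡ 2 ℕ.* q
        q+q≤ = ≡.cong (q ℕ.+_) (≡.sym (ℕₚ.+-identityʳ q))
        P : IsPoly m (φ β * (1# * 1#) + 0# + 0#) (λ x → A x * (φ x * φ x) + B x * φ x + x * C x)
        P = poly-+ m (poly-+ m
              (≡.subst (λ k → IsPoly (suc k) (φ β * (1# * 1#)) (λ x → A x * (φ x * φ x))) q+q≤ (poly-* 1 (q ℕ.+ q) A-poly (poly-* q q (poly-^ q) (poly-^ q))))
              (poly-raise (2 ℕ.+ q) (poly-* 2 q B-poly (poly-^ q)) (s≤s (≡.subst (2 ℕ.+ q ≤_) q+q≤ (ℕₚ.+-monoˡ-≤ q 1<q)))))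
              (poly-raise 2 (poly-x* 1 C-poly) (s≤s (≡.subst (2 ≤_) q+q≤ (ℕₚ.≤-trans 1<q (ℕₚ.m≤m+n q q)))))
        β≈0 : β ≈ 0#
        β≈0 = φ-zero⁻ (trans (solve 1 (λ b → b := b :* (con (+ 1) :* con (+ 1)) :+ con (+ 0) :+ con (+ 0)) (φ β))
                (poly-roots m P v distinct (λ i → equation (v∈ i) (f≈0 i))))
        α≈0 : α ≈ 0#
        α≈0 = begin
          α                             ≈⟨ trans (+-congˡ (trans (Tr-cong (trans (*-congʳ β≈0) (zeroˡ _))) Tr-0)) (+-identityʳ α) ⟨
          functional α β (v zero)       ≈⟨ f≈0 zero ⟩
          0#                            ∎

      -- The resultant with respect to y of the equations of two curves is a
      -- polynomial of degree 6, with leading coefficient a product of conjugates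
      -- of the 2×2 minor φ(β)β′ - φ(β′)β.
      bezout : ∀ α β α′ β′ (v : Vector Carrier 7) → Distinct v → (∀ i → OnSurface (v i)) →
               (∀ i → functional α β (v i) ≈ 0#) → (∀ i → functional α′ β′ (v i) ≈ 0#) → φ β * β′ ≈ φ β′ * β
      bezout α β α′ β′ v distinct v∈ f≈0 f′≈0 = conclude (*-zero (trans (sym (+-identityʳ _)) (trans (+-congˡ (sym -0#≈0#)) (poly-roots 6 R-poly v distinct R≈0))))
        where
        open Curve α β
        open Curve α′ β′ using () renaming (A to A′; B to B′; C to C′; A-poly to A′-poly; B-poly to B′-poly; C-poly to C′-poly; equation to equation′)
        G H D R : Carrier → Carrier
        G x = A x * B′ x - A′ x * B x
        H x = B x * C′ x - B′ x * C x
        D x = A x * C′ x - A′ x * C x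
        -- The constant terms x C and x C′ make the resultant divisible by x. Dividing by it lowers
        -- the degree from 7 to 6; the term with D has degree 5 and leaves the leading coefficient
        -- to G H.
        R x = G x * H x - x * (D x * D x)
        R-poly : IsPoly 6 ((φ β * β′ - φ β′ * β) * (β * (φ₅ β′ * ν̄) - β′ * (φ₅ β * ν̄)) - 0#) R
        R-poly = poly-+ 6 (poly-* 3 3 (poly-+ 3 (poly-* 1 2 A-poly B′-poly) (poly-neg 3 (poly-* 1 2 A′-poly B-poly)))
                                       (poly-+ 3 (poly-* 2 1 B-poly C′-poly) (poly-neg 3 (poly-* 2 1 B′-poly C-poly))))
                          (poly-neg 6 (poly-raise 5 (poly-x* 4 (poly-* 2 2 D-poly D-poly)) ℕₚ.≤-refl))
          where
          D-poly = poly-+ 2 (poly-* 1 1 A-poly C′-poly) (poly-neg 2 (poly-* 1 1 A′-poly C-poly))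
        R≈0 : ∀ i → R (v i) ≈ 0#
        R≈0 i = *-zeroʳ⁻ y≉0 (begin
          y * R x                      ≈⟨ solve 4 (λ y G H xE² → y :* (G :* H :- xE²) := (G :* y) :* H :- y :* xE²) y (G x) (H x) (x * (D x * D x)) ⟩
          G x * y * H x - y * (x * (D x * D x))  ≈⟨ +-congʳ (*-congʳ Gy) ⟩
          - (x * D x) * H x - y * (x * (D x * D x))
            ≈⟨ solve 4 (λ x y D H → :- (x :* D) :* H :- y :* (x :* (D :* D)) := :- (x :* D :* (D :* y :+ H))) x y (D x) (H x) ⟩
          - (x * D x * (D x * y + H x))  ≈⟨ -‿cong (*-congˡ Dy+H) ⟩
          - (x * D x * 0#)              ≈⟨ trans (-‿cong (zeroʳ _)) -0#≈0# ⟩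
          0#                            ∎)
          where
          x = v i
          y = φ x
          x≉0 = proj₁ (v∈ i)
          y≉0 = φ-nonzero x≉0
          e₁ = equation (v∈ i) (f≈0 i)
          e₂ = equation′ (v∈ i) (f′≈0 i)
          combine₁ : ∀ s t → s * 0# - t * 0# ≈ 0#
          combine₁ s t = solve 2 (λ s t → s :* con (+ 0) :- t :* con (+ 0) := con (+ 0)) s t
          -- Elimination of y² from the two equations; `Dy+H` eliminates the constant terms and
          -- cancels y. Substituting one relation into the other gives R = 0.
          Gy : G x * y ≈ - (x * D x)
          Gy = x-y≈0⇒x≈y (begin
            G x * y - - (x * D x)
              ≈⟨ solve 8 (λ A B C A′ B′ C′ x y → (A :* B′ :- A′ :* B) :* y :- :- (x :* (A :* C′ :- A′ :* C)) :=
                   A :* (A′ :* (y :* y) :+ B′ :* y :+ x :* C′) :- A′ :* (A :* (y :* y) :+ B :* y :+ x :* C))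
                   (A x) (B x) (C x) (A′ x) (B′ x) (C′ x) x y ⟩
            A x * (A′ x * (y * y) + B′ x * y + x * C′ x) - A′ x * (A x * (y * y) + B x * y + x * C x)
              ≈⟨ +-cong (*-congˡ e₂) (-‿cong (*-congˡ e₁)) ⟩
            A x * 0# - A′ x * 0#  ≈⟨ combine₁ _ _ ⟩
            0# ∎)
          Dy+H : D x * y + H x ≈ 0#
          Dy+H = *-zeroʳ⁻ y≉0 (begin
            y * (D x * y + H x)
              ≈⟨ solve 8 (λ A B C A′ B′ C′ x y → y :* ((A :* C′ :- A′ :* C) :* y :+ (B :* C′ :- B′ :* C)) :=
                   C′ :* (A :* (y :* y) :+ B :* y :+ x :* C) :- C :* (A′ :* (y :* y) :+ B′ :* y :+ x :* C′))
                   (A x) (B x) (C x) (A′ x) (B′ x) (C′ x) x y ⟩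
            C′ x * (A x * (y * y) + B x * y + x * C x) - C x * (A′ x * (y * y) + B′ x * y + x * C′ x)
              ≈⟨ +-cong (*-congˡ e₁) (-‿cong (*-congˡ e₂)) ⟩
            C′ x * 0# - C x * 0#  ≈⟨ combine₁ _ _ ⟩
            0# ∎)
        conclude : φ β * β′ - φ β′ * β ≈ 0# ⊎ β * (φ₅ β′ * ν̄) - β′ * (φ₅ β * ν̄) ≈ 0# → φ β * β′ ≈ φ β′ * β
        conclude (inj₁ eq) = x-y≈0⇒x≈y eq
        -- The second factor is ν̄ times the image of the minor under φ₅, the inverse of φ, so it
        -- vanishes only if the minor does.
        conclude (inj₂ eq) = begin
          φ β * β′          ≈⟨ *-congˡ (φ₆-id β′) ⟨
          φ β * φ (φ₅ β′)   ≈⟨ φ-* β (φ₅ β′) ⟨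
          φ (β * φ₅ β′)     ≈⟨ φ-cong (*-cancelˡ (φ-nonzero ν≉0) (begin
            ν̄ * (β * φ₅ β′)    ≈⟨ solve 3 (λ ν a b → ν :* (a :* b) := a :* (b :* ν)) ν̄ β (φ₅ β′) ⟩
            β * (φ₅ β′ * ν̄)    ≈⟨ x-y≈0⇒x≈y eq ⟩
            β′ * (φ₅ β * ν̄)    ≈⟨ solve 3 (λ ν a b → ν :* (a :* b) := a :* (b :* ν)) ν̄ β′ (φ₅ β) ⟨
            ν̄ * (β′ * φ₅ β)    ∎)) ⟩
          φ (β′ * φ₅ β)     ≈⟨ φ-* β′ (φ₅ β) ⟩
          φ β′ * φ (φ₅ β)   ≈⟨ *-congˡ (φ₆-id β) ⟩
          φ β′ * β          ∎

    -- The case q = 4: thirteenth roots of unity in characteristic 2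

    module OrderFour (q≡4 : q ≡ 4) where

      open Exp semiring using (^-homo-*; ^-assocʳ)

      2x≈0 : ∀ x → x + x ≈ 0#
      2x≈0 x = begin
        x + x            ≈⟨ solve 1 (λ x → x :+ x := (con (+ 1) :+ con (+ 1)) :* x) x ⟩
        (1# + 1#) * x    ≈⟨ *-congʳ 2≈0 ⟩
        0# * x           ≈⟨ zeroˡ x ⟩
        0#               ∎
        where
        2≈0 : 1# + 1# ≈ 0#
        2≈0 = begin
          1# + 1#            ≈⟨ +-cong ι-1 ι-1 ⟨
          ι K.1# + ι K.1#    ≈⟨ ι-+ _ _ ⟨
          ι (K.1# K.+ K.1#)  ≈⟨ ι-cong (K.trans (K.+-congˡ (K.sym (K.+-identityʳ K.1#))) (Characteristic.p×1≈0 K K-finite 2 2 q≡4)) ⟩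
          ι K.0#             ≈⟨ ι-0 ⟩
          0#                 ∎

      φ≈^4 : ∀ x → φ x ≈ x ^ 4
      φ≈^4 x = reflexive (≡.cong (x ^_) q≡4)

      1^n≈1 : ∀ n {x} → x ≈ 1# → x ^ n ≈ 1#
      1^n≈1 zero    x≈1 = refl
      1^n≈1 (suc n) x≈1 = trans (*-cong x≈1 (1^n≈1 n x≈1)) (*-identityˡ 1#)

      ^-nonzero : ∀ n {x} → x ≉ 0# → x ^ n ≉ 0#
      ^-nonzero n x≉0 eq = x≉0 (^-zero⁻ n eq)

      module ThirteenthRoot {ζ} (ζ¹³≈1 : ζ ^ 13 ≈ 1#) (ζ≉1 : ζ ≉ 1#) where

        ^-multiple : ∀ k {d} → ζ ^ d ≈ 1# → ζ ^ (k ℕ.* d) ≈ 1#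
        ^-multiple k {d} ζᵈ≈1 = begin
          ζ ^ (k ℕ.* d)  ≡⟨ ≡.cong (ζ ^_) (ℕₚ.*-comm k d) ⟩
          ζ ^ (d ℕ.* k)  ≈⟨ ^-assocʳ ζ d k ⟨
          (ζ ^ d) ^ k    ≈⟨ 1^n≈1 k ζᵈ≈1 ⟩
          1#             ∎

        -- As 13 is prime, a Bézout identity between 13 and d expresses ζ through ζ^13 and ζ^d.
        ζᵈ≉1 : ∀ {d} → 0 < d → d < 13 → ζ ^ d ≉ 1#
        ζᵈ≉1 {d} 0<d d<13 ζᵈ≈1 = go (coprime-Bézout (prime⇒coprime (Dec.toWitness {a? = prime? 13} tt) {{ℕ.>-nonZero 0<d}} d<13))
          where
          go : Bézout.Identity 1 13 d → _
          go (Bézout.+- x y eq) = ζ≉1 (begin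
            ζ                       ≈⟨ *-identityʳ ζ ⟨
            ζ * 1#                  ≈⟨ *-congˡ (^-multiple y ζᵈ≈1) ⟨
            ζ * ζ ^ (y ℕ.* d)       ≡⟨ ≡.cong (ζ ^_) eq ⟩
            ζ ^ (x ℕ.* 13)          ≈⟨ ^-multiple x ζ¹³≈1 ⟩
            1#                      ∎)
          go (Bézout.-+ x y eq) = ζ≉1 (begin
            ζ                       ≈⟨ *-identityʳ ζ ⟨
            ζ * 1#                  ≈⟨ *-congˡ (^-multiple x ζ¹³≈1) ⟨
            ζ * ζ ^ (x ℕ.* 13)      ≡⟨ ≡.cong (ζ ^_) eq ⟩
            ζ ^ (y ℕ.* d)           ≈⟨ ^-multiple y ζᵈ≈1 ⟩
            1#                      ∎)

        ζ≉0 : ζ ≉ 0#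
        ζ≉0 ζ≈0 = 1≉0 (trans (sym ζ¹³≈1) (trans (*-congʳ ζ≈0) (zeroˡ _)))

        ^-distinct< : ∀ {i j} → i < j → j < 13 → ζ ^ i ≉ ζ ^ j
        ^-distinct< {i} {j} i<j j<13 eq = ζᵈ≉1 (ℕₚ.m<n⇒0<n∸m i<j) (ℕₚ.≤-<-trans (ℕₚ.m∸n≤m j i) j<13)
          (*-cancelˡ (^-nonzero i ζ≉0) (begin
            ζ ^ i * ζ ^ (j ℕ.∸ i)    ≈⟨ ^-homo-* ζ i (j ℕ.∸ i) ⟨
            ζ ^ (i ℕ.+ (j ℕ.∸ i))    ≡⟨ ≡.cong (ζ ^_) (ℕₚ.m+[n∸m]≡n (ℕₚ.<⇒≤ i<j)) ⟩
            ζ ^ j                    ≈⟨ eq ⟨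
            ζ ^ i                    ≈⟨ *-identityʳ _ ⟨
            ζ ^ i * 1#               ∎))

        ^-distinct : ∀ {i j} → i < 13 → j < 13 → ζ ^ i ≈ ζ ^ j → i ≡ j
        ^-distinct {i} {j} i<13 j<13 eq with ℕₚ.<-cmp i j
        ... | tri< i<j _ _ = contradiction eq (^-distinct< i<j j<13)
        ... | tri≈ _ i≡j _ = i≡j
        ... | tri> _ _ j<i = contradiction (sym eq) (^-distinct< j<i i<13)

        T : ℕ → Carrier
        T j = Tr (ζ ^ j)

        T-13 : ∀ k j → T (k ℕ.* 13 ℕ.+ j) ≈ T j
        T-13 k j = Tr-cong (trans (^-homo-* ζ (k ℕ.* 13) j) (trans (*-congʳ (^-multiple k ζ¹³≈1)) (*-identityˡ _)))

        -- The fourth power is the Frobenius map φ, which preserves the trace.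
        T-4 : ∀ j → T (j ℕ.* 4) ≈ T j
        T-4 j = trans (Tr-cong (trans (sym (^-assocʳ ζ j 4)) (sym (φ≈^4 _)))) (Tr-φ (ζ ^ j))

        -- Multiplication by 4 permutes cyclically the quadratic residues
        -- 1, 4, 3, 12, 9, 10 and the non-residues 2, 8, 6, 11, 5, 7 modulo 13.
        T₄ : T 4 ≈ T 1
        T₄ = T-4 1
        T₃ : T 3 ≈ T 1
        T₃ = trans (sym (T-13 1 3)) (trans (T-4 4) T₄)
        T₁₂ : T 12 ≈ T 1
        T₁₂ = trans (T-4 3) T₃
        T₉ : T 9 ≈ T 1
        T₉ = trans (sym (T-13 3 9)) (trans (T-4 12) T₁₂)
        T₁₀ : T 10 ≈ T 1
        T₁₀ = trans (sym (T-13 2 10)) (trans (T-4 9) T₉)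
        T₈ : T 8 ≈ T 2
        T₈ = T-4 2
        T₆ : T 6 ≈ T 2
        T₆ = trans (sym (T-13 2 6)) (trans (T-4 8) T₈)
        T₁₁ : T 11 ≈ T 2
        T₁₁ = trans (sym (T-13 1 11)) (trans (T-4 6) T₆)
        T₅ : T 5 ≈ T 2
        T₅ = trans (sym (T-13 3 5)) (trans (T-4 11) T₁₁)
        T₇ : T 7 ≈ T 2
        T₇ = trans (sym (T-13 1 7)) (trans (T-4 5) T₅)

        -- The values of u ↦ T 2 + Tr ((1 + ζ + ζ⁻¹) u) at the powers of ζ form a
        -- word of weight 5 in the quadratic residue code of length 13 over 𝔽₄; these
        -- are the exponents of its eight zeros.
        exponents : Vector ℕ 8
        exponents = 2 ∷ 3 ∷ 4 ∷ 6 ∷ 7 ∷ 9 ∷ 10 ∷ 11 ∷ []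

        exponents<13 : ∀ i → exponents i < 13
        exponents<13 i = Dec.toWitness {a? = Finₚ.all? (λ i → exponents i ℕₚ.<? 13)} tt i

        exponents-injective : ∀ i j → exponents i ≡ exponents j → i ≡ j
        exponents-injective = Dec.toWitness
          {a? = Finₚ.all? λ i → Finₚ.all? λ j → exponents i ℕₚ.≟ exponents j Dec.→-dec i Finₚ.≟ j} tt

        -- The exponent 12 + j stands for j - 1. At the chosen j either none or exactly two of j -
        -- 1, j, j + 1 are quadratic residues modulo 13, so the four traces cancel in pairs in
        -- characteristic 2.
        exponents-sum : ∀ i → T 2 + (T (exponents i) + T (1 ℕ.+ exponents i) + T (12 ℕ.+ exponents i)) ≈ 0#
        exponents-sum i = go i
          where
          NN : ∀ x → x + (x + x + x) ≈ 0#
          NN x = trans (solve 1 (λ x → x :+ (x :+ x :+ x) := (x :+ x) :+ (x :+ x)) x) (2x≈0 _)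
          QQ : ∀ x y → x + (y + y + x) ≈ 0#
          QQ x y = trans (solve 2 (λ x y → x :+ (y :+ y :+ x) := (x :+ y) :+ (x :+ y)) x y) (2x≈0 _)
          QN : ∀ x y → x + (y + x + y) ≈ 0#
          QN x y = trans (solve 2 (λ x y → x :+ (y :+ x :+ y) := (x :+ y) :+ (x :+ y)) x y) (2x≈0 _)
          NQ : ∀ x y → x + (x + y + y) ≈ 0#
          NQ x y = trans (solve 2 (λ x y → x :+ (x :+ y :+ y) := (x :+ y) :+ (x :+ y)) x y) (2x≈0 _)
          sum : ∀ {a b c a′ b′ c′} → a ≈ a′ → b ≈ b′ → c ≈ c′ → T 2 + (a′ + b′ + c′) ≈ 0# → T 2 + (a + b + c) ≈ 0#
          sum p q r eq = trans (+-congˡ (+-cong (+-cong p q) r)) eq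
          previous : ∀ j {t} → T j ≈ t → T (13 ℕ.+ j) ≈ t
          previous j eq = trans (T-13 1 j) eq
          go : ∀ i → T 2 + (T (exponents i) + T (1 ℕ.+ exponents i) + T (12 ℕ.+ exponents i)) ≈ 0#
          go 0F = sum refl T₃ (previous 1 refl) (NQ (T 2) (T 1))
          go 1F = sum T₃ T₄ (previous 2 refl) (QQ (T 2) (T 1))
          go 2F = sum T₄ T₅ (previous 3 T₃) (QN (T 2) (T 1))
          go 3F = sum T₆ T₇ (previous 5 T₅) (NN (T 2))
          go 4F = sum T₇ T₈ (previous 6 T₆) (NN (T 2))
          go 5F = sum T₉ T₁₀ (previous 8 T₈) (QQ (T 2) (T 1))
          go 6F = sum T₁₀ T₁₁ (previous 9 T₉) (QN (T 2) (T 1))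
          go 7F = sum T₁₁ T₁₂ (previous 10 T₁₀) (NQ (T 2) (T 1))

        β : Carrier
        β = 1# + ζ + ζ ^ 12

        -- Because ζβ = 1 + ζ + ζ² = (ζ³ - 1) / (ζ - 1).
        β≉0 : β ≉ 0#
        β≉0 β≈0 = ζᵈ≉1 {3} (s≤s z≤n) (s≤s (s≤s (s≤s (s≤s z≤n)))) (x-y≈0⇒x≈y (begin
          ζ ^ 3 - 1#
            ≈⟨ solve 1 (λ z → z :* (z :* (z :* con (+ 1))) :- con (+ 1) := (z :- con (+ 1)) :* (z :* (con (+ 1) :+ z) :+ con (+ 1))) ζ ⟩
          (ζ - 1#) * (ζ * (1# + ζ) + 1#)      ≈⟨ *-congˡ (+-congˡ ζ¹³≈1) ⟨
          (ζ - 1#) * (ζ * (1# + ζ) + ζ ^ 13)  ≈⟨ *-congˡ (distribˡ ζ (1# + ζ) (ζ ^ 12)) ⟨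
          (ζ - 1#) * (ζ * β)                  ≈⟨ *-congˡ (trans (*-congˡ β≈0) (zeroʳ ζ)) ⟩
          (ζ - 1#) * 0#                       ≈⟨ zeroʳ _ ⟩
          0#                                  ∎))

      module _ (ν : Carrier) (ν≉0 : ν ≉ 0#) (φ₂ν≈ν : φ₂ ν ≈ ν) where
        open Surface ν ν≉0 φ₂ν≈ν

        -- The quotients u of the thirteen elements by the first satisfy u u^16 = u^4, that is u^13
        -- = 1. Being distinct, they are all the thirteenth roots of unity, whatever the section is,
        -- and any one of them other than 1 can serve as ζ.
        eight-zeros : (w : Vector Carrier 13) → Distinct w → (∀ i → OnSurface (w i)) →
                      ∃₂ λ α β → φ α ≈ α × β ≉ 0# × ∃ λ (e : Vector (Fin 13) 8) →
                        Injectiveᵥ e × (∀ i → functional α β (w (e i)) ≈ 0#)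
        eight-zeros w distinct w∈ = T 2 , β * w₀ ⁻¹ , φ-Tr _ , *-nonzero β≉0 w₀⁻¹≉0 , (λ i → proj₁ (position i)) , e-injective , zero-at
          where
          w₀ = w zero
          w₀≉0 = proj₁ (w∈ zero)
          w₀⁻¹≉0 : w₀ ⁻¹ ≉ 0#
          w₀⁻¹≉0 eq = 1≉0 (trans (sym (⁻¹-inverseʳ w₀≉0)) (trans (*-congˡ eq) (zeroʳ _)))
          u : Fin 13 → Carrier
          u i = w i * w₀ ⁻¹
          w≈uw₀ : ∀ i → w i ≈ u i * w₀
          w≈uw₀ i = sym (trans (*-assoc _ _ _) (trans (*-congˡ (⁻¹-inverseˡ w₀≉0)) (*-identityʳ _)))
          u≉0 : ∀ i → u i ≉ 0#
          u≉0 i = *-nonzero (proj₁ (w∈ i)) w₀⁻¹≉0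
          u-distinct : Distinct u
          u-distinct i j eq = distinct i j (trans (w≈uw₀ i) (trans (*-congʳ eq) (sym (w≈uw₀ j))))
          u-equation : ∀ i → u i * φ₂ (u i) ≈ φ (u i)
          u-equation i = *-cancelˡ (*-nonzero ν≉0 (φ-nonzero w₀≉0)) (begin
            ν * φ w₀ * (x * φ₂ x)             ≈⟨ *-congʳ (proj₂ (w∈ zero)) ⟨
            w₀ * φ₂ w₀ * (x * φ₂ x)           ≈⟨ solve 4 (λ a b c d → a :* b :* (c :* d) := c :* a :* (d :* b)) w₀ (φ₂ w₀) x (φ₂ x) ⟩
            x * w₀ * (φ₂ x * φ₂ w₀)           ≈⟨ *-cong (sym (w≈uw₀ i)) (trans (sym (φ₂-* x w₀)) (φ₂-cong (sym (w≈uw₀ i)))) ⟩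
            w i * φ₂ (w i)                    ≈⟨ proj₂ (w∈ i) ⟩
            ν * φ (w i)                       ≈⟨ *-congˡ (trans (φ-cong (w≈uw₀ i)) (φ-* x w₀)) ⟩
            ν * (φ x * φ w₀)                  ≈⟨ solve 3 (λ a b c → a :* (b :* c) := a :* c :* b) ν (φ x) (φ w₀) ⟩
            ν * φ w₀ * φ x                    ∎)
            where x = u i
          u¹³≈1 : ∀ i → u i ^ 13 ≈ 1#
          u¹³≈1 i = *-cancelˡ (^-nonzero 4 (u≉0 i)) (begin
            x ^ 4 * x ^ 13           ≈⟨ ^-homo-* x 4 13 ⟨
            x * x ^ 16               ≈⟨ *-congˡ (^-assocʳ x 4 4) ⟨
            x * (x ^ 4) ^ 4          ≈⟨ *-congˡ (trans (φ-cong (φ≈^4 x)) (φ≈^4 _)) ⟨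
            x * φ₂ x                 ≈⟨ u-equation i ⟩
            φ x                      ≈⟨ φ≈^4 x ⟩
            x ^ 4                    ≈⟨ *-identityʳ _ ⟨
            x ^ 4 * 1#               ∎)
            where x = u i
          ζ = u (suc zero)
          ζ≉1 : ζ ≉ 1#
          ζ≉1 eq = Finₚ.0≢1+n (≡.sym (u-distinct (suc zero) zero (trans eq (sym (⁻¹-inverseʳ w₀≉0)))))
          open ThirteenthRoot {ζ} (u¹³≈1 (suc zero)) ζ≉1
          find : ∀ j → ∃ λ i → u i ≈ ζ ^ j
          find j with Finₚ.any? (λ i → u i ≟ ζ ^ j)
          ... | yes found = found
          ... | no  none  = contradiction (trans (sym (+-identityʳ 1#)) (poly-roots 13 X¹³-1 roots roots-distinct
                  (λ { zero → x≈y⇒x-y≈0 ζʲ¹³≈1 ; (suc i) → x≈y⇒x-y≈0 (u¹³≈1 i) }))) 1≉0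
            where
            ζʲ¹³≈1 : (ζ ^ j) ^ 13 ≈ 1#
            ζʲ¹³≈1 = trans (^-assocʳ ζ j 13) (^-multiple j (u¹³≈1 (suc zero)))
            X¹³-1 : IsPoly 13 (1# + 0#) (λ x → x ^ 13 - 1#)
            X¹³-1 = poly-+ 13 (poly-^ 13) (poly-raise 0 {13} (poly-const (- 1#)) (s≤s z≤n))
            roots : Vector Carrier 14
            roots zero    = ζ ^ j
            roots (suc i) = u i
            roots-distinct : Distinct roots
            roots-distinct zero    zero    _  = ≡.refl
            roots-distinct zero    (suc i) eq = contradiction (i , sym eq) none
            roots-distinct (suc i) zero    eq = contradiction (i , eq) none
            roots-distinct (suc i) (suc k) eq = ≡.cong suc (u-distinct i k eq)
          position : ∀ i → ∃ λ k → u k ≈ ζ ^ exponents i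
          position i = find (exponents i)
          e-injective : ∀ i j → proj₁ (position i) ≡ proj₁ (position j) → i ≡ j
          e-injective i j eq = exponents-injective i j (^-distinct (exponents<13 i) (exponents<13 j)
            (trans (sym (proj₂ (position i))) (trans (reflexive (≡.cong u eq)) (proj₂ (position j)))))
          zero-at : ∀ i → functional (T 2) (β * w₀ ⁻¹) (w (proj₁ (position i))) ≈ 0#
          zero-at i = begin
            T 2 + Tr (β * w₀ ⁻¹ * w k)
              ≈⟨ +-congˡ (Tr-cong (begin
                   β * w₀ ⁻¹ * w k          ≈⟨ solve 3 (λ a b c → a :* b :* c := a :* (c :* b)) β (w₀ ⁻¹) (w k) ⟩
                   β * u k                  ≈⟨ *-congˡ (proj₂ (position i)) ⟩
                   β * ζ ^ j                ≈⟨ solve 3 (λ z y x → (con (+ 1) :+ z :+ y) :* x := x :+ z :* x :+ y :* x) ζ (ζ ^ 12) (ζ ^ j) ⟩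
                   ζ ^ j + ζ ^ (1 ℕ.+ j) + ζ ^ 12 * ζ ^ j    ≈⟨ +-congˡ (^-homo-* ζ 12 j) ⟨
                   ζ ^ j + ζ ^ (1 ℕ.+ j) + ζ ^ (12 ℕ.+ j)    ∎)) ⟩
            T 2 + Tr (ζ ^ j + ζ ^ (1 ℕ.+ j) + ζ ^ (12 ℕ.+ j))
              ≈⟨ +-congˡ (trans (Tr-+ _ _) (+-congʳ (Tr-+ _ _))) ⟩
            T 2 + (T j + T (1 ℕ.+ j) + T (12 ℕ.+ j))  ≈⟨ exponents-sum i ⟩
            0# ∎
            where
            k = proj₁ (position i)
            j = exponents i

    -- From the surface to the hyperplane section

    module Section (4≤q : 4 ≤ q) (V : LeftModule (CommutativeRing.ring K) ℓm ℓm′) where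

      open LeftModule V
      open Projective V
      open KLinear V
      open LinearAlgebra K K-finite using (NonzeroVec; dot; annihilated-or-spanning; pencil-member)
      open LinearAlgebra.Module K K-finite V
      private
        module KL = LinearAlgebra K K-finite

      -- The pair (f, g) plays the role of coordinates of H in 𝔽_q ⊕ 𝔽_{q⁶}. The ratio g / f embeds
      -- X into the surface, and the theorem for X follows from these properties alone.
      module _ (ν : Carrier) (ν≉0 : ν ≉ 0#) (φ₂ν≈ν : φ₂ ν ≈ ν)
        (H : Subspace 6) (X : Pred Point ℓx) (X⊆H : X ⊆ ⟦ H ⟧)
        (f g : Carrierᴹ → Carrier) (f-linear : IsLinear f) (g-linear : IsLinear g)
        (f-fixed : ∀ {v} → Span (basis H) v → φ (f v) ≈ f v)
        (f-nonzero : ∀ x → X x → f (vec x) ≉ 0#)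
        (surface : ∀ x → X x → Surface.OnSurface ν ν≉0 φ₂ν≈ν (g (vec x) * f (vec x) ⁻¹))
        (separated : ∀ x y → X x → X y → g (vec x) * f (vec x) ⁻¹ ≈ g (vec y) * f (vec y) ⁻¹ → x ≈ₚ y)
        (points : HasAtLeast (q ℕ.^ 2 ℕ.∸ q ℕ.+ 1) X)
        where

        open Surface ν ν≉0 φ₂ν≈ν

        w : Point → Carrier
        w x = g (vec x) * f (vec x) ⁻¹

        form : K.Carrier → Carrier → Carrierᴹ → Carrier
        form α β v = ι α * f v + Tr (β * g v)

        private
          module f = IsLinear f-linear
          module g = IsLinear g-linear

        form-linear : ∀ α β → IsLinear (form α β)
        form-linear α β = record
          { resp = λ u≈v → +-cong (*-congˡ (f.resp u≈v)) (Tr-cong (*-congˡ (g.resp u≈v)))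
          ; +-homo = λ u v → trans (+-cong (*-congˡ (f.+-homo u v)) (trans (Tr-cong (trans (*-congˡ (g.+-homo u v)) (distribˡ β _ _))) (Tr-+ _ _)))
              (solve 5 (λ a x y s t → a :* (x :+ y) :+ (s :+ t) := a :* x :+ s :+ (a :* y :+ t)) (ι α) (f u) (f v) (Tr (β * g u)) (Tr (β * g v)))
          ; *-homo = λ k v → trans (+-cong (*-congˡ (f.*-homo k v))
              (trans (Tr-cong (trans (*-congˡ (g.*-homo k v)) (solve 3 (λ b k g → b :* (k :* g) := k :* (b :* g)) β (ι k) (g v)))) (Tr-scale _ (φ-ι k))))
              (solve 4 (λ a k x t → a :* (k :* x) :+ k :* t := k :* (a :* x :+ t)) (ι α) (ι k) (f v) (Tr (β * g v)))
          }

        zeroLocus : ∀ α β → IsLinearSubspace (λ v → form α β v ≈ 0#)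
        zeroLocus α β = record
          { resp = λ u≈v eq → trans (sym (resp u≈v)) eq
          ; zero∈ = 0-homo
          ; +-closed = λ {u} {v} fu≈0 fv≈0 → trans (+-homo u v) (trans (+-cong fu≈0 fv≈0) (+-identityˡ _))
          ; *-closed = λ k {v} fv≈0 → trans (*-homo k v) (trans (*-congˡ fv≈0) (zeroʳ _)) }
          where open IsLinear (form-linear α β)

        form-fixed : ∀ α β {v} → Span (basis H) v → φ (form α β v) ≈ form α β v
        form-fixed α β v∈ = trans (φ-+ _ _) (+-cong (trans (φ-* _ _) (*-cong (φ-ι α) (f-fixed v∈))) (φ-Tr _))

        form-sub : ∀ α β α′ β′ v → form (α K.- α′) (β - β′) v ≈ form α β v - form α′ β′ v
        form-sub α β α′ β′ v = trans
          (+-cong (*-congʳ (ι-sub α α′)) (trans (Tr-cong (solve 3 (λ b b′ g → (b :- b′) :* g := b :* g :- b′ :* g) β β′ (g v))) (Tr-sub _ _)))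
          (solve 5 (λ a a′ x s t → (a :- a′) :* x :+ (s :- t) := a :* x :+ s :- (a′ :* x :+ t)) (ι α) (ι α′) (f v) (Tr (β * g v)) (Tr (β′ * g v)))

        form-point : ∀ α β x → X x → form α β (vec x) ≈ f (vec x) * functional (ι α) β (w x)
        form-point α β x x∈X = begin
          ι α * f (vec x) + Tr (β * g (vec x))
            ≈⟨ +-cong (*-comm _ _) (trans (Tr-cong (begin
                 β * g (vec x)                              ≈⟨ *-congˡ (*-identityʳ _) ⟨
                 β * (g (vec x) * 1#)                       ≈⟨ *-congˡ (*-congˡ (⁻¹-inverseˡ (f-nonzero x x∈X))) ⟨
                 β * (g (vec x) * (f (vec x) ⁻¹ * f (vec x)))
                   ≈⟨ solve 4 (λ b g i f → b :* (g :* (i :* f)) := f :* (b :* (g :* i))) β (g (vec x)) (f (vec x) ⁻¹) (f (vec x)) ⟩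
                 f (vec x) * (β * w x)                      ∎)) (Tr-scale _ (f-fixed (X⊆H x∈X)))) ⟩
          f (vec x) * ι α + f (vec x) * Tr (β * w x)        ≈⟨ distribˡ _ _ _ ⟨
          f (vec x) * functional (ι α) β (w x)              ∎

        functional-zero : ∀ α β x → X x → form α β (vec x) ≈ 0# → functional (ι α) β (w x) ≈ 0#
        functional-zero α β x x∈X eq = *-zeroʳ⁻ (f-nonzero x x∈X) (trans (sym (form-point α β x x∈X)) eq)

        Trivial : K.Carrier → Carrier → Set _
        Trivial α β = ι α ≈ 0# × β ≈ 0#

        -- The pairs (α, β) form a space of dimension 7 over K, so six linear conditions with values
        -- in K leave a nonzero solution: q⁷ pairs against q⁶ lists of values.
        common-zero : (τ : Fin 6 → K.Carrier → Carrier → Carrier) → (∀ i α β → φ (τ i α β) ≈ τ i α β) →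
                      (∀ i α β α′ β′ → τ i (α K.- α′) (β - β′) ≈ τ i α β - τ i α′ β′) →
                      ∃₂ λ α β → ¬ Trivial α β × (∀ i → τ i α β ≈ 0#)
        common-zero τ τ-fixed τ-sub = go (collision {A = K.setoid ×ₛ setoid}
            (IsFiniteField.order K-finite ×-finite IsFiniteField.order F-finite)
            (finite-vector 6 (IsFiniteField.order K-finite)) q⁶<qn (λ (α , β) i → proj₁ (value i α β)))
          where
          value : ∀ i α β → ∃ λ k → ι k ≈ τ i α β
          value i α β = fixed (τ i α β) (τ-fixed i α β)
          q⁶<qn : q ℕ.^ 6 < q ℕ.* n
          q⁶<qn = ≡.subst (λ n → q ℕ.^ 6 < q ℕ.* n) (≡.sym n≡q⁶) (ℕₚ.^-monoʳ-< q 1<q {6} {7} ℕₚ.≤-refl)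
          go : (∃₂ λ x y → ¬ (proj₁ x K.≈ proj₁ y × proj₂ x ≈ proj₂ y) × (∀ i → proj₁ (value i (proj₁ x) (proj₂ x)) K.≈ proj₁ (value i (proj₁ y) (proj₂ y)))) →
               ∃₂ λ α β → ¬ Trivial α β × (∀ i → τ i α β ≈ 0#)
          go ((α , β) , (α′ , β′) , differ , agree) = α K.- α′ , β - β′ ,
            (λ (p , r) → differ (K.x-y≈0⇒x≈y (ι-zero⁻ p) , x-y≈0⇒x≈y r)) ,
            λ i → trans (τ-sub i α β α′ β′) (x≈y⇒x-y≈0 (trans (sym (proj₂ (value i α β))) (trans (ι-cong (agree i)) (proj₂ (value i α′ β′)))))

        w-distinct : ∀ {k} (x : Vector Point k) → DistinctPointsOf X x → Distinct (w ∘ x)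
        w-distinct x (x∈X , x-inj) i j eq = x-inj i j (separated (x i) (x j) (x∈X i) (x∈X j) eq)

        restrict : ∀ {k l} (Y : Pred Point ℓp) (x : Vector Point l) → DistinctPointsOf Y x → (k≤l : k ≤ l) →
                   DistinctPointsOf Y (λ i → x (Fin.inject≤ {k} i k≤l))
        restrict Y x (x∈ , x-inj) k≤l = (λ i → x∈ _) , λ i j eq → Finₚ.inject≤-injective k≤l k≤l i j (x-inj _ _ eq)

        many-zeros : ∀ α β → (∀ i → form α β (vec (proj₁ points i)) ≈ 0#) → Trivial α β
        many-zeros α β zero-at = zeros-bound (ι α) β (λ i → w (x i)) (w-distinct x x-distinct)
            (λ i → surface (x i) (proj₁ x-distinct i)) (λ i → functional-zero α β (x i) (proj₁ x-distinct i) (zero-at _))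
          where
          x : Vector Point (suc (suc (2 ℕ.* q)))
          x i = proj₁ points (Fin.inject≤ i (2q+2≤q²-q+1 4≤q))
          x-distinct = restrict X (proj₁ points) (proj₂ points) (2q+2≤q²-q+1 4≤q)

        β≈0⇒Trivial : ∀ α β x → X x → form α β (vec x) ≈ 0# → β ≈ 0# → Trivial α β
        β≈0⇒Trivial α β x x∈X eq β≈0 = trans (sym (trans (+-congˡ (trans (Tr-cong (trans (*-congʳ β≈0) (zeroˡ _))) Tr-0)) (+-identityʳ _)))
                                              (functional-zero α β x x∈X eq) , β≈0

        -- Vanishing on S amounts to five conditions, so a first form exists and one more condition
        -- may be imposed on a second. That condition is Tr(β′β⁻¹θ) = 0 with Tr(θ) ≠ 0. By `bezout`
        -- seven common zeros put κ = β′/β into 𝔽_q, and then the trace is κ Tr(θ), so κ = 0 and the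
        -- second form is trivial.
        no-seven : (S : Subspace 4) → ⟦ S ⟧ ⊆ ⟦ H ⟧ → (x : Vector Point 7) → ¬ DistinctPointsOf (⟦ S ⟧ ∩ X) x
        no-seven S S⊆H x (x∈ , x-inj) = conclude (common-zero τ₁ (λ i α β → form-fixed α β (s∈H (suc-pred i))) (λ i α β α′ β′ → form-sub α β α′ β′ (s (suc-pred i))))
          where
          s = basis S
          s∈H : ∀ i → Span (basis H) (s i)
          s∈H i = S⊆H {record { vec = s i ; nonzero = independent⇒nonzero {v = s} (independent S) i }} (basis∈Span s i)
          suc-pred : Fin 6 → Fin 5
          -- A basis of S gives five conditions; the first one is repeated to make the six of
          -- `common-zero`.
          suc-pred zero    = zero
          suc-pred (suc i) = i
          τ₁ : Fin 6 → K.Carrier → Carrier → Carrier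
          τ₁ i α β = form α β (s (suc-pred i))
          at-points : ∀ α β → (∀ i → form α β (s i) ≈ 0#) → ∀ i → form α β (vec (x i)) ≈ 0#
          at-points α β eq i = Span⊆ (zeroLocus α β) {v = s} eq {vec (x i)} (proj₁ (x∈ i))
          distinct : Distinct (w ∘ x)
          distinct = w-distinct x ((λ i → proj₂ (x∈ i)) , x-inj)
          conclude : (∃₂ λ α β → ¬ Trivial α β × (∀ i → τ₁ i α β ≈ 0#)) → _
          conclude (α , β , nontrivial , killed) = conclude′ (common-zero τ₂ τ₂-fixed τ₂-sub)
            where
            zeros : ∀ i → form α β (vec (x i)) ≈ 0#
            zeros = at-points α β (λ i → killed (suc i))
            β≉0 : β ≉ 0#
            β≉0 β≈0 = nontrivial (β≈0⇒Trivial α β (x zero) (proj₂ (x∈ zero)) (zeros zero) β≈0)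
            θ = proj₁ Tr-nontrivial
            τ₂ : Fin 6 → K.Carrier → Carrier → Carrier
            τ₂ zero    α′ β′ = Tr (β′ * β ⁻¹ * θ)
            τ₂ (suc i) α′ β′ = form α′ β′ (s i)
            τ₂-fixed : ∀ i α β → φ (τ₂ i α β) ≈ τ₂ i α β
            τ₂-fixed zero    α′ β′ = φ-Tr _
            τ₂-fixed (suc i) α′ β′ = form-fixed α′ β′ (s∈H i)
            τ₂-sub : ∀ i α β α′ β′ → τ₂ i (α K.- α′) (β - β′) ≈ τ₂ i α β - τ₂ i α′ β′
            τ₂-sub zero    _ β₁ _ β₂ = trans (Tr-cong (solve 4 (λ x y i t → (x :- y) :* i :* t := x :* i :* t :- y :* i :* t) β₁ β₂ (β ⁻¹) θ)) (Tr-sub _ _)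
            τ₂-sub (suc i) α₁ β₁ α₂ β₂ = form-sub α₁ β₁ α₂ β₂ (s i)
            conclude′ : (∃₂ λ α β → ¬ Trivial α β × (∀ i → τ₂ i α β ≈ 0#)) → _
            conclude′ (α′ , β′ , nontrivial′ , killed′) = nontrivial′ (β≈0⇒Trivial α′ β′ (x zero) (proj₂ (x∈ zero)) (zeros′ zero) β′≈0)
              where
              zeros′ : ∀ i → form α′ β′ (vec (x i)) ≈ 0#
              zeros′ = at-points α′ β′ (λ i → killed′ (suc i))
              proportional : φ β * β′ ≈ φ β′ * β
              proportional = bezout (ι α) β (ι α′) β′ (w ∘ x) distinct (λ i → surface (x i) (proj₂ (x∈ i)))
                (λ i → functional-zero α β (x i) (proj₂ (x∈ i)) (zeros i)) (λ i → functional-zero α′ β′ (x i) (proj₂ (x∈ i)) (zeros′ i))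
              κ = β′ * β ⁻¹
              κβ≈β′ : κ * β ≈ β′
              κβ≈β′ = trans (*-assoc _ _ _) (trans (*-congˡ (⁻¹-inverseˡ β≉0)) (*-identityʳ _))
              φκ≈κ : φ κ ≈ κ
              φκ≈κ = *-cancelˡ (*-nonzero (φ-nonzero β≉0) β≉0) (begin
                φ β * β * φ κ     ≈⟨ solve 3 (λ a b c → a :* b :* c := c :* a :* b) (φ β) β (φ κ) ⟩
                φ κ * φ β * β     ≈⟨ *-congʳ (trans (sym (φ-* κ β)) (φ-cong κβ≈β′)) ⟩
                φ β′ * β          ≈⟨ proportional ⟨
                φ β * β′          ≈⟨ *-congˡ κβ≈β′ ⟨
                φ β * (κ * β)     ≈⟨ solve 3 (λ a b c → a :* (c :* b) := a :* b :* c) (φ β) β κ ⟩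
                φ β * β * κ       ∎)
              κ≈0 : κ ≈ 0#
              κ≈0 = *-zeroʳ⁻ (proj₂ Tr-nontrivial) (trans (*-comm _ _) (trans (sym (Tr-scale θ φκ≈κ)) (killed′ zero)))
              β′≈0 : β′ ≈ 0#
              β′≈0 = trans (sym κβ≈β′) (trans (*-congʳ κ≈0) (zeroˡ β))

        at-most-six : (S : Subspace 4) → ⟦ S ⟧ ⊆ ⟦ H ⟧ → HasAtMost 6 (⟦ S ⟧ ∩ X)
        at-most-six S S⊆H {k} x x-distinct = ℕₚ.≮⇒≥ (λ 6<k →
          no-seven S (λ {y} → S⊆H {y}) (λ i → x (Fin.inject≤ i 6<k)) (restrict (⟦ S ⟧ ∩ X) x x-distinct 6<k))

        coordinates : ∀ x → X x → Vector K.Carrier 7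
        coordinates x x∈X = proj₁ (X⊆H x∈X)

        module Hyperplane (d : Vector K.Carrier 7) (d≉0 : NonzeroVec d) where
          j₀ = proj₁ d≉0
          unit : Vector K.Carrier 7
          unit j = d j₀ K.⁻¹ K.* d j
          open Kernel (basis H) unit j₀ (K.⁻¹-inverseˡ (proj₂ d≉0)) public

          point∈Span : ∀ x (x∈X : X x) → dot d (coordinates x x∈X) K.≈ K.0# → Span kernelBasis (vec x)
          point∈Span x x∈X eq = Span-cong {v = kernelBasis} (proj₂ (X⊆H x∈X)) (kernel∈Span (coordinates x x∈X)
            (K.trans (KL.dot-scaleˡ d (coordinates x x∈X) (d j₀ K.⁻¹)) (K.trans (K.*-congˡ eq) (K.zeroʳ _))))

          subspace : Subspace 5
          subspace = record { basis = kernelBasis ; independent = kernelBasis-independent (independent H) }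

          subspace⊆H : ⟦ subspace ⟧ ⊆ ⟦ H ⟧
          subspace⊆H {y} = Span-trans {v = kernelBasis} {w = basis H} kernelBasis∈Span {vec y}

        attained-by : (d : Vector K.Carrier 7) → NonzeroVec d → (x : Vector Point 8) (x-distinct : DistinctPointsOf X x) →
                      (∀ i → dot d (coordinates (x i) (proj₁ x-distinct i)) K.≈ K.0#) →
                      ∃ λ (S : Subspace 5) → ⟦ S ⟧ ⊆ ⟦ H ⟧ × HasAtLeast 8 (⟦ S ⟧ ∩ X)
        attained-by d d≉0 x (x∈X , x-inj) eq = subspace , (λ {y} → subspace⊆H {y}) , x , (λ i → point∈Span (x i) (x∈X i) (eq i) , x∈X i) , x-inj
          where open Hyperplane d d≉0

        -- If the points do not span, their coordinates lie in the kernel of some d. A nonzero form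
        -- vanishing on the six basis vectors of this kernel would vanish at all the points, more
        -- than the 2q + 1 zeros it can have.
        spanning : ⟦ H ⟧ ⊆ SpannedByPointsOf X
        spanning {y} (k , kh≈y) with annihilated-or-spanning 7 (λ i → coordinates (x i) (x∈X i))
          where
          x = proj₁ points
          x∈X = proj₁ (proj₂ points)
        ... | inj₂ spans = q ℕ.^ 2 ℕ.∸ q ℕ.+ 1 , proj₁ points , proj₁ (proj₂ points) , proj₁ (spans k) ,
          ≈ᴹ-trans (combination-cong {k = proj₁ (spans k)} (λ _ → K.refl) (λ i → ≈ᴹ-sym (proj₂ (X⊆H (proj₁ (proj₂ points) i)))))
          (≈ᴹ-trans (combination-combination (proj₁ (spans k)) (λ i → coordinates (proj₁ points i) (proj₁ (proj₂ points) i)) (basis H))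
          (≈ᴹ-trans (combination-cong {v = basis H} {w = basis H} (proj₂ (spans k)) (λ _ → ≈ᴹ-refl)) kh≈y))
        ... | inj₁ (d , d≉0 , killed) = contradiction (many-zeros α β zero-at) nontrivial
          where
          open Hyperplane d d≉0
          pencil = common-zero (λ i α β → form α β (kernelBasis i)) (λ i α β → form-fixed α β (kernelBasis∈Span i))
                     (λ i α β α′ β′ → form-sub α β α′ β′ (kernelBasis i))
          α = proj₁ pencil
          β = proj₁ (proj₂ pencil)
          nontrivial = proj₁ (proj₂ (proj₂ pencil))
          zero-at : ∀ i → form α β (vec (proj₁ points i)) ≈ 0#
          zero-at i = Span⊆ (zeroLocus α β) {v = kernelBasis} (proj₂ (proj₂ (proj₂ pencil))) (point∈Span (proj₁ points i) (proj₁ (proj₂ points) i) (killed i))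

        attained-≥5 : 5 ≤ q → ∃ λ (S : Subspace 5) → ⟦ S ⟧ ⊆ ⟦ H ⟧ × HasAtLeast 8 (⟦ S ⟧ ∩ X)
        attained-≥5 5≤q = go (pencil-member {5} {suc (suc q ℕ.* 2)} {2} ℕₚ.≤-refl ℕₚ.≤-refl (λ i → coordinates (x i) (x∈X i)))
          where
          x : Vector Point (5 ℕ.+ suc (suc q ℕ.* 2))
          x i = proj₁ points (Fin.inject≤ i (2q+8≤q²-q+1 5≤q))
          x-distinct : DistinctPointsOf X x
          x-distinct = restrict X (proj₁ points) (proj₂ points) (2q+8≤q²-q+1 5≤q)
          x∈X = proj₁ x-distinct
          go : (∃ λ d → NonzeroVec d × ∃ λ (e : Vector _ 8) → Injectiveᵥ e × (∀ i → dot d (coordinates (x (e i)) (x∈X (e i))) K.≈ K.0#)) →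
               ∃ λ (S : Subspace 5) → ⟦ S ⟧ ⊆ ⟦ H ⟧ × HasAtLeast 8 (⟦ S ⟧ ∩ X)
          go (d , d≉0 , e , e-inj , killed) = attained-by d d≉0 (x ∘ e)
            ((λ i → x∈X (e i)) , λ i j eq → e-inj i j (proj₂ x-distinct (e i) (e j) eq)) killed

        module Coefficients (α : K.Carrier) (β : Carrier) (nontrivial : ¬ Trivial α β)
                            (d : Vector K.Carrier 7) (d-value : ∀ j → ι (d j) ≈ form α β (basis H j)) where
          d-form : ∀ y (y∈X : X y) → ι (dot d (coordinates y y∈X)) ≈ form α β (vec y)
          d-form y y∈X = trans (IsLinear.combination-homo (form-linear α β) {d = d} {h = basis H} d-value (coordinates y y∈X))
                               (IsLinear.resp (form-linear α β) (proj₂ (X⊆H y∈X)))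

          -- If d were zero, the form would vanish on all of X, against `many-zeros`.
          d-nonzero : NonzeroVec d
          d-nonzero = go (Finₚ.any? (λ j → Dec.¬? (d j K.≟ K.0#)))
            where
            go : Dec (NonzeroVec d) → NonzeroVec d
            go (yes found) = found
            go (no  none)  = contradiction (many-zeros α β (λ i → form≈0 (proj₁ points i) (proj₁ (proj₂ points) i))) nontrivial
              where
              d≈0 : ∀ j → d j K.≈ K.0#
              d≈0 j = Dec.decidable-stable (d j K.≟ K.0#) (λ dj≉0 → none (j , dj≉0))
              form≈0 : ∀ y → X y → form α β (vec y) ≈ 0#
              form≈0 y y∈X = trans (sym (d-form y y∈X)) (trans (ι-cong
                (KL.sum-zero {v = λ j → d j K.* coordinates y y∈X j} (λ j → K.trans (K.*-congʳ (d≈0 j)) (K.zeroˡ _)))) ι-0)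

          attained-by-form : (x : Vector Point 8) → DistinctPointsOf X x → (∀ i → form α β (vec (x i)) ≈ 0#) →
                             ∃ λ (S : Subspace 5) → ⟦ S ⟧ ⊆ ⟦ H ⟧ × HasAtLeast 8 (⟦ S ⟧ ∩ X)
          attained-by-form x x-distinct zeros = attained-by d d-nonzero x x-distinct
            (λ i → ι-zero⁻ (trans (d-form (x i) (proj₁ x-distinct i)) (zeros i)))

        attained-by-functional : ∀ {α β} → φ α ≈ α → β ≉ 0# → (x : Vector Point 8) → DistinctPointsOf X x →
                                 (∀ i → functional α β (w (x i)) ≈ 0#) →
                                 ∃ λ (S : Subspace 5) → ⟦ S ⟧ ⊆ ⟦ H ⟧ × HasAtLeast 8 (⟦ S ⟧ ∩ X)
        attained-by-functional {α} {β} φα≈α β≉0 x x-distinct zeros = go (fixed α φα≈α)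
          where
          go : (∃ λ α₀ → ι α₀ ≈ α) → ∃ λ (S : Subspace 5) → ⟦ S ⟧ ⊆ ⟦ H ⟧ × HasAtLeast 8 (⟦ S ⟧ ∩ X)
          go (α₀ , ια₀≈α) = attained-by-form x x-distinct (λ i → trans (form-point α₀ β (x i) (proj₁ x-distinct i))
              (trans (*-congˡ (trans (+-congʳ ια₀≈α) (zeros i))) (zeroʳ _)))
            where
            value : ∀ j → ∃ λ k → ι k ≈ form α₀ β (basis H j)
            value j = fixed (form α₀ β (basis H j)) (form-fixed α₀ β (basis∈Span (basis H) j))
            open Coefficients α₀ β (λ trivial → β≉0 (proj₂ trivial)) (λ j → proj₁ (value j)) (λ j → proj₂ (value j))

        attained-4 : q ≡ 4 → ∃ λ (S : Subspace 5) → ⟦ S ⟧ ⊆ ⟦ H ⟧ × HasAtLeast 8 (⟦ S ⟧ ∩ X)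
        attained-4 q≡4 = from-thirteen (λ i → proj₁ points (Fin.inject≤ i 13≤N)) (restrict X (proj₁ points) (proj₂ points) 13≤N)
          where
          13≤N : 13 ≤ q ℕ.^ 2 ℕ.∸ q ℕ.+ 1
          13≤N = ℕₚ.≤-reflexive (≡.sym (≡.cong (λ q → q ℕ.^ 2 ℕ.∸ q ℕ.+ 1) q≡4))
          from-thirteen : (x : Vector Point 13) → DistinctPointsOf X x → ∃ λ (S : Subspace 5) → ⟦ S ⟧ ⊆ ⟦ H ⟧ × HasAtLeast 8 (⟦ S ⟧ ∩ X)
          from-thirteen x (x∈X , x-inj) =
            let α , β , φα≈α , β≉0 , e , e-inj , zeros =
                  OrderFour.eight-zeros q≡4 ν ν≉0 φ₂ν≈ν (λ i → w (x i))
                    (w-distinct x (x∈X , x-inj)) (λ i → surface (x i) (x∈X i))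
            in attained-by-functional {α} {β} φα≈α β≉0 (λ i → x (e i)) ((λ i → x∈X (e i)) , λ i j eq → e-inj i j (x-inj (e i) (e j) eq)) zeros

        is⟨6,4⟩-set : Is⟨ 6 , 4 ⟩-SetOf H X
        is⟨6,4⟩-set = record
          { within   = λ {x} → X⊆H {x}
          ; atMost   = λ S S⊆H {k} → at-most-six S (λ {y} → S⊆H {y}) {k}
          ; spanning = λ {x} → spanning {x}
          ; attained = attained
          }
          where
          attained : ∃ λ (S : Subspace 5) → ⟦ S ⟧ ⊆ ⟦ H ⟧ × HasAtLeast 8 (⟦ S ⟧ ∩ X)
          attained with ℕₚ.m≤n⇒m<n∨m≡n 4≤q
          ... | inj₁ 5≤q = attained-≥5 5≤q
          ... | inj₂ 4≡q = attained-4 (≡.sym 4≡q)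

    -- Tensors with irreducible quadratic covariant

    module Diagonal (B : Vector Carrier 8) (B-cyclic : IsCyclic B) (ρ : Carrier)
      (det≈0 : det (contract₁ B 1# ρ) ≈ 0#)
      (leading≉0 : B 4F * B 7F - B 5F * B 6F ≉ 0#)
      (ρ≉φ₃ρ : ρ ≉ φ₃ ρ) where

      ρ₁ ρ₂ ρ₃ ρ₄ ρ₅ : Carrier
      ρ₁ = φ ρ
      ρ₂ = φ₂ ρ
      ρ₃ = φ₃ ρ
      ρ₄ = φ₄ ρ
      ρ₅ = φ₅ ρ

      private
        b : Carrier → Carrier → Carrier → Carrier
        b x y z = tri B 1# x 1# y 1# z

        φ-b : ∀ x y z → φ (b x y z) ≈ b (φ z) (φ x) (φ y)
        φ-b x y z = trans (φ-tri B-cyclic 1# x 1# y 1# z) (tri-cong {B} {B} (λ _ → refl) φ-1 refl φ-1 refl φ-1 refl)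

        b-cong : ∀ {x y z x′ y′ z′} → x ≈ x′ → y ≈ y′ → z ≈ z′ → b x y z ≈ b x′ y′ z′
        b-cong p q r = tri-cong {B} {B} (λ _ → refl) refl p refl q refl r

        -- The values of the trilinear form B on the vectors (1 , ρ) and (1 , φ₃ ρ)
        -- and their conjugates form two Frobenius orbits, p₀, …, p₅ and r, r′. As ρ
        -- is a root of det (contract₁ B 1# x), the first orbit vanishes.
        p₀ p₁ p₂ p₃ p₄ p₅ : Carrier
        p₀ = b ρ ρ₁ ρ₂
        p₁ = b ρ₃ ρ₁ ρ₂
        p₂ = b ρ₃ ρ₄ ρ₂
        p₃ = b ρ₃ ρ₄ ρ₅
        p₄ = b ρ ρ₄ ρ₅
        p₅ = b ρ ρ₁ ρ₅

      r r′ : Carrier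
      r = b ρ ρ₄ ρ₂
      r′ = b ρ₃ ρ₁ ρ₅

      private
        φp₀ : φ p₀ ≈ p₁
        φp₀ = φ-b ρ ρ₁ ρ₂
        φp₁ : φ p₁ ≈ p₂
        φp₁ = φ-b ρ₃ ρ₁ ρ₂
        φp₂ : φ p₂ ≈ p₃
        φp₂ = φ-b ρ₃ ρ₄ ρ₂
        φp₃ : φ p₃ ≈ p₄
        φp₃ = trans (φ-b ρ₃ ρ₄ ρ₅) (b-cong {y = ρ₄} {z = ρ₅} (φ₆-id ρ) refl refl)
        φp₄ : φ p₄ ≈ p₅
        φp₄ = trans (φ-b ρ ρ₄ ρ₅) (b-cong {y = ρ₁} {z = ρ₅} (φ₆-id ρ) refl refl)
        φp₅ : φ p₅ ≈ p₀
        φp₅ = trans (φ-b ρ ρ₁ ρ₅) (b-cong {y = ρ₁} {z = ρ₂} (φ₆-id ρ) refl refl)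
        φr : φ r ≈ r′
        φr = φ-b ρ ρ₄ ρ₂
        φr′ : φ r′ ≈ r
        φr′ = trans (φ-b ρ₃ ρ₁ ρ₅) (b-cong {y = ρ₄} {z = ρ₂} (φ₆-id ρ) refl refl)

        φ-product : ∀ {x y x′ y′} → φ x ≈ x′ → φ y ≈ y′ → φ (x * y) ≈ x′ * y′
        φ-product p q = trans (φ-* _ _) (*-cong p q)

        conjugate : ∀ {x y z w x′ y′ z′ w′} → φ x ≈ x′ → φ y ≈ y′ → φ z ≈ z′ → φ w ≈ w′ → x * y ≈ z * w → x′ * y′ ≈ z′ * w′
        conjugate p q s t eq = trans (sym (φ-product p q)) (trans (φ-cong eq) (φ-product s t))

        Δ : Carrier
        Δ = (1# * ρ₄ - ρ₁ * 1#) * (1# * ρ₅ - ρ₂ * 1#)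

        -- The vanishing determinant says that the contraction of B with (1, ρ) has rank at most
        -- one. The next three relations are Frobenius conjugates of this one.
        p₀p₄ : p₀ * p₄ ≈ p₅ * r
        p₀p₄ = x-y≈0⇒x≈y (trans (bilinear-det (contract₁ B 1# ρ) 1# ρ₁ 1# ρ₄ 1# ρ₂ 1# ρ₅) (trans (*-congˡ det≈0) (zeroʳ _)))

        p₁p₅ : p₁ * p₅ ≈ p₀ * r′
        p₁p₅ = conjugate φp₀ φp₄ φp₅ φr p₀p₄

        p₂p₀ : p₂ * p₀ ≈ p₁ * r
        p₂p₀ = conjugate φp₁ φp₅ φp₀ φr′ p₁p₅

        p₃p₁ : p₃ * p₁ ≈ p₂ * r′
        p₃p₁ = conjugate φp₂ φp₀ φp₁ φr p₂p₀

        Δ≉0 : Δ ≉ 0#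
        Δ≉0 = *-nonzero (difference ρ₄ ρ₁ (λ eq → ρ≉φ₃ρ (sym (φ-injective eq)))) (difference ρ₅ ρ₂ (λ eq → ρ≉φ₃ρ (sym (φ-injective (φ-injective eq)))))
          where
          difference : ∀ x y → x ≉ y → 1# * x - y * 1# ≉ 0#
          difference x y x≉y eq = x≉y (trans (sym (*-identityˡ x)) (trans (x-y≈0⇒x≈y eq) (*-identityʳ y)))

        -- The third conjugate p₃p₁ = p₂r′ is the vanishing of the 2×2 determinant of values of the
        -- contraction with (1, ρ₃).
        det₃≈0 : det (contract₁ B 1# ρ₃) ≈ 0#
        det₃≈0 = *-zeroʳ⁻ Δ≉0 (trans (sym (bilinear-det (contract₁ B 1# ρ₃) 1# ρ₁ 1# ρ₄ 1# ρ₂ 1# ρ₅))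
          (x≈y⇒x-y≈0 (trans (*-comm p₁ p₃) (trans p₃p₁ (*-comm p₂ r′)))))

        mixed : Carrier
        mixed = p₀ * p₃ + p₁ * p₄ - p₅ * p₂ - r′ * r

        -- The determinant of the contraction with (1, x) is a quadratic polynomial in x with
        -- leading coefficient Q and the distinct roots ρ, ρ₃. Its polarisation at the two roots is
        -- -Q(ρ - ρ₃)², and `mixed` is a nonzero multiple of it.
        mixed≉0 : mixed ≉ 0#
        mixed≉0 eq = *-nonzero (*-nonzero Δ≉0 leading≉0) (*-nonzero ρ-ρ₃≉0 ρ-ρ₃≉0) (begin
          Δ * Q * ((ρ - ρ₃) * (ρ - ρ₃))
            ≈⟨ solve 5 (λ Δ Q d x y → Δ :* Q :* (d :* d) := Δ :* (x :+ y) :- Δ :* (x :+ y :- Q :* (d :* d))) Δ Q (ρ - ρ₃) (det A) (det A₃) ⟩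
          Δ * (det A + det A₃) - Δ * (det A + det A₃ - Q * ((ρ - ρ₃) * (ρ - ρ₃)))
            ≈⟨ +-cong (trans (*-congˡ (trans (+-cong det≈0 det₃≈0) (+-identityʳ 0#))) (zeroʳ Δ)) (-‿cong (*-congˡ (sym polar))) ⟩
          0# - Δ * polar-det A A₃      ≈⟨ +-congˡ (-‿cong (sym (bilinear-polar A A₃ 1# ρ₁ 1# ρ₄ 1# ρ₂ 1# ρ₅))) ⟩
          0# - mixed                   ≈⟨ +-congˡ (-‿cong eq) ⟩
          0# - 0#                      ≈⟨ -‿inverseʳ 0# ⟩
          0#                           ∎)
          where
          A = contract₁ B 1# ρ
          A₃ = contract₁ B 1# ρ₃
          Q = B 4F * B 7F - B 5F * B 6F
          ρ-ρ₃≉0 : ρ - ρ₃ ≉ 0#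
          ρ-ρ₃≉0 d≈0 = ρ≉φ₃ρ (x-y≈0⇒x≈y d≈0)
          polar : polar-det A A₃ ≈ det A + det A₃ - Q * ((ρ - ρ₃) * (ρ - ρ₃))
          polar = solve 10 (λ a b c d e f g h x y →
              let A = λ s t x → s :* con (+ 1) :+ t :* x in
              A a e x :* A d h y :+ A a e y :* A d h x :- A b f x :* A c g y :- A b f y :* A c g x :=
              (A a e x :* A d h x :- A b f x :* A c g x) :+ (A a e y :* A d h y :- A b f y :* A c g y) :- (e :* h :- f :* g) :* ((x :- y) :* (x :- y))) (B 0F) (B 1F) (B 2F) (B 3F) (B 4F) (B 5F) (B 6F) (B 7F) ρ ρ₃

        -- Otherwise p₅ is nonzero as well, and cancellation in the monomial relations gives p₀p₃ =
        -- p₅p₂ and r′r = p₁p₄, so that `mixed` would vanish.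
        p₀≈0 : p₀ ≈ 0#
        p₀≈0 with p₀ ≟ 0#
        ... | yes eq  = eq
        ... | no p₀≉0 = contradiction (begin
          p₀ * p₃ + p₁ * p₄ - p₅ * p₂ - r′ * r  ≈⟨ +-cong (+-congʳ (+-cong p₀p₃ refl)) (-‿cong r′r) ⟩
          p₅ * p₂ + p₁ * p₄ - p₅ * p₂ - p₁ * p₄  ≈⟨ solve 2 (λ x y → x :+ y :- x :- y := con (+ 0)) (p₅ * p₂) (p₁ * p₄) ⟩
          0# ∎) mixed≉0
          where
          p₅≉0 : p₅ ≉ 0#
          p₅≉0 eq = p₀≉0 (trans (sym φp₅) (trans (φ-cong eq) φ-0))
          r′r : r′ * r ≈ p₁ * p₄
          r′r = *-cancelˡ (*-nonzero p₀≉0 p₅≉0) (begin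
            p₀ * p₅ * (r′ * r)        ≈⟨ solve 4 (λ a b c d → a :* b :* (c :* d) := (b :* d) :* (a :* c)) p₀ p₅ r′ r ⟩
            (p₅ * r) * (p₀ * r′)      ≈⟨ *-cong p₀p₄ p₁p₅ ⟨
            (p₀ * p₄) * (p₁ * p₅)     ≈⟨ solve 4 (λ a b c d → (a :* b) :* (c :* d) := a :* d :* (c :* b)) p₀ p₄ p₁ p₅ ⟩
            p₀ * p₅ * (p₁ * p₄)       ∎)
          p₄p₁ : p₄ * p₁ ≈ p₅ * p₂
          p₄p₁ = *-cancelˡ p₀≉0 (begin
            p₀ * (p₄ * p₁)    ≈⟨ *-assoc _ _ _ ⟨
            p₀ * p₄ * p₁      ≈⟨ *-congʳ p₀p₄ ⟩
            p₅ * r * p₁       ≈⟨ solve 3 (λ a b c → a :* b :* c := a :* (c :* b)) p₅ r p₁ ⟩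
            p₅ * (p₁ * r)     ≈⟨ *-congˡ p₂p₀ ⟨
            p₅ * (p₂ * p₀)    ≈⟨ solve 3 (λ a b c → a :* (b :* c) := c :* (a :* b)) p₅ p₂ p₀ ⟩
            p₀ * (p₅ * p₂)    ∎)
          p₀p₃ : p₀ * p₃ ≈ p₅ * p₂
          p₀p₃ = sym (conjugate φp₄ φp₁ φp₅ φp₂ p₄p₁)

        vanish : ∀ {x y} → φ x ≈ y → x ≈ 0# → y ≈ 0#
        vanish eq x≈0 = trans (sym eq) (trans (φ-cong x≈0) φ-0)
        p₁≈0 = vanish φp₀ p₀≈0
        p₂≈0 = vanish φp₁ p₁≈0
        p₃≈0 = vanish φp₂ p₂≈0
        p₄≈0 = vanish φp₃ p₃≈0
        p₅≈0 = vanish φp₄ p₄≈0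

      -- Once the first orbit vanishes, `mixed` reduces to -r′r.
      r≉0 : r ≉ 0#
      r≉0 r≈0 = mixed≉0 (begin
        p₀ * p₃ + p₁ * p₄ - p₅ * p₂ - r′ * r
          ≈⟨ +-cong (+-cong (+-cong (*-congʳ p₀≈0) (*-congʳ p₁≈0)) (-‿cong (*-congʳ p₅≈0))) (-‿cong (*-congˡ r≈0)) ⟩
        0# * p₃ + 0# * p₄ - 0# * p₂ - r′ * 0#
          ≈⟨ solve 4 (λ a b c d → con (+ 0) :* a :+ con (+ 0) :* b :- con (+ 0) :* c :- d :* con (+ 0) := con (+ 0)) p₃ p₄ p₂ r′ ⟩
        0# ∎)

      φ₂r≈r : φ₂ r ≈ r
      φ₂r≈r = trans (φ-cong φr) φr′

      -- In the adapted coordinates B is supported at two opposite corners of the 2×2×2 cube. Up to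
      -- the factor r, `scalar` is the coordinate of T at one of them. The other six corners form a
      -- Frobenius orbit, a hexagon, and `product` is the coordinate at one of its vertices.
      scalar product : Vector Carrier 8 → Carrier
      scalar T = r * tri T (- ρ₃) 1# (- ρ₁) 1# (- ρ₅) 1#
      product T = tri T (- ρ₃) 1# (- ρ₄) 1# (- ρ₅) 1#

      -- As all p vanish, the expansion of the pairing of B and T keeps just two terms. They are
      -- conjugate to each other, and their equality is the equation of the hyperplane.
      scalar-fixed : ∀ {T} → IsCyclic T → pairing B T ≈ 0# → φ (scalar T) ≈ scalar T
      scalar-fixed {T} T-cyclic BT≈0 = begin
        φ (r * t ρ₃ ρ₁ ρ₅)        ≈⟨ φ-product φr φt ⟩
        r′ * t ρ ρ₄ ρ₂            ≈⟨ x-y≈0⇒x≈y (trans (sym expansion≈) expansion≈0) ⟩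
        r * t ρ₃ ρ₁ ρ₅            ∎
        where
        t : Carrier → Carrier → Carrier → Carrier
        t x y z = tri T (- x) 1# (- y) 1# (- z) 1#
        φt : φ (t ρ₃ ρ₁ ρ₅) ≈ t ρ ρ₄ ρ₂
        φt = trans (φ-tri T-cyclic (- ρ₃) 1# (- ρ₁) 1# (- ρ₅) 1#) (tri-cong {T} {T} (λ _ → refl)
          (trans (φ-neg ρ₅) (-‿cong (φ₆-id ρ))) φ-1 (φ-neg ρ₃) φ-1 (φ-neg ρ₁) φ-1)
        expansion : Carrier
        expansion =
            ((p₀ * t ρ₃ ρ₄ ρ₅ - p₅ * t ρ₃ ρ₄ ρ₂) - (r * t ρ₃ ρ₁ ρ₅ - p₄ * t ρ₃ ρ₁ ρ₂))
          - ((p₁ * t ρ ρ₄ ρ₅ - r′ * t ρ ρ₄ ρ₂) - (p₂ * t ρ ρ₁ ρ₅ - p₃ * t ρ ρ₁ ρ₂))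
        expansion≈0 : expansion ≈ 0#
        expansion≈0 = trans (sym (pairing-expansion B T ρ ρ₁ ρ₂ ρ₃ ρ₄ ρ₅))
          (trans (*-congˡ (trans (*-congˡ (trans (*-congˡ BT≈0) (zeroʳ (ρ₂ - ρ₅)))) (zeroʳ (ρ₁ - ρ₄)))) (zeroʳ (ρ - ρ₃)))
        drop : ∀ {p} x → p ≈ 0# → p * x ≈ 0#
        drop x p≈0 = trans (*-congʳ p≈0) (zeroˡ x)
        expansion≈ : expansion ≈ r′ * t ρ ρ₄ ρ₂ - r * t ρ₃ ρ₁ ρ₅
        expansion≈ = trans
          (+-cong (+-cong (+-cong (drop (t ρ₃ ρ₄ ρ₅) p₀≈0) (-‿cong (drop (t ρ₃ ρ₄ ρ₂) p₅≈0))) (-‿cong (+-congˡ (-‿cong (drop (t ρ₃ ρ₁ ρ₂) p₄≈0)))))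
            (-‿cong (+-cong (+-congʳ (drop (t ρ ρ₄ ρ₅) p₁≈0)) (-‿cong (+-cong (drop (t ρ ρ₁ ρ₅) p₂≈0) (-‿cong (drop (t ρ ρ₁ ρ₂) p₃≈0)))))))
          (solve 2 (λ x y → let z = con (+ 0) in ((z :- z) :- (x :- z)) :- ((z :- y) :- (z :- z)) := y :- x) (r * t ρ₃ ρ₁ ρ₅) (r′ * t ρ ρ₄ ρ₂))

      -- The linear form with zero (1, ρ₃), hence without zeros in PG(1, q³).
      linear : Carrier → Carrier → Carrier
      linear x₀ x₁ = - ρ₃ * x₀ + 1# * x₁

      private
        φ-linear : ∀ {σ x₀ x₁} → φ (- σ * x₀ + 1# * x₁) ≈ - φ σ * φ x₀ + 1# * φ x₁
        φ-linear = trans (φ-+ _ _) (+-cong (φ-product (φ-neg _) refl) (φ-product φ-1 refl))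

      φ₃-linear : ∀ {x₀ x₁} → φ₃ x₀ ≈ x₀ → φ₃ x₁ ≈ x₁ → φ₃ (linear x₀ x₁) ≈ - ρ * x₀ + 1# * x₁
      φ₃-linear x₀∈ x₁∈ = trans (φ-cong (trans (φ-cong φ-linear) φ-linear)) (trans φ-linear
        (+-cong (*-cong (-‿cong (φ₆-id ρ)) x₀∈) (*-congˡ x₁∈)))

      module _ {x₀ x₁} (x₀∈ : φ₃ x₀ ≈ x₀) (x₁∈ : φ₃ x₁ ≈ x₁) where
        private
          X = linear x₀ x₁
          φX : φ X ≈ - ρ₄ * φ x₀ + 1# * φ x₁
          φX = φ-linear
          φ₂X : φ₂ X ≈ - ρ₅ * φ₂ x₀ + 1# * φ₂ x₁
          φ₂X = trans (φ-cong φX) φ-linear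
          φ₄X : φ₄ X ≈ - ρ₁ * φ x₀ + 1# * φ x₁
          φ₄X = trans (φ-cong (φ₃-linear x₀∈ x₁∈)) φ-linear

        scalar-tensor : scalar (tensor x₀ x₁ (φ x₀) (φ x₁) (φ₂ x₀) (φ₂ x₁)) ≈ r * (X * φ₄ X * φ₂ X)
        scalar-tensor = *-congˡ (trans (tri-tensor x₀ x₁ (φ x₀) (φ x₁) (φ₂ x₀) (φ₂ x₁) (- ρ₃) 1# (- ρ₁) 1# (- ρ₅) 1#) (sym (*-cong (*-congˡ φ₄X) φ₂X)))

        product-tensor : product (tensor x₀ x₁ (φ x₀) (φ x₁) (φ₂ x₀) (φ₂ x₁)) ≈ X * φ X * φ₂ X
        product-tensor = trans (tri-tensor x₀ x₁ (φ x₀) (φ x₁) (φ₂ x₀) (φ₂ x₁) (- ρ₃) 1# (- ρ₄) 1# (- ρ₅) 1#) (sym (*-cong (*-congˡ φX) φ₂X))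

      -- The forms `linear` and its conjugate under φ₃ are independent because ρ ≠ ρ₃. The
      -- hypothesis is the vanishing of the determinant of their values at x and y.
      cross : ∀ {x₀ x₁ y₀ y₁} → φ₃ x₀ ≈ x₀ → φ₃ x₁ ≈ x₁ → φ₃ y₀ ≈ y₀ → φ₃ y₁ ≈ y₁ →
              linear x₀ x₁ * φ₃ (linear y₀ y₁) ≈ linear y₀ y₁ * φ₃ (linear x₀ x₁) → x₁ * y₀ ≈ y₁ * x₀
      cross {x₀} {x₁} {y₀} {y₁} x₀∈ x₁∈ y₀∈ y₁∈ eq = x-y≈0⇒x≈y (*-zeroʳ⁻ (λ d≈0 → ρ≉φ₃ρ (sym (x-y≈0⇒x≈y d≈0))) (begin
        (ρ₃ - ρ) * (x₁ * y₀ - y₁ * x₀)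
          ≈⟨ solve 6 (λ ρ₃ ρ x₀ x₁ y₀ y₁ → (ρ₃ :- ρ) :* (x₁ :* y₀ :- y₁ :* x₀) :=
               (:- ρ₃ :* x₀ :+ con (+ 1) :* x₁) :* (:- ρ :* y₀ :+ con (+ 1) :* y₁) :- (:- ρ₃ :* y₀ :+ con (+ 1) :* y₁) :* (:- ρ :* x₀ :+ con (+ 1) :* x₁)) ρ₃ ρ x₀ x₁ y₀ y₁ ⟩
        linear x₀ x₁ * (- ρ * y₀ + 1# * y₁) - linear y₀ y₁ * (- ρ * x₀ + 1# * x₁)
          ≈⟨ x≈y⇒x-y≈0 (trans (*-congˡ (sym (φ₃-linear y₀∈ y₁∈))) (trans eq (*-congˡ (φ₃-linear x₀∈ x₁∈)))) ⟩
        0# ∎))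

      -- f and g stand for the values of scalar and product at κ times the tensor
      -- of a point.
      record AtPoint (f g X : Carrier) : Set (c′ Level.⊔ ℓ′) where
        field
          {κ}      : Carrier
          κ-fixed  : φ κ ≈ κ
          κ-nonzero : κ ≉ 0#
          f≈ : f ≈ κ * (r * (X * φ₄ X * φ₂ X))
          g≈ : g ≈ κ * (X * φ X * φ₂ X)
          X≉0 : X ≉ 0#

        f≉0 : f ≉ 0#
        f≉0 f≈0 = *-nonzero κ-nonzero (*-nonzero r≉0 (*-nonzero (*-nonzero X≉0 (φ-nonzero (φ-nonzero (φ-nonzero (φ-nonzero X≉0))))) (φ-nonzero (φ-nonzero X≉0))))
          (trans (sym f≈) f≈0)

        w = g * f ⁻¹

        -- The common factor κ X φ₂(X) of f and g cancels. So w is φ(X / φ₃(X)) / r, which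
        -- determines X up to a factor fixed by φ₃ and hence the point.
        ratio : φ X ≈ w * (r * φ₄ X)
        ratio = *-cancelˡ (*-nonzero κ-nonzero (*-nonzero X≉0 (φ-nonzero (φ-nonzero X≉0)))) (begin
          κ * (X * φ₂ X) * φ X      ≈⟨ solve 4 (λ k a b c → k :* (a :* b) :* c := k :* (a :* c :* b)) κ X (φ₂ X) (φ X) ⟩
          κ * (X * φ X * φ₂ X)      ≈⟨ g≈ ⟨
          g                         ≈⟨ trans (*-assoc _ _ _) (trans (*-congˡ (⁻¹-inverseˡ f≉0)) (*-identityʳ g)) ⟨
          w * f                     ≈⟨ *-congˡ f≈ ⟩
          w * (κ * (r * (X * φ₄ X * φ₂ X)))
            ≈⟨ solve 6 (λ w k r a b c → w :* (k :* (r :* (a :* b :* c))) := k :* (a :* c) :* (w :* (r :* b))) w κ r X (φ₄ X) (φ₂ X) ⟩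
          κ * (X * φ₂ X) * (w * (r * φ₄ X)) ∎)

        w≉0 : w ≉ 0#
        w≉0 w≈0 = φ-nonzero X≉0 (trans ratio (trans (*-congʳ w≈0) (zeroˡ _)))

        -- The invariance of f reads r′ φ(X) φ₃(X) φ₅(X) = r X φ₂(X) φ₄(X). Replacing φ(X), φ₂(X),
        -- φ₃(X) by `ratio` and its conjugates leaves only w and its conjugates.
        surface-equation : φ f ≈ f → w * φ₂ w ≈ r ⁻¹ * φ w
        surface-equation f-fixed = *-cancelˡ r≉0 (trans (*-cancelˡ (*-nonzero (*-nonzero r≉0 (*-nonzero φ₄X≉0 X≉0)) (*-nonzero r′≉0 φ₅X≉0)) (begin
          r * (φ₄ X * X) * (r′ * φ₅ X) * (r * (w * φ₂ w))
            ≈⟨ solve 7 (λ r r′ x x₄ x₅ w w₂ → r :* (x₄ :* x) :* (r′ :* x₅) :* (r :* (w :* w₂)) := (w :* (r :* x₄)) :* (w₂ :* (r :* x)) :* (r′ :* x₅)) r r′ X (φ₄ X) (φ₅ X) w (φ₂ w) ⟩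
          (w * (r * φ₄ X)) * (φ₂ w * (r * X)) * (r′ * φ₅ X)
            ≈⟨ *-congʳ (*-cong (sym ratio) (sym ratio₂)) ⟩
          φ X * φ₃ X * (r′ * φ₅ X)
            ≈⟨ solve 4 (λ a b c d → a :* b :* (c :* d) := c :* (a :* d :* b)) (φ X) (φ₃ X) r′ (φ₅ X) ⟩
          r′ * (φ X * φ₅ X * φ₃ X)    ≈⟨ norm-fixed ⟩
          r * (X * φ₄ X * φ₂ X)       ≈⟨ *-congˡ (*-congˡ ratio₁) ⟩
          r * (X * φ₄ X * (φ w * (r′ * φ₅ X)))
            ≈⟨ solve 6 (λ r r′ x x₄ x₅ w₁ → r :* (x :* x₄ :* (w₁ :* (r′ :* x₅))) := r :* (x₄ :* x) :* (r′ :* x₅) :* w₁) r r′ X (φ₄ X) (φ₅ X) (φ w) ⟩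
          r * (φ₄ X * X) * (r′ * φ₅ X) * φ w   ∎))
          (sym (trans (sym (*-assoc _ _ _)) (trans (*-congʳ (⁻¹-inverseʳ r≉0)) (*-identityˡ _)))))
          where
          φ₄X≉0 = φ-nonzero (φ-nonzero (φ-nonzero (φ-nonzero X≉0)))
          φ₅X≉0 = φ-nonzero φ₄X≉0
          r′≉0 : r′ ≉ 0#
          r′≉0 eq = φ-nonzero r≉0 (trans φr eq)
          ratio₁ : φ₂ X ≈ φ w * (r′ * φ₅ X)
          ratio₁ = trans (φ-cong ratio) (φ-product refl (φ-product φr refl))
          ratio₂ : φ₃ X ≈ φ₂ w * (r * X)
          ratio₂ = trans (φ-cong ratio₁) (φ-product refl (φ-product φr′ (φ₆-id X)))
          norm-fixed : r′ * (φ X * φ₅ X * φ₃ X) ≈ r * (X * φ₄ X * φ₂ X)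
          norm-fixed = *-cancelˡ κ-nonzero (begin
            κ * (r′ * (φ X * φ₅ X * φ₃ X))   ≈⟨ φ-product κ-fixed (φ-product φr (φ-product (φ-* _ _) refl)) ⟨
            φ (κ * (r * (X * φ₄ X * φ₂ X)))  ≈⟨ φ-cong f≈ ⟨
            φ f                              ≈⟨ f-fixed ⟩
            f                                ≈⟨ f≈ ⟩
            κ * (r * (X * φ₄ X * φ₂ X))      ∎)

      same-ratio : ∀ {f g X f′ g′ X′} → AtPoint f g X → AtPoint f′ g′ X′ → g * f ⁻¹ ≈ g′ * f′ ⁻¹ → X * φ₃ X′ ≈ X′ * φ₃ X
      same-ratio {X = X} {X′ = X′} P P′ eq = φ-injective (begin
        φ (X * φ₃ X′)                   ≈⟨ φ-* _ _ ⟩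
        φ X * φ₄ X′                     ≈⟨ *-congʳ (trans P.ratio (*-congʳ eq)) ⟩
        P′.w * (r * φ₄ X) * φ₄ X′       ≈⟨ solve 4 (λ w r a b → w :* (r :* a) :* b := w :* (r :* b) :* a) P′.w r (φ₄ X) (φ₄ X′) ⟩
        P′.w * (r * φ₄ X′) * φ₄ X       ≈⟨ *-congʳ P′.ratio ⟨
        φ X′ * φ₄ X                     ≈⟨ φ-* _ _ ⟨
        φ (X′ * φ₃ X)                   ∎)
        where
        module P = AtPoint P
        module P′ = AtPoint P′

  -- The points of O₁ and the tensor annihilating a hyperplane

  module Geometry (n≡q³ : n ≡ q ℕ.^ 3) where

    open Extension.WithEmbedding K F ι-hom q
    open LeftModule (space 8) hiding (-ᴹ_)
    open LinearAlgebra.Module K K-finite (space 8)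
    open KLinear (space 8)

    φ₂ : Carrier → Carrier
    φ₂ x = φ (φ x)

    ^q² : ∀ x → x ^ (q ℕ.^ 2) ≈ φ₂ x
    ^q² x = sym (trans (Exp.^-assocʳ semiring x q q) (reflexive (≡.cong (λ m → x ^ (q ℕ.* m)) (≡.sym (ℕₚ.*-identityʳ q)))))

    φ₃-id : ∀ x → φ (φ₂ x) ≈ x
    φ₃-id x = begin
      φ (φ₂ x)             ≈⟨ φ-cong (^q² x) ⟨
      (x ^ (q ℕ.^ 2)) ^ q  ≈⟨ Exp.^-assocʳ semiring x (q ℕ.^ 2) q ⟩
      x ^ (q ℕ.^ 2 ℕ.* q)  ≡⟨ ≡.cong (x ^_) (ℕₚ.*-comm (q ℕ.^ 2) q) ⟩
      x ^ (q ℕ.^ 3)        ≡⟨ ≡.cong (x ^_) n≡q³ ⟨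
      x ^ n                ≈⟨ fermat x ⟩
      x                    ∎

    ^[q²+q] : ∀ x → x ^ (q ℕ.^ 2 ℕ.+ q) ≈ φ x * φ₂ x
    ^[q²+q] x = trans (Exp.^-homo-* semiring x (q ℕ.^ 2) q) (trans (*-congʳ (^q² x)) (*-comm _ _))

    ^[q²+q+1] : ∀ x → x ^ (q ℕ.^ 2 ℕ.+ q ℕ.+ 1) ≈ x * φ x * φ₂ x
    ^[q²+q+1] x = trans (Exp.^-homo-* semiring x (q ℕ.^ 2 ℕ.+ q) 1) (trans (*-cong (^[q²+q] x) (*-identityʳ x))
      (trans (*-comm _ _) (sym (*-assoc _ _ _))))

    norm : Carrier → Carrier
    norm x = x * φ x * φ₂ x

    φ-norm : ∀ x → φ (norm x) ≈ norm x
    φ-norm x = trans (φ-* _ _) (trans (*-cong (φ-* _ _) (φ₃-id x)) (trans (*-comm _ _) (sym (*-assoc _ _ _))))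

    norm-* : ∀ x y → norm (x * y) ≈ norm x * norm y
    norm-* x y = trans (*-cong (*-congˡ (φ-* x y)) (trans (φ-cong (φ-* x y)) (φ-* _ _)))
      (solve 6 (λ a b c d e f → a :* b :* (c :* d) :* (e :* f) := a :* c :* e :* (b :* d :* f)) x y (φ x) (φ y) (φ₂ x) (φ₂ y))

    norm-nonzero : ∀ {x} → x ≉ 0# → norm x ≉ 0#
    norm-nonzero x≉0 = *-nonzero (*-nonzero x≉0 (φ-nonzero x≉0)) (φ-nonzero (φ-nonzero x≉0))

    norm-cong : ∀ {x y} → x ≈ y → norm x ≈ norm y
    norm-cong eq = *-cong (*-cong eq (φ-cong eq)) (φ-cong (φ-cong eq))

    pureTensor : Carrier → Carrier → Vector Carrier 8
    pureTensor x₀ x₁ = tensor x₀ x₁ (φ x₀) (φ x₁) (φ₂ x₀) (φ₂ x₁)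

    pureTensor-cyclic : ∀ x₀ x₁ → IsCyclic (pureTensor x₀ x₁)
    pureTensor-cyclic x y = record
      { φ000 = rotate x x x ; φ100 = rotate y x x ; φ010 = rotate x y x ; φ001 = rotate x x y
      ; φ011 = rotate x y y ; φ101 = rotate y x y ; φ110 = rotate y y x ; φ111 = rotate y y y }
      where
      rotate : ∀ a b c → φ (a * φ b * φ₂ c) ≈ c * φ a * φ₂ b
      rotate a b c = trans (trans (φ-* _ _) (*-cong (φ-* _ _) (φ₃-id c))) (trans (*-comm _ _) (sym (*-assoc _ _ _)))

    data Normalized (x₀ x₁ : Carrier) : Set ℓ′ where
      affine   : x₀ ≈ 1# → Normalized x₀ x₁
      infinity : x₀ ≈ 0# → x₁ ≈ 1# → Normalized x₀ x₁

    private
      tensor-cong : ∀ {x₀ x₁ y₀ y₁ z₀ z₁ x₀′ x₁′ y₀′ y₁′ z₀′ z₁′} →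
        x₀ ≈ x₀′ → x₁ ≈ x₁′ → y₀ ≈ y₀′ → y₁ ≈ y₁′ → z₀ ≈ z₀′ → z₁ ≈ z₁′ → tensor x₀ x₁ y₀ y₁ z₀ z₁ ≈ᴹ tensor x₀′ x₁′ y₀′ y₁′ z₀′ z₁′
      tensor-cong a b c d e f 0F = *-cong (*-cong a c) e
      tensor-cong a b c d e f 1F = *-cong (*-cong a c) f
      tensor-cong a b c d e f 2F = *-cong (*-cong a d) e
      tensor-cong a b c d e f 3F = *-cong (*-cong a d) f
      tensor-cong a b c d e f 4F = *-cong (*-cong b c) e
      tensor-cong a b c d e f 5F = *-cong (*-cong b c) f
      tensor-cong a b c d e f 6F = *-cong (*-cong b d) e
      tensor-cong a b c d e f 7F = *-cong (*-cong b d) f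

    pureTensor-cong : ∀ {x₀ x₁ y₀ y₁} → x₀ ≈ y₀ → x₁ ≈ y₁ → pureTensor x₀ x₁ ≈ᴹ pureTensor y₀ y₁
    pureTensor-cong a b = tensor-cong a b (φ-cong a) (φ-cong b) (φ-cong (φ-cong a)) (φ-cong (φ-cong b))

    -- With its counterpart at infinity this presents O₁ as the image of PG(1, q³) under the twisted
    -- Segre map x ↦ x ⊗ φ(x) ⊗ φ₂(x).
    affine-coordinates : ∀ t → coordinates 1# t (t ^ (q ℕ.^ 2 ℕ.+ q)) (t ^ (q ℕ.^ 2 ℕ.+ q ℕ.+ 1)) ≈ᴹ pureTensor 1# t
    affine-coordinates t i = trans (go i) (tensor-cong refl refl (sym φ-1) refl (sym (trans (φ-cong φ-1) φ-1)) refl i)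
      where
      γ = t ^ (q ℕ.^ 2 ℕ.+ q)
      φγ : φ γ ≈ t * φ₂ t
      φγ = trans (φ-cong (^[q²+q] t)) (trans (φ-* _ _) (trans (*-congˡ (φ₃-id t)) (*-comm _ _)))
      φ₂γ : φ₂ γ ≈ t * φ t
      φ₂γ = trans (φ-cong φγ) (trans (φ-* _ _) (trans (*-congˡ (φ₃-id t)) (*-comm _ _)))
      l = λ x → trans (*-congʳ (*-identityˡ 1#)) (*-identityˡ x)
      go : coordinates 1# t γ (t ^ (q ℕ.^ 2 ℕ.+ q ℕ.+ 1)) ≈ᴹ tensor 1# t 1# (φ t) 1# (φ₂ t)
      go 0F = sym (l 1#)
      go 1F = trans (^q² t) (sym (l (φ₂ t)))
      go 2F = sym (trans (*-identityʳ _) (*-identityˡ _))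
      go 3F = trans (^[q²+q] t) (sym (*-congʳ (*-identityˡ _)))
      go 4F = sym (trans (*-identityʳ _) (*-identityʳ _))
      go 5F = trans φγ (sym (*-congʳ (*-identityʳ _)))
      go 6F = trans (trans (^q² γ) φ₂γ) (sym (*-identityʳ _))
      go 7F = ^[q²+q+1] t

    infinity-coordinates : coordinates 0# 0# 0# 1# ≈ᴹ pureTensor 0# 1#
    infinity-coordinates i = trans (go i) (tensor-cong refl refl (sym φ-0) (sym φ-1) (sym (trans (φ-cong φ-0) φ-0)) (sym (trans (φ-cong φ-1) φ-1)) i)
      where
      φ₂0 = trans (^q² 0#) (trans (φ-cong φ-0) φ-0)
      go : coordinates 0# 0# 0# 1# ≈ᴹ tensor 0# 1# 0# 1# 0# 1#
      go 0F = sym (zeroʳ _)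
      go 1F = trans φ₂0 (sym (trans (*-congʳ (zeroˡ _)) (zeroˡ _)))
      go 2F = trans φ-0 (sym (zeroʳ _))
      go 3F = sym (trans (*-congʳ (zeroˡ _)) (zeroˡ _))
      go 4F = sym (zeroʳ _)
      go 5F = trans φ-0 (sym (trans (*-congʳ (zeroʳ _)) (zeroˡ _)))
      go 6F = trans φ₂0 (sym (zeroʳ _))
      go 7F = sym (trans (*-identityʳ _) (*-identityʳ _))

    record Representative (p : Point) : Set (c Level.⊔ c′ Level.⊔ ℓ′) where
      field
        x₀ x₁      : Carrier
        normalized : Normalized x₀ x₁
        scalar     : K.Carrier
        spans      : scalar *ₗ pureTensor x₀ x₁ ≈ᴹ vec p

      scalar≉0 : ι scalar ≉ 0#
      scalar≉0 k≈0 = nonzero p (λ i → trans (sym (spans i)) (trans (*-congʳ k≈0) (zeroˡ _)))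

    representative : ∀ {p} → O₁ p → Representative p
    representative (inj₁ (t , k , eq)) = record
      { x₀ = 1# ; x₁ = t ; normalized = affine refl ; scalar = k ; spans = λ i → trans (*-congˡ (sym (affine-coordinates t i))) (eq i) }
    representative (inj₂ (k , eq)) = record
      { x₀ = 0# ; x₁ = 1# ; normalized = infinity refl refl ; scalar = k ; spans = λ i → trans (*-congˡ (sym (infinity-coordinates i))) (eq i) }

    pureTensor-nonzero : ∀ {x₀ x₁} → Normalized x₀ x₁ → ¬ (pureTensor x₀ x₁ ≈ᴹ 0ᴹ)
    pureTensor-nonzero (affine x₀≈1) eq = norm-nonzero (λ x₀≈0 → 1≉0 (trans (sym x₀≈1) x₀≈0)) (eq 0F)
    pureTensor-nonzero (infinity _ x₁≈1) eq = norm-nonzero (λ x₁≈0 → 1≉0 (trans (sym x₁≈1) x₁≈0)) (eq 7F)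

    pureTensor∈O₁ : ∀ {x₀ x₁} → Normalized x₀ x₁ → (p : Point) → vec p ≈ᴹ pureTensor x₀ x₁ → O₁ p
    pureTensor∈O₁ {x₀} {x₁} (affine x₀≈1) p eq = inj₁ (x₁ , K.1# , λ i → trans (*-congʳ ι-1) (trans (*-identityˡ _)
      (trans (affine-coordinates x₁ i) (trans (pureTensor-cong (sym x₀≈1) refl i) (sym (eq i))))))
    pureTensor∈O₁ (infinity x₀≈0 x₁≈1) p eq = inj₂ (K.1# , λ i → trans (*-congʳ ι-1) (trans (*-identityˡ _)
      (trans (infinity-coordinates i) (trans (pureTensor-cong (sym x₀≈0) (sym x₁≈1) i) (sym (eq i))))))

    normalized-cross : ∀ {x₀ x₁ y₀ y₁} → Normalized x₀ x₁ → Normalized y₀ y₁ → x₁ * y₀ ≈ y₁ * x₀ → x₀ ≈ y₀ × x₁ ≈ y₁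
    normalized-cross (affine x₀≈1) (affine y₀≈1) eq = trans x₀≈1 (sym y₀≈1) ,
      trans (sym (trans (*-congˡ y₀≈1) (*-identityʳ _))) (trans eq (trans (*-congˡ x₀≈1) (*-identityʳ _)))
    normalized-cross (infinity x₀≈0 x₁≈1) (infinity y₀≈0 y₁≈1) eq = trans x₀≈0 (sym y₀≈0) , trans x₁≈1 (sym y₁≈1)
    normalized-cross (affine x₀≈1) (infinity y₀≈0 y₁≈1) eq = contradiction
      (trans (sym (trans (*-cong y₁≈1 x₀≈1) (*-identityˡ 1#))) (trans (sym eq) (trans (*-congˡ y₀≈0) (zeroʳ _)))) 1≉0
    normalized-cross (infinity x₀≈0 x₁≈1) (affine y₀≈1) eq = contradiction
      (trans (sym (trans (*-cong x₁≈1 y₀≈1) (*-identityˡ 1#))) (trans eq (trans (*-congˡ x₀≈0) (zeroʳ _)))) 1≉0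

    same-point : ∀ {p r} (P : Representative p) (R : Representative r) →
                 Representative.x₁ P * Representative.x₀ R ≈ Representative.x₁ R * Representative.x₀ P → p ≈ₚ r
    same-point P R eq = P.scalar K.* R.scalar K.⁻¹ , λ i → begin
      ι (P.scalar K.* R.scalar K.⁻¹) * _      ≈⟨ *-cong (ι-* _ _) (sym (R.spans i)) ⟩
      ι P.scalar * ι (R.scalar K.⁻¹) * (ι R.scalar * pureTensor R.x₀ R.x₁ i)
        ≈⟨ solve 4 (λ a b c t → a :* b :* (c :* t) := a :* (b :* c :* t)) (ι P.scalar) (ι (R.scalar K.⁻¹)) (ι R.scalar) (pureTensor R.x₀ R.x₁ i) ⟩
      ι P.scalar * (ι (R.scalar K.⁻¹) * ι R.scalar * pureTensor R.x₀ R.x₁ i)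
        ≈⟨ *-congˡ (trans (*-congʳ (trans (sym (ι-* _ _)) (trans (ι-cong (K.⁻¹-inverseˡ (ι-nonzero R.scalar≉0))) ι-1))) (*-identityˡ _)) ⟩
      ι P.scalar * pureTensor R.x₀ R.x₁ i     ≈⟨ *-congˡ (pureTensor-cong (proj₁ same) (proj₂ same) i) ⟨
      ι P.scalar * pureTensor P.x₀ P.x₁ i     ≈⟨ P.spans i ⟩
      _                                       ∎
      where
      module P = Representative P
      module R = Representative R
      same = normalized-cross P.normalized R.normalized eq

    U₁⇒cyclic : ∀ {v} → U₁ v → IsCyclic v
    U₁⇒cyclic {v} (a , d , b , e , eq) = record
      { φ000 = step 0F 0F (φ-ι a)
      ; φ100 = step 4F 2F refl
      ; φ010 = step 2F 1F (sym (^q² b))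
      ; φ001 = step 1F 4F (trans (φ-cong (^q² b)) (φ₃-id b))
      ; φ011 = step 3F 5F refl
      ; φ101 = step 5F 6F (sym (^q² e))
      ; φ110 = step 6F 3F (trans (φ-cong (^q² e)) (φ₃-id e))
      ; φ111 = step 7F 7F (φ-ι d)
      }
      where
      step : ∀ i j → φ (coordinates (ι a) b e (ι d) i) ≈ coordinates (ι a) b e (ι d) j → φ (v i) ≈ v j
      step i j eq′ = trans (φ-cong (eq i)) (trans eq′ (sym (eq j)))

    cyclic-resp : ∀ {v w} → v ≈ᴹ w → IsCyclic v → IsCyclic w
    cyclic-resp {v} {w} v≈w C = record
      { φ000 = step φ000 ; φ100 = step φ100 ; φ010 = step φ010 ; φ001 = step φ001
      ; φ011 = step φ011 ; φ101 = step φ101 ; φ110 = step φ110 ; φ111 = step φ111 }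
      where
      open IsCyclic C
      step : ∀ {i j} → φ (v i) ≈ v j → φ (w i) ≈ w j
      step {i} {j} eq = trans (φ-cong (sym (v≈w i))) (trans eq (v≈w j))

    cyclic-+ : ∀ {v w} → IsCyclic v → IsCyclic w → IsCyclic (v +ᴹ w)
    cyclic-+ C D = record
      { φ000 = add C.φ000 D.φ000 ; φ100 = add C.φ100 D.φ100 ; φ010 = add C.φ010 D.φ010 ; φ001 = add C.φ001 D.φ001
      ; φ011 = add C.φ011 D.φ011 ; φ101 = add C.φ101 D.φ101 ; φ110 = add C.φ110 D.φ110 ; φ111 = add C.φ111 D.φ111 }
      where
      module C = IsCyclic C
      module D = IsCyclic D
      add : ∀ {x y x′ y′} → φ x ≈ x′ → φ y ≈ y′ → φ (x + y) ≈ x′ + y′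
      add p r = trans (φ-+ _ _) (+-cong p r)

    cyclic-* : ∀ k {v} → IsCyclic v → IsCyclic (k *ₗ v)
    cyclic-* k C = record
      { φ000 = scale φ000 ; φ100 = scale φ100 ; φ010 = scale φ010 ; φ001 = scale φ001
      ; φ011 = scale φ011 ; φ101 = scale φ101 ; φ110 = scale φ110 ; φ111 = scale φ111 }
      where
      open IsCyclic C
      scale : ∀ {x x′} → φ x ≈ x′ → φ (ι k * x) ≈ ι k * x′
      scale p = trans (φ-* _ _) (*-cong (φ-ι k) p)

    cyclic-subspace : IsLinearSubspace IsCyclic
    cyclic-subspace = record
      { resp = cyclic-resp
      ; zero∈ = record { φ000 = φ-0 ; φ100 = φ-0 ; φ010 = φ-0 ; φ001 = φ-0 ; φ011 = φ-0 ; φ101 = φ-0 ; φ110 = φ-0 ; φ111 = φ-0 }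
      ; +-closed = cyclic-+
      ; *-closed = cyclic-*
      }

    pairing-linear : ∀ B → IsLinear (pairing B)
    pairing-linear B = record
      { resp = λ u≈v → +-cong (+-cong (+-cong (+-cong (+-cong (+-cong (+-cong (*-congˡ (u≈v 0F)) (*-congˡ (u≈v 1F))) (*-congˡ (u≈v 2F))) (*-congˡ (u≈v 3F)))
          (*-congˡ (u≈v 4F))) (*-congˡ (u≈v 5F))) (*-congˡ (u≈v 6F))) (*-congˡ (u≈v 7F))
      ; +-homo = pairing-+ B
      ; *-homo = λ k v → pairing-scale B v (ι k)
      }

    linear-kernel : ∀ {f} → IsLinear f → IsLinearSubspace (λ v → f v ≈ 0#)
    linear-kernel f-linear = record
      { resp = λ u≈v eq → trans (sym (resp u≈v)) eq
      ; zero∈ = 0-homo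
      ; +-closed = λ {u} {v} p r → trans (+-homo u v) (trans (+-cong p r) (+-identityˡ _))
      ; *-closed = λ k {v} p → trans (*-homo k v) (trans (*-congˡ p) (zeroʳ _)) }
      where open IsLinear f-linear

    Tr₃ : Carrier → Carrier
    Tr₃ x = x + φ x + φ₂ x

    Tr₃-cong : ∀ {x y} → x ≈ y → Tr₃ x ≈ Tr₃ y
    Tr₃-cong eq = +-cong (+-cong eq (φ-cong eq)) (φ-cong (φ-cong eq))

    Tr₃-+ : ∀ x y → Tr₃ (x + y) ≈ Tr₃ x + Tr₃ y
    Tr₃-+ x y = trans (+-cong (+-congˡ (φ-+ x y)) (trans (φ-cong (φ-+ x y)) (φ-+ _ _)))
      (solve 6 (λ a b c d e f → a :+ b :+ (c :+ d) :+ (e :+ f) := a :+ c :+ e :+ (b :+ d :+ f)) x y (φ x) (φ y) (φ₂ x) (φ₂ y))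

    φ-Tr₃ : ∀ x → φ (Tr₃ x) ≈ Tr₃ x
    φ-Tr₃ x = trans (φ-+ _ _) (trans (+-cong (φ-+ _ _) (φ₃-id x))
      (solve 3 (λ a b c → b :+ c :+ a := a :+ b :+ c) x (φ x) (φ₂ x)))

    Tr₃-nontrivial : ∃ λ θ → Tr₃ θ ≉ 0#
    Tr₃-nontrivial with search (λ x≈y Tx≉0 Ty≈0 → Tx≉0 (trans (Tr₃-cong x≈y) Ty≈0)) (λ x → Dec.¬? (Tr₃ x ≟ 0#))
    ... | yes found = found
    ... | no  none  = contradiction
      (trans (solve 1 (λ x → x := con (+ 0) :+ con (+ 0) :+ x) 1#)
        (poly-roots (q ℕ.^ 2) Tr₃-poly (λ i → element (Fin.inject≤ i q²<n))
          (λ i j eq → Finₚ.inject≤-injective q²<n q²<n i j (element-injective eq))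
          (λ i → Dec.decidable-stable (Tr₃ (element (Fin.inject≤ i q²<n)) ≟ 0#) (λ T≉0 → none (element (Fin.inject≤ i q²<n) , T≉0))))) 1≉0
      where
      q²<n : q ℕ.^ 2 < n
      q²<n = ≡.subst (q ℕ.^ 2 <_) (≡.sym n≡q³) (ℕₚ.^-monoʳ-< q 1<q {2} {3} ℕₚ.≤-refl)
      q<q² : q < q ℕ.^ 2
      q<q² = ≡.subst (_< q ℕ.^ 2) (ℕₚ.*-identityʳ q) (ℕₚ.^-monoʳ-< q 1<q {1} {2} ℕₚ.≤-refl)
      Tr₃-poly : IsPoly (q ℕ.^ 2) (0# + 0# + 1#) Tr₃
      Tr₃-poly = poly-+ (q ℕ.^ 2) (poly-+ (q ℕ.^ 2)
          (poly-raise 1 (poly-cong 1 refl (λ x → trans (+-identityʳ _) (*-identityˡ x)) (poly-linear 1# 0#)) (ℕₚ.<-trans 1<q q<q²))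
          (poly-raise q (poly-^ q) q<q²))
          (poly-cong (q ℕ.^ 2) refl ^q² (poly-^ (q ℕ.^ 2)))

    -- The positions 0, 4, 3, 7 represent the four orbits of the rotation on the index triples.
    cyclic-determined : ∀ {u v} → IsCyclic u → IsCyclic v → u 0F ≈ v 0F → u 4F ≈ v 4F → u 3F ≈ v 3F → u 7F ≈ v 7F → u ≈ᴹ v
    cyclic-determined U V e₀ e₄ e₃ e₇ = λ where
        0F → e₀
        1F → next U.φ010 V.φ010 e₂
        2F → e₂
        3F → e₃
        4F → e₄
        5F → e₅
        6F → next U.φ101 V.φ101 e₅
        7F → e₇
      where
      module U = IsCyclic U
      module V = IsCyclic V
      next : ∀ {x y x′ y′} → φ x ≈ x′ → φ y ≈ y′ → x ≈ y → x′ ≈ y′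
      next p r eq = trans (sym p) (trans (φ-cong eq) r)
      e₂ = next U.φ100 V.φ100 e₄
      e₅ = next U.φ011 V.φ011 e₃

    parameters : Setoid _ _
    parameters = K.setoid ×ₛ (setoid ×ₛ (setoid ×ₛ K.setoid))

    parameters-finite : FiniteSetoid (q ℕ.* (q ℕ.^ 3 ℕ.* (q ℕ.^ 3 ℕ.* q))) parameters
    parameters-finite = IsFiniteField.order K-finite ×-finite (q³-elements ×-finite (q³-elements ×-finite IsFiniteField.order K-finite))
      where
      q³-elements : FiniteSetoid (q ℕ.^ 3) setoid
      q³-elements = ≡.subst (λ m → FiniteSetoid m setoid) n≡q³ (IsFiniteField.order F-finite)

    fromParameters : Setoid.Carrier parameters → Vector Carrier 8
    fromParameters (α , β , γ , δ) = coordinates (ι α) β γ (ι δ)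

    fromParameters-cyclic : ∀ π → IsCyclic (fromParameters π)
    fromParameters-cyclic (α , β , γ , δ) = U₁⇒cyclic (α , δ , β , γ , λ i → refl)

    sub-zero : ∀ {u v : Vector Carrier 8} i → u i ≈ v i → (u +ᴹ (K.- K.1#) *ₗ v) i ≈ 0#
    sub-zero {u} {v} i eq = trans (+-cong eq (trans (*-congʳ (trans (ι-neg K.1#) (-‿cong ι-1))) (-1*x≈-x (v i)))) (-‿inverseʳ (v i))

    sub-zero⁻ : ∀ {u v : Vector Carrier 8} i → (u +ᴹ (K.- K.1#) *ₗ v) i ≈ 0# → u i ≈ v i
    sub-zero⁻ {u} {v} i eq = x-y≈0⇒x≈y (trans (+-congˡ (sym (trans (*-congʳ (trans (ι-neg K.1#) (-‿cong ι-1))) (-1*x≈-x (v i))))) eq)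

    basis-cyclic : (H : Subspace 6) → ⟦ H ⟧ ⊆ Points U₁ → ∀ i → IsCyclic (basis H i)
    basis-cyclic H H⊆U₁ i = U₁⇒cyclic (H⊆U₁ {record { vec = basis H i ; nonzero = independent⇒nonzero {v = basis H} (independent H) i }} (basis∈Span (basis H) i))

    module _ (H : Subspace 6) (H-cyclic : ∀ i → IsCyclic (basis H i)) where

      Span-cyclic : ∀ {v} → Span (basis H) v → IsCyclic v
      Span-cyclic = Span⊆ cyclic-subspace {v = basis H} H-cyclic

      Annihilates : Vector Carrier 8 → Set _
      Annihilates B = IsCyclic B × ¬ (B ≈ᴹ 0ᴹ) × (∀ i → pairing B (basis H i) ≈ 0#)

      -- Cyclic tensors pair to values in K, so the q⁸ of them yield only q⁷ lists of values on the
      -- basis of H.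
      annihilating-tensor : ∃ Annihilates
      annihilating-tensor = go (collision {A = parameters} parameters-finite (finite-vector 7 (IsFiniteField.order K-finite)) (q⁷<q⁸ 1<q) (λ π i → proj₁ (value π i)))
        where
        value : ∀ π i → ∃ λ k → ι k ≈ pairing (fromParameters π) (basis H i)
        value π i = fixed (pairing (fromParameters π) (basis H i)) (φ-pairing (H-cyclic i) (fromParameters-cyclic π))
        go : (∃₂ λ π π′ → ¬ (Setoid._≈_ parameters π π′) × (∀ i → proj₁ (value π i) K.≈ proj₁ (value π′ i))) → ∃ Annihilates
        go (π , π′ , differ , agree) = B , cyclic-+ (fromParameters-cyclic π) (cyclic-* (K.- K.1#) (fromParameters-cyclic π′)) ,
            (λ B≈0 → differ (ι-injective (sub-zero⁻ {u} {u′} 0F (B≈0 0F)) , sub-zero⁻ {u} {u′} 4F (B≈0 4F) , sub-zero⁻ {u} {u′} 3F (B≈0 3F) , ι-injective (sub-zero⁻ {u} {u′} 7F (B≈0 7F)))) ,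
            λ i → trans (pairing-comm B (basis H i)) (trans (P.+-homo i u ((K.- K.1#) *ₗ u′))
              (trans (+-congˡ (trans (P.*-homo i (K.- K.1#) u′) (trans (*-congʳ (trans (ι-neg K.1#) (-‿cong ι-1))) (-1*x≈-x _))))
                (x≈y⇒x-y≈0 (trans (pairing-comm (basis H i) u) (trans (sym (proj₂ (value π i))) (trans (ι-cong (agree i)) (trans (proj₂ (value π′ i)) (pairing-comm u′ (basis H i)))))))))
          where
          u = fromParameters π
          u′ = fromParameters π′
          B = u +ᴹ (K.- K.1#) *ₗ u′
          module P i = IsLinear (pairing-linear (basis H i))

      module _ (B : Vector Carrier 8) (B-annihilates : Annihilates B) where
        B-cyclic = proj₁ B-annihilates
        private module B = IsCyclic B-cyclic

        Span-annihilated : ∀ {v} → Span (basis H) v → pairing B v ≈ 0#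
        Span-annihilated = Span⊆ (linear-kernel (pairing-linear B)) {v = basis H} (proj₂ (proj₂ B-annihilates))

        -- Nondegeneracy of the pairing on cyclic tensors. Some orbit representative of B is
        -- nonzero. On an orbit of length one a unit entry detects it; on an orbit of length three
        -- the pairing is the trace of a product, and t is chosen to make this product an element of
        -- nonzero trace.
        detecting-tensor : ∃ λ T → IsCyclic T × pairing B T ≉ 0#
        detecting-tensor with B 0F ≟ 0# | B 7F ≟ 0# | B 4F ≟ 0# | B 3F ≟ 0#
        ... | no B₀≉0 | _ | _ | _ = 1# ∷ 0# ∷ 0# ∷ 0# ∷ 0# ∷ 0# ∷ 0# ∷ 0# ∷ [] ,
            record { φ000 = φ-1 ; φ100 = φ-0 ; φ010 = φ-0 ; φ001 = φ-0 ; φ011 = φ-0 ; φ101 = φ-0 ; φ110 = φ-0 ; φ111 = φ-0 } ,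
            λ eq → B₀≉0 (trans (solve 8 (λ a b c d e f g h → a := a :* con (+ 1) :+ b :* con (+ 0) :+ c :* con (+ 0) :+ d :* con (+ 0) :+ e :* con (+ 0) :+ f :* con (+ 0) :+ g :* con (+ 0) :+ h :* con (+ 0))
              (B 0F) (B 1F) (B 2F) (B 3F) (B 4F) (B 5F) (B 6F) (B 7F)) eq)
        ... | yes _ | no B₇≉0 | _ | _ = 0# ∷ 0# ∷ 0# ∷ 0# ∷ 0# ∷ 0# ∷ 0# ∷ 1# ∷ [] ,
            record { φ000 = φ-0 ; φ100 = φ-0 ; φ010 = φ-0 ; φ001 = φ-0 ; φ011 = φ-0 ; φ101 = φ-0 ; φ110 = φ-0 ; φ111 = φ-1 } ,
            λ eq → B₇≉0 (trans (solve 8 (λ a b c d e f g h → h := a :* con (+ 0) :+ b :* con (+ 0) :+ c :* con (+ 0) :+ d :* con (+ 0) :+ e :* con (+ 0) :+ f :* con (+ 0) :+ g :* con (+ 0) :+ h :* con (+ 1))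
              (B 0F) (B 1F) (B 2F) (B 3F) (B 4F) (B 5F) (B 6F) (B 7F)) eq)
        ... | yes _ | yes _ | no B₄≉0 | _ = 0# ∷ φ₂ t ∷ φ t ∷ 0# ∷ t ∷ 0# ∷ 0# ∷ 0# ∷ [] ,
            record { φ000 = φ-0 ; φ100 = refl ; φ010 = refl ; φ001 = φ₃-id t ; φ011 = φ-0 ; φ101 = φ-0 ; φ110 = φ-0 ; φ111 = φ-0 } ,
            λ eq → proj₂ Tr₃-nontrivial (trans (trans (Tr₃-cong (sym B₄t≈θ)) (trans (+-cong (+-congˡ (trans (φ-* _ _) (*-congʳ B.φ100)))
                (trans (φ-cong (trans (φ-* _ _) (*-congʳ B.φ100))) (trans (φ-* _ _) (*-congʳ B.φ010))))
              (solve 11 (λ t t₁ t₂ a b c d e f g h → e :* t :+ c :* t₁ :+ b :* t₂ := a :* con (+ 0) :+ b :* t₂ :+ c :* t₁ :+ d :* con (+ 0) :+ e :* t :+ f :* con (+ 0) :+ g :* con (+ 0) :+ h :* con (+ 0))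
                t (φ t) (φ₂ t) (B 0F) (B 1F) (B 2F) (B 3F) (B 4F) (B 5F) (B 6F) (B 7F)))) eq)
            where
            t = B 4F ⁻¹ * proj₁ Tr₃-nontrivial
            B₄t≈θ : B 4F * t ≈ proj₁ Tr₃-nontrivial
            B₄t≈θ = trans (sym (*-assoc _ _ _)) (trans (*-congʳ (⁻¹-inverseʳ B₄≉0)) (*-identityˡ _))
        ... | yes _ | yes _ | yes _ | no B₃≉0 = 0# ∷ 0# ∷ 0# ∷ t ∷ 0# ∷ φ t ∷ φ₂ t ∷ 0# ∷ [] ,
            record { φ000 = φ-0 ; φ100 = φ-0 ; φ010 = φ-0 ; φ001 = φ-0 ; φ011 = refl ; φ101 = refl ; φ110 = φ₃-id t ; φ111 = φ-0 } ,
            λ eq → proj₂ Tr₃-nontrivial (trans (trans (Tr₃-cong (sym B₃t≈θ)) (trans (+-cong (+-congˡ (trans (φ-* _ _) (*-congʳ B.φ011)))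
                (trans (φ-cong (trans (φ-* _ _) (*-congʳ B.φ011))) (trans (φ-* _ _) (*-congʳ B.φ101))))
              (solve 11 (λ t t₁ t₂ a b c d e f g h → d :* t :+ f :* t₁ :+ g :* t₂ := a :* con (+ 0) :+ b :* con (+ 0) :+ c :* con (+ 0) :+ d :* t :+ e :* con (+ 0) :+ f :* t₁ :+ g :* t₂ :+ h :* con (+ 0))
                t (φ t) (φ₂ t) (B 0F) (B 1F) (B 2F) (B 3F) (B 4F) (B 5F) (B 6F) (B 7F)))) eq)
            where
            t = B 3F ⁻¹ * proj₁ Tr₃-nontrivial
            B₃t≈θ : B 3F * t ≈ proj₁ Tr₃-nontrivial
            B₃t≈θ = trans (sym (*-assoc _ _ _)) (trans (*-congʳ (⁻¹-inverseʳ B₃≉0)) (*-identityˡ _))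
        ... | yes B₀≈0 | yes B₇≈0 | yes B₄≈0 | yes B₃≈0 = contradiction
            (cyclic-determined B-cyclic (IsLinearSubspace.zero∈ cyclic-subspace) B₀≈0 B₄≈0 B₃≈0 B₇≈0) (proj₁ (proj₂ B-annihilates))

        -- H has codimension 1 in U₁, by comparison of q⁹ and |U₁| = q⁸.
        annihilated⇒Span : ∀ {v} → IsCyclic v → pairing B v ≈ 0# → Span (basis H) v
        annihilated⇒Span {v} v-cyclic Bv≈0 = go (collision {A = vectorSetoid K.setoid 9} (finite-vector 9 (IsFiniteField.order K-finite)) parameters-finite (q⁸<q⁹ 1<q) toParameters)
          where
          T = proj₁ detecting-tensor
          T-cyclic = proj₁ (proj₂ detecting-tensor)
          W : Vector (Vector Carrier 8) 9
          W = T ∷ v ∷ basis H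
          W-cyclic : ∀ i → IsCyclic (W i)
          W-cyclic zero          = T-cyclic
          W-cyclic (suc zero)    = v-cyclic
          W-cyclic (suc (suc i)) = H-cyclic i
          u : Vector K.Carrier 9 → Vector Carrier 8
          u k = combination k W
          u-cyclic : ∀ k → IsCyclic (u k)
          u-cyclic k = Span⊆ cyclic-subspace {v = W} W-cyclic {u k} (k , λ i → refl)
          value₀ : ∀ k → ∃ λ a → ι a ≈ u k 0F
          value₀ k = fixed (u k 0F) (IsCyclic.φ000 (u-cyclic k))
          value₇ : ∀ k → ∃ λ a → ι a ≈ u k 7F
          value₇ k = fixed (u k 7F) (IsCyclic.φ111 (u-cyclic k))
          toParameters : Vector K.Carrier 9 → Setoid.Carrier parameters
          toParameters k = proj₁ (value₀ k) , u k 4F , u k 3F , proj₁ (value₇ k)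
          go : (∃₂ λ k l → ¬ (∀ i → k i K.≈ l i) × Setoid._≈_ parameters (toParameters k) (toParameters l)) → Span (basis H) v
          go (k , l , k≉l , e₀ , e₄ , e₃ , e₇) = conclude (δ₁ K.≟ K.0#)
            where
            δ : Vector K.Carrier 9
            δ i = k i K.- l i
            δ₀ = δ zero
            δ₁ = δ (suc zero)
            δ′ : Vector K.Carrier 7
            δ′ i = δ (suc (suc i))
            C = combination δ′ (basis H)
            agree : u k ≈ᴹ u l
            agree = cyclic-determined (u-cyclic k) (u-cyclic l)
              (trans (sym (proj₂ (value₀ k))) (trans (ι-cong e₀) (proj₂ (value₀ l)))) e₄ e₃
              (trans (sym (proj₂ (value₇ k))) (trans (ι-cong e₇) (proj₂ (value₇ l))))
            -- Pairing with B isolates the term with T and gives δ₀ = 0. Then δ₁ cannot vanish, as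
            -- the basis of H is independent, and the relation can be solved for v.
            relation : δ₀ *ₗ T +ᴹ (δ₁ *ₗ v +ᴹ C) ≈ᴹ 0ᴹ
            relation i = trans (combination-sub k l W i) (sub-zero {u k} {u l} i (agree i))
            module P = IsLinear (pairing-linear B)
            δ₀≈0 : ι δ₀ ≈ 0#
            δ₀≈0 = *-zeroʳ⁻ (proj₂ (proj₂ detecting-tensor)) (begin
              pairing B T * ι δ₀                        ≈⟨ *-comm _ _ ⟩
              ι δ₀ * pairing B T                        ≈⟨ trans (+-congˡ (trans (+-cong (trans (*-congˡ Bv≈0) (zeroʳ _)) (Span-annihilated {C} (δ′ , λ i → refl))) (+-identityʳ 0#))) (+-identityʳ _) ⟨
              ι δ₀ * pairing B T + (ι δ₁ * pairing B v + pairing B C)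
                ≈⟨ +-cong (P.*-homo δ₀ T) (trans (P.+-homo (δ₁ *ₗ v) C) (+-congʳ (P.*-homo δ₁ v))) ⟨
              pairing B (δ₀ *ₗ T) + pairing B (δ₁ *ₗ v +ᴹ C)  ≈⟨ P.+-homo (δ₀ *ₗ T) (δ₁ *ₗ v +ᴹ C) ⟨
              pairing B (δ₀ *ₗ T +ᴹ (δ₁ *ₗ v +ᴹ C))      ≈⟨ trans (P.resp relation) P.0-homo ⟩
              0#                                        ∎)
            relation′ : ∀ i → ι δ₁ * v i + C i ≈ 0#
            relation′ i = trans (sym (trans (+-congʳ (trans (*-congʳ δ₀≈0) (zeroˡ _))) (+-identityˡ _))) (relation i)
            conclude : Dec (δ₁ K.≈ K.0#) → Span (basis H) v
            conclude (no δ₁≉0) = Span-cong {v = basis H} {(K.- (δ₁ K.⁻¹)) *ₗ C} {v} scaled (Span-* {v = basis H} (K.- (δ₁ K.⁻¹)) (δ′ , λ i → refl))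
              where
              scaled : ∀ i → ι (K.- (δ₁ K.⁻¹)) * C i ≈ v i
              scaled i = begin
                ι (K.- (δ₁ K.⁻¹)) * C i     ≈⟨ *-congʳ (ι-neg _) ⟩
                - ι (δ₁ K.⁻¹) * C i
                  ≈⟨ solve 4 (λ d e v C → :- e :* C := d :* e :* v :- e :* (d :* v :+ C)) (ι δ₁) (ι (δ₁ K.⁻¹)) (v i) (C i) ⟩
                ι δ₁ * ι (δ₁ K.⁻¹) * v i - ι (δ₁ K.⁻¹) * (ι δ₁ * v i + C i)
                  ≈⟨ +-cong (*-congʳ (trans (sym (ι-* _ _)) (trans (ι-cong (K.⁻¹-inverseʳ δ₁≉0)) ι-1))) (-‿cong (trans (*-congˡ (relation′ i)) (zeroʳ _))) ⟩
                1# * v i - 0#               ≈⟨ solve 1 (λ v → con (+ 1) :* v :- con (+ 0) := v) (v i) ⟩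
                v i                         ∎
            conclude (yes δ₁≈0) = contradiction k≈l k≉l
              where
              C≈0 : C ≈ᴹ 0ᴹ
              C≈0 i = trans (sym (trans (+-congʳ (trans (*-congʳ (trans (ι-cong δ₁≈0) ι-0)) (zeroˡ _))) (+-identityˡ _))) (relation′ i)
              k≈l : ∀ i → k i K.≈ l i
              k≈l zero          = K.x-y≈0⇒x≈y (ι-zero⁻ δ₀≈0)
              k≈l (suc zero)    = K.x-y≈0⇒x≈y δ₁≈0
              k≈l (suc (suc i)) = K.x-y≈0⇒x≈y (independent H δ′ C≈0 i)

    -- Hyperplanes whose covariant has a root

    module Degenerate (4≤q : 4 ≤ q) (H : Subspace 6) (H-cyclic : ∀ i → IsCyclic (basis H i))
      (B : Vector Carrier 8) (B-annihilates : Annihilates H H-cyclic B)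
      (exactly : HasExactly (q ℕ.^ 2 ℕ.∸ q ℕ.+ 1) (⟦ H ⟧ ∩ O₁)) where

      private
        N = q ℕ.^ 2 ℕ.∸ q ℕ.+ 1
        BC = proj₁ B-annihilates

      norm-zero⁻ : ∀ {x} → norm x ≈ 0# → x ≈ 0#
      norm-zero⁻ {x} N≈0 with x ≟ 0#
      ... | yes x≈0 = x≈0
      ... | no  x≉0 = contradiction N≈0 (norm-nonzero x≉0)

      value : Carrier → Carrier → Carrier
      value x₀ x₁ = pairing B (pureTensor x₀ x₁)

      value-scale : ∀ k x₀ x₁ → value (k * x₀) (k * x₁) ≈ norm k * value x₀ x₁
      value-scale k x₀ x₁ = trans (IsLinear.resp (pairing-linear B) scaled) (pairing-scale B (pureTensor x₀ x₁) (norm k))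
        where
        term : ∀ a b d → k * a * φ (k * b) * φ₂ (k * d) ≈ norm k * (a * φ b * φ₂ d)
        term a b d = trans (*-cong (*-congˡ (φ-* k b)) (trans (φ-cong (φ-* k d)) (φ-* _ _)))
          (solve 6 (λ k k₁ k₂ a b d → k :* a :* (k₁ :* b) :* (k₂ :* d) := k :* k₁ :* k₂ :* (a :* b :* d)) k (φ k) (φ₂ k) a (φ b) (φ₂ d))
        scaled : pureTensor (k * x₀) (k * x₁) ≈ᴹ (λ i → norm k * pureTensor x₀ x₁ i)
        scaled 0F = term x₀ x₀ x₀
        scaled 1F = term x₀ x₀ x₁
        scaled 2F = term x₀ x₁ x₀
        scaled 3F = term x₀ x₁ x₁
        scaled 4F = term x₁ x₀ x₀
        scaled 5F = term x₁ x₀ x₁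
        scaled 6F = term x₁ x₁ x₀
        scaled 7F = term x₁ x₁ x₁

      value-cong : ∀ {x₀ x₁ y₀ y₁} → x₀ ≈ y₀ → x₁ ≈ y₁ → value x₀ x₁ ≈ value y₀ y₁
      value-cong p r = IsLinear.resp (pairing-linear B) (pureTensor-cong p r)

      record Normalization (y₀ y₁ : Carrier) : Set (c′ Level.⊔ ℓ′) where
        field
          z₀ z₁      : Carrier
          normalized : Normalized z₀ z₁
          factor     : Carrier
          factor≉0   : factor ≉ 0#
          y₀≈        : y₀ ≈ factor * z₀
          y₁≈        : y₁ ≈ factor * z₁

      normalize : ∀ y₀ y₁ → ¬ (y₀ ≈ 0# × y₁ ≈ 0#) → Normalization y₀ y₁
      normalize y₀ y₁ y≉0 with y₀ ≟ 0#
      ... | no y₀≉0 = record { z₀ = 1# ; z₁ = y₀ ⁻¹ * y₁ ; normalized = affine refl ; factor = y₀ ; factor≉0 = y₀≉0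
          ; y₀≈ = sym (*-identityʳ y₀) ; y₁≈ = sym (trans (sym (*-assoc _ _ _)) (trans (*-congʳ (⁻¹-inverseʳ y₀≉0)) (*-identityˡ y₁))) }
      ... | yes y₀≈0 = record { z₀ = 0# ; z₁ = 1# ; normalized = infinity refl refl ; factor = y₁ ; factor≉0 = λ y₁≈0 → y≉0 (y₀≈0 , y₁≈0)
          ; y₀≈ = trans y₀≈0 (sym (zeroʳ y₁)) ; y₁≈ = sym (*-identityʳ y₁) }

      -- When x₀ is nonzero, the entries at 4 and 0 of the pure tensor of x have the quotient x₁ /
      -- x₀.
      proportional : ∀ {k x₀ x₁ y₀ y₁} → ¬ (pureTensor x₀ x₁ ≈ᴹ 0ᴹ) → (∀ i → k * pureTensor y₀ y₁ i ≈ pureTensor x₀ x₁ i) → x₁ * y₀ ≈ y₁ * x₀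
      proportional {k} {x₀} {x₁} {y₀} {y₁} T≉0 eq with x₀ ≟ 0# | y₀ ≟ 0#
      ... | yes x₀≈0 | yes y₀≈0 = trans (trans (*-congˡ y₀≈0) (zeroʳ _)) (sym (trans (*-congˡ x₀≈0) (zeroʳ _)))
      ... | yes x₀≈0 | no  y₀≉0 = contradiction (λ i → trans (sym (eq i)) (trans (*-congʳ k≈0) (zeroˡ _))) T≉0
        where
        k≈0 : k ≈ 0#
        k≈0 = *-zeroʳ⁻ (norm-nonzero y₀≉0) (trans (*-comm _ _) (trans (eq 0F) (trans (*-congʳ (*-congʳ x₀≈0)) (trans (*-congʳ (zeroˡ _)) (zeroˡ _)))))
      ... | no  x₀≉0 | yes y₀≈0 = contradiction (trans (sym (eq 0F)) (trans (*-congˡ (trans (*-congʳ (trans (*-congʳ y₀≈0) (zeroˡ _))) (zeroˡ _))) (zeroʳ k))) (norm-nonzero x₀≉0)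
      ... | no  x₀≉0 | no  y₀≉0 = *-cancelˡ (*-nonzero (rest x₀≉0) (rest y₀≉0)) (begin
        φ x₀ * φ₂ x₀ * (φ y₀ * φ₂ y₀) * (x₁ * y₀)
          ≈⟨ solve 6 (λ a b c d x y → a :* b :* (c :* d) :* (x :* y) := (x :* a :* b) :* (y :* c :* d)) (φ x₀) (φ₂ x₀) (φ y₀) (φ₂ y₀) x₁ y₀ ⟩
        (x₁ * φ x₀ * φ₂ x₀) * (y₀ * φ y₀ * φ₂ y₀)    ≈⟨ *-congʳ (eq 4F) ⟨
        (k * (y₁ * φ y₀ * φ₂ y₀)) * norm y₀          ≈⟨ solve 3 (λ k a b → k :* a :* b := a :* (k :* b)) k (y₁ * φ y₀ * φ₂ y₀) (norm y₀) ⟩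
        (y₁ * φ y₀ * φ₂ y₀) * (k * norm y₀)          ≈⟨ *-congˡ (eq 0F) ⟩
        (y₁ * φ y₀ * φ₂ y₀) * norm x₀
          ≈⟨ solve 6 (λ a b c d x y → (y :* c :* d) :* (x :* a :* b) := a :* b :* (c :* d) :* (y :* x)) (φ x₀) (φ₂ x₀) (φ y₀) (φ₂ y₀) x₀ y₁ ⟩
        φ x₀ * φ₂ x₀ * (φ y₀ * φ₂ y₀) * (y₁ * x₀)    ∎)
        where
        rest : ∀ {x} → x ≉ 0# → φ x * φ₂ x ≉ 0#
        rest x≉0 = *-nonzero (φ-nonzero x≉0) (φ-nonzero (φ-nonzero x≉0))

      -- Homogeneous coordinates are compared by cross products, so families such as f + s e can be
      -- used without normalising them first.
      too-many-zeros : (y₀ y₁ : Fin (suc N) → Carrier) → (∀ i → ¬ (y₀ i ≈ 0# × y₁ i ≈ 0#)) →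
        (∀ i j → y₁ i * y₀ j ≈ y₁ j * y₀ i → i ≡ j) → ¬ (∀ i → value (y₀ i) (y₁ i) ≈ 0#)
      too-many-zeros y₀ y₁ y≉0 distinct zeros = exactly⇒not-more {X = ⟦ H ⟧ ∩ O₁} exactly (point , (λ i → in-H i , pureTensor∈O₁ (Z.normalized i) (point i) (λ j → refl)) , injective)
        where
        module Z i = Normalization (normalize (y₀ i) (y₁ i) (y≉0 i))
        point : Fin (suc N) → Point
        point i = record { vec = pureTensor (Z.z₀ i) (Z.z₁ i) ; nonzero = pureTensor-nonzero (Z.normalized i) }
        in-H : ∀ i → ⟦ H ⟧ (point i)
        in-H i = annihilated⇒Span H H-cyclic B B-annihilates (pureTensor-cyclic (Z.z₀ i) (Z.z₁ i))
          (*-zeroʳ⁻ (norm-nonzero (Z.factor≉0 i)) (trans (sym (value-scale (Z.factor i) (Z.z₀ i) (Z.z₁ i)))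
            (trans (value-cong (sym (Z.y₀≈ i)) (sym (Z.y₁≈ i))) (zeros i))))
        injective : ∀ i j → point i ≈ₚ point j → i ≡ j
        injective i j (k , eq) = distinct i j (begin
          y₁ i * y₀ j                     ≈⟨ *-cong (Z.y₁≈ i) (Z.y₀≈ j) ⟩
          cᵢ * Z.z₁ i * (cⱼ * Z.z₀ j)     ≈⟨ solve 4 (λ a b c d → a :* b :* (c :* d) := a :* c :* (b :* d)) cᵢ (Z.z₁ i) cⱼ (Z.z₀ j) ⟩
          cᵢ * cⱼ * (Z.z₁ i * Z.z₀ j)     ≈⟨ *-congˡ (proportional (nonzero (point i)) eq) ⟩
          cᵢ * cⱼ * (Z.z₁ j * Z.z₀ i)     ≈⟨ solve 4 (λ a b c d → c :* b :* (a :* d) := b :* a :* (c :* d)) (Z.z₁ j) cⱼ cᵢ (Z.z₀ i) ⟩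
          cⱼ * Z.z₁ j * (cᵢ * Z.z₀ i)     ≈⟨ *-cong (Z.y₁≈ j) (Z.y₀≈ i) ⟨
          y₁ j * y₀ i                     ∎)
          where
          cᵢ = Z.factor i
          cⱼ = Z.factor j

      fibre : (h : Carrier → Carrier) → (∀ s → φ (h s) ≈ h s) → ∃ λ (g : Vector Carrier (suc N)) → Distinct g × (∀ i j → h (g i) ≈ h (g j))
      fibre h h-fixed = go (fibre-pigeonhole q N (≡.subst (q ℕ.* N <_) (≡.sym n≡q³) (q*[q²-q+1]<q³ 4≤q)) class)
        where
        preimage : ∀ s → ∃ λ k → ι k ≈ h s
        preimage s = fixed (h s) (h-fixed s)
        class : Fin n → Fin q
        class i = K.index (proj₁ (preimage (element i)))
        go : (∃ λ (g : Vector (Fin n) (suc N)) → Injectiveᵥ g × (∀ i j → class (g i) ≡ class (g j))) → _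
        go (g , g-inj , g-const) = element ∘ g , (λ i j eq → g-inj i j (element-injective eq)) , λ i j →
          trans (sym (proj₂ (preimage (element (g i))))) (trans (ι-cong (K.trans (K.sym (K.element-index _))
            (K.trans (K.reflexive (≡.cong K.element (g-const i j))) (K.element-index _)))) (proj₂ (preimage (element (g j)))))

      2≤N : 2 ≤ N
      2≤N = ℕₚ.≤-trans (s≤s (s≤s z≤n)) (2q+2≤q²-q+1 4≤q)

      record Zero : Set (c′ Level.⊔ ℓ′) where
        field
          x₀ x₁      : Carrier
          normalized : Normalized x₀ x₁
          value≈0    : value x₀ x₁ ≈ 0#

      representative-zero : ∀ {p} → Representative p → ⟦ H ⟧ p → Zero
      representative-zero {p} P p∈H = record { x₀ = P.x₀ ; x₁ = P.x₁ ; normalized = P.normalized ; value≈0 = *-zeroʳ⁻ P.scalar≉0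
        (trans (sym (IsLinear.*-homo (pairing-linear B) P.scalar (pureTensor P.x₀ P.x₁)))
        (trans (IsLinear.resp (pairing-linear B) P.spans) (Span-annihilated H H-cyclic B B-annihilates {vec p} p∈H))) }
        where module P = Representative P

      Proportional : Zero → Zero → Set ℓ′
      Proportional P R = Zero.x₁ P * Zero.x₀ R ≈ Zero.x₁ R * Zero.x₀ P

      two-zeros : ∃₂ λ P R → ¬ Proportional P R
      two-zeros = go exactly
        where
        go : HasExactly N (⟦ H ⟧ ∩ O₁) → ∃₂ λ P R → ¬ Proportional P R
        go (p , (p∈ , p-inj) , _) = representative-zero (rep i) (proj₁ (p∈ i)) , representative-zero (rep j) (proj₁ (p∈ j)) ,
            λ eq → i≢j (p-inj i j (same-point (rep i) (rep j) eq))
          where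
          i j : Fin N
          i = Fin.inject≤ {2} 0F 2≤N
          j = Fin.inject≤ {2} 1F 2≤N
          i≢j : i ≢ j
          i≢j eq = Finₚ.0≢1+n (Finₚ.inject≤-injective {2} 2≤N 2≤N 0F 1F eq)
          rep : ∀ i → Representative (p i)
          rep i = representative {p i} (proj₂ (p∈ i))

      -- The points of the projective line other than ⟨e⟩ are the ⟨f + s e⟩.
      module Frame (e₀ e₁ f₀ f₁ : Carrier) (Δ≉0 : f₀ * e₁ - f₁ * e₀ ≉ 0#) (det≈0 : det (contract₁ B e₀ e₁) ≈ 0#) where
        private
          Δ = f₀ * e₁ - f₁ * e₀

          t : Carrier × Carrier → Carrier × Carrier → Carrier × Carrier → Carrier
          t (x₀ , x₁) (y₀ , y₁) (z₀ , z₁) = tri B x₀ x₁ y₀ y₁ z₀ z₁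

          e e′ e″ f f′ f″ : Carrier × Carrier
          e = e₀ , e₁
          e′ = φ e₀ , φ e₁
          e″ = φ₂ e₀ , φ₂ e₁
          f = f₀ , f₁
          f′ = φ f₀ , φ f₁
          f″ = φ₂ f₀ , φ₂ f₁

        -- Together with the conjugates of β and γ these are the eight coordinates of B in the frame
        -- (f, e).
        α β γ δ : Carrier
        α = t f f′ f″
        β = t e f′ f″
        γ = t f e′ e″
        δ = t e e′ e″

        private
          φ-t : ∀ x₀ x₁ y₀ y₁ z₀ z₁ → φ (t (x₀ , x₁) (φ y₀ , φ y₁) (φ₂ z₀ , φ₂ z₁)) ≈ t (z₀ , z₁) (φ x₀ , φ x₁) (φ₂ y₀ , φ₂ y₁)
          φ-t x₀ x₁ y₀ y₁ z₀ z₁ = trans (φ-tri BC x₀ x₁ (φ y₀) (φ y₁) (φ₂ z₀) (φ₂ z₁))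
            (tri-cong {B} {B} (λ _ → refl) (φ₃-id z₀) (φ₃-id z₁) refl refl refl refl)

          φβ : φ β ≈ t f e′ f″
          φβ = φ-t e₀ e₁ f₀ f₁ f₀ f₁
          φ₂β : φ₂ β ≈ t f f′ e″
          φ₂β = trans (φ-cong φβ) (φ-t f₀ f₁ e₀ e₁ f₀ f₁)
          φγ : φ γ ≈ t e f′ e″
          φγ = φ-t f₀ f₁ e₀ e₁ e₀ e₁
          φ₂γ : φ₂ γ ≈ t e e′ f″
          φ₂γ = trans (φ-cong φγ) (φ-t e₀ e₁ f₀ f₁ e₀ e₁)

        -- The contraction of B with e has matrix entries β, φ(γ), φ₂(γ), δ, and its determinant
        -- vanishes by hypothesis.
        βδ : β * δ ≈ φ γ * φ₂ γ
        βδ = trans (x-y≈0⇒x≈y (trans (bilinear-det (contract₁ B e₀ e₁) (φ f₀) (φ f₁) (φ e₀) (φ e₁) (φ₂ f₀) (φ₂ f₁) (φ₂ e₀) (φ₂ e₁)) (trans (*-congˡ det≈0) (zeroʳ _))))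
          (sym (*-cong φγ φ₂γ))

        value-frame : ∀ s → value (f₀ + s * e₀) (f₁ + s * e₁) ≈
          α + s * β + φ s * φ β + φ₂ s * φ₂ β + φ s * φ₂ s * γ + s * φ₂ s * φ γ + s * φ s * φ₂ γ + norm s * δ
        value-frame s = begin
          pairing B (pureTensor x₀ x₁)            ≈⟨ pairing-tensor B x₀ x₁ (φ x₀) (φ x₁) (φ₂ x₀) (φ₂ x₁) ⟩
          tri B x₀ x₁ (φ x₀) (φ x₁) (φ₂ x₀) (φ₂ x₁)
            ≈⟨ tri-cong {B} {B} (λ _ → refl) refl refl (φ-lin f₀ e₀) (φ-lin f₁ e₁) (φ₂-lin f₀ e₀) (φ₂-lin f₁ e₁) ⟩
          t (x₀ , x₁) (y₀ , y₁) (z₀ , z₁)         ≈⟨ tri-linear₁ B s f₀ f₁ e₀ e₁ y₀ y₁ z₀ z₁ ⟩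
          t f (y₀ , y₁) (z₀ , z₁) + s * t e (y₀ , y₁) (z₀ , z₁)
            ≈⟨ +-cong (second f₀ f₁) (*-congˡ (second e₀ e₁)) ⟩
          t f f′ f″ + s″ * t f f′ e″ + s′ * (t f e′ f″ + s″ * t f e′ e″) + s * (t e f′ f″ + s″ * t e f′ e″ + s′ * (t e e′ f″ + s″ * t e e′ e″))
            ≈⟨ solve 11 (λ s s′ s″ a b b₁ b₂ c c₁ c₂ d → a :+ s″ :* b₂ :+ s′ :* (b₁ :+ s″ :* c) :+ s :* (b :+ s″ :* c₁ :+ s′ :* (c₂ :+ s″ :* d)) :=
                 a :+ s :* b :+ s′ :* b₁ :+ s″ :* b₂ :+ s′ :* s″ :* c :+ s :* s″ :* c₁ :+ s :* s′ :* c₂ :+ s :* s′ :* s″ :* d)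
                 s s′ s″ (t f f′ f″) (t e f′ f″) (t f e′ f″) (t f f′ e″) (t f e′ e″) (t e f′ e″) (t e e′ f″) (t e e′ e″) ⟩
          α + s * β + s′ * t f e′ f″ + s″ * t f f′ e″ + s′ * s″ * γ + s * s″ * t e f′ e″ + s * s′ * t e e′ f″ + norm s * δ
            ≈⟨ +-congʳ (+-cong (+-cong (+-congʳ (+-cong (+-congˡ (*-congˡ φβ)) (*-congˡ φ₂β))) (*-congˡ φγ)) (*-congˡ φ₂γ)) ⟨
          α + s * β + s′ * φ β + s″ * φ₂ β + s′ * s″ * γ + s * s″ * φ γ + s * s′ * φ₂ γ + norm s * δ ∎
          where
          s′ = φ s
          s″ = φ₂ s
          x₀ = f₀ + s * e₀
          x₁ = f₁ + s * e₁
          y₀ = φ f₀ + s′ * φ e₀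
          y₁ = φ f₁ + s′ * φ e₁
          z₀ = φ₂ f₀ + s″ * φ₂ e₀
          z₁ = φ₂ f₁ + s″ * φ₂ e₁
          φ-lin : ∀ f e → φ (f + s * e) ≈ φ f + s′ * φ e
          φ-lin f e = trans (φ-+ _ _) (+-congˡ (φ-* s e))
          φ₂-lin : ∀ f e → φ₂ (f + s * e) ≈ φ₂ f + s″ * φ₂ e
          φ₂-lin f e = trans (φ-cong (φ-lin f e)) (trans (φ-+ _ _) (+-congˡ (φ-* _ _)))
          second : ∀ u₀ u₁ → t (u₀ , u₁) (y₀ , y₁) (z₀ , z₁) ≈
            t (u₀ , u₁) f′ f″ + s″ * t (u₀ , u₁) f′ e″ + s′ * (t (u₀ , u₁) e′ f″ + s″ * t (u₀ , u₁) e′ e″)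
          second u₀ u₁ = trans (tri-linear₂ B s′ u₀ u₁ (φ f₀) (φ f₁) (φ e₀) (φ e₁) z₀ z₁)
            (+-cong (tri-linear₃ B s″ u₀ u₁ (φ f₀) (φ f₁) (φ₂ f₀) (φ₂ f₁) (φ₂ e₀) (φ₂ e₁))
                    (*-congˡ (tri-linear₃ B s″ u₀ u₁ (φ e₀) (φ e₁) (φ₂ f₀) (φ₂ f₁) (φ₂ e₀) (φ₂ e₁))))

        no-family : (σ : Vector Carrier (suc N)) → Distinct σ → ¬ (∀ i → value (f₀ + σ i * e₀) (f₁ + σ i * e₁) ≈ 0#)
        no-family σ σ-distinct = too-many-zeros (λ i → f₀ + σ i * e₀) (λ i → f₁ + σ i * e₁) nonzeros (λ i j eq → σ-distinct i j (separate i j eq))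
          where
          nonzeros : ∀ i → ¬ (f₀ + σ i * e₀ ≈ 0# × f₁ + σ i * e₁ ≈ 0#)
          nonzeros i (p , r) = Δ≉0 (trans (solve 5 (λ e₀ e₁ f₀ f₁ s → f₀ :* e₁ :- f₁ :* e₀ := (f₀ :+ s :* e₀) :* e₁ :- (f₁ :+ s :* e₁) :* e₀) e₀ e₁ f₀ f₁ (σ i))
            (x≈y⇒x-y≈0 (trans (*-congʳ p) (trans (zeroˡ _) (sym (trans (*-congʳ r) (zeroˡ _)))))))
          separate : ∀ i j → (f₁ + σ i * e₁) * (f₀ + σ j * e₀) ≈ (f₁ + σ j * e₁) * (f₀ + σ i * e₀) → σ i ≈ σ j
          separate i j eq = x-y≈0⇒x≈y (*-zeroʳ⁻ Δ≉0 (trans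
            (solve 6 (λ e₀ e₁ f₀ f₁ s r → (f₀ :* e₁ :- f₁ :* e₀) :* (s :- r) := (f₁ :+ s :* e₁) :* (f₀ :+ r :* e₀) :- (f₁ :+ r :* e₁) :* (f₀ :+ s :* e₀)) e₀ e₁ f₀ f₁ (σ i) (σ j))
            (x≈y⇒x-y≈0 eq)))

        data Position (z₀ z₁ : Carrier) : Set (c′ Level.⊔ ℓ′) where
          finite   : ∀ u s → u ≉ 0# → value (f₀ + s * e₀) (f₁ + s * e₁) ≈ 0# →
                     z₀ ≈ u * (f₀ + s * e₀) → z₁ ≈ u * (f₁ + s * e₁) → Position z₀ z₁
          infinite : ∀ v → z₀ ≈ v * e₀ → z₁ ≈ v * e₁ → Position z₀ z₁

        private
          cramer : ∀ {x y} → x * Δ ≈ y → x ≈ y * Δ ⁻¹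
          cramer eq = trans (sym (trans (*-assoc _ _ _) (trans (*-congˡ (⁻¹-inverseʳ Δ≉0)) (*-identityʳ _)))) (*-congʳ eq)

        module _ (z₀ z₁ : Carrier) where
          private
            u = (z₀ * e₁ - z₁ * e₀) * Δ ⁻¹
            v = (f₀ * z₁ - f₁ * z₀) * Δ ⁻¹

            expand₀ : z₀ ≈ u * f₀ + v * e₀
            expand₀ = trans (cramer refl) (solve 7 (λ e₀ e₁ f₀ f₁ z₀ z₁ i → z₀ :* (f₀ :* e₁ :- f₁ :* e₀) :* i :=
              (z₀ :* e₁ :- z₁ :* e₀) :* i :* f₀ :+ (f₀ :* z₁ :- f₁ :* z₀) :* i :* e₀) e₀ e₁ f₀ f₁ z₀ z₁ (Δ ⁻¹))

            expand₁ : z₁ ≈ u * f₁ + v * e₁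
            expand₁ = trans (cramer refl) (solve 7 (λ e₀ e₁ f₀ f₁ z₀ z₁ i → z₁ :* (f₀ :* e₁ :- f₁ :* e₀) :* i :=
              (z₀ :* e₁ :- z₁ :* e₀) :* i :* f₁ :+ (f₀ :* z₁ :- f₁ :* z₀) :* i :* e₁) e₀ e₁ f₀ f₁ z₀ z₁ (Δ ⁻¹))

          position : value z₀ z₁ ≈ 0# → Position z₀ z₁
          position z∈ = go (u ≟ 0#)
            where
            go : Dec (u ≈ 0#) → Position z₀ z₁
            go (yes u≈0) = infinite v
              (trans expand₀ (trans (+-congʳ (trans (*-congʳ u≈0) (zeroˡ f₀))) (+-identityˡ _)))
              (trans expand₁ (trans (+-congʳ (trans (*-congʳ u≈0) (zeroˡ f₁))) (+-identityˡ _)))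
            go (no u≉0) = finite u s u≉0
              (*-zeroʳ⁻ (norm-nonzero u≉0) (trans (sym (value-scale u (f₀ + s * e₀) (f₁ + s * e₁))) (trans (value-cong (sym z₀≈) (sym z₁≈)) z∈)))
              z₀≈ z₁≈
              where
              s = u ⁻¹ * v
              split : ∀ f e → u * f + v * e ≈ u * (f + s * e)
              split f e = sym (trans (solve 5 (λ u f i v e → u :* (f :+ i :* v :* e) := u :* f :+ u :* i :* (v :* e)) u f (u ⁻¹) v e)
                (+-congˡ (trans (*-congʳ (⁻¹-inverseʳ u≉0)) (*-identityˡ _))))
              z₀≈ : z₀ ≈ u * (f₀ + s * e₀)
              z₀≈ = trans expand₀ (split f₀ e₀)
              z₁≈ : z₁ ≈ u * (f₁ + s * e₁)
              z₁≈ = trans expand₁ (split f₁ e₁)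

        private
          proportional-pairs : ∀ {x₀ x₁ y₀ y₁ g₀ g₁ u v} → x₀ ≈ u * g₀ → x₁ ≈ u * g₁ → y₀ ≈ v * g₀ → y₁ ≈ v * g₁ → x₁ * y₀ ≈ y₁ * x₀
          proportional-pairs {g₀ = g₀} {g₁} {u} {v} p r p′ r′ = trans (*-cong r p′)
            (trans (solve 4 (λ u v g₀ g₁ → u :* g₁ :* (v :* g₀) := v :* g₁ :* (u :* g₀)) u v g₀ g₁) (sym (*-cong r′ p)))

        position-of : ∀ P → Position (Zero.x₀ P) (Zero.x₁ P)
        position-of P = position (Zero.x₀ P) (Zero.x₁ P) (Zero.value≈0 P)

        -- The value at f + s e is α + Tr(βs). Two different zeros cannot both be ⟨e⟩, so some s
        -- occurs; translating a large fibre of Tr(β ·) so that it contains s gives too many zeros.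
        ¬trace-case : γ ≈ 0# → ¬ (δ ≈ 0#)
        ¬trace-case γ≈0 δ≈0 = go two-zeros
          where
          drop : ∀ {x} y → x ≈ 0# → y * x ≈ 0#
          drop y x≈0 = trans (*-congˡ x≈0) (zeroʳ y)
          h : Carrier → Carrier
          h s = Tr₃ (s * β)
          value-h : ∀ s → value (f₀ + s * e₀) (f₁ + s * e₁) ≈ α + h s
          value-h s = trans (value-frame s) (trans
            (+-cong (+-cong (+-cong (+-congˡ (drop _ γ≈0)) (drop _ (trans (φ-cong γ≈0) φ-0))) (drop _ (trans (φ-cong (trans (φ-cong γ≈0) φ-0)) φ-0))) (drop _ δ≈0))
            (trans (solve 4 (λ a b c d → let z = con (+ 0) in a :+ b :+ c :+ d :+ z :+ z :+ z :+ z := a :+ (b :+ c :+ d)) α (s * β) (φ s * φ β) (φ₂ s * φ₂ β))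
              (+-congˡ (sym (+-cong (+-congˡ (φ-* s β)) (trans (φ-cong (φ-* s β)) (φ-* _ _)))))))
          refute : ∀ s → value (f₀ + s * e₀) (f₁ + s * e₁) ≈ 0# → ⊥
          refute s s∈ = let g , g-distinct , g-const = fibre h (λ s → φ-Tr₃ (s * β)) in contradiction
            (λ i → trans (value-h (g i + (s - g zero))) (begin
              α + h (g i + (s - g zero))
                ≈⟨ +-congˡ (trans (Tr₃-cong (solve 4 (λ a b c β → (a :+ (b :- c)) :* β := b :* β :+ (a :* β :- c :* β)) (g i) s (g zero) β)) (Tr₃-+ _ _)) ⟩
              α + (h s + Tr₃ (g i * β - g zero * β))  ≈⟨ +-congˡ (+-congˡ (same-trace (g-const i zero))) ⟩
              α + (h s + 0#)                          ≈⟨ +-congˡ (+-identityʳ _) ⟩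
              α + h s                                 ≈⟨ trans (sym (value-h s)) s∈ ⟩
              0#                                      ∎))
            (no-family (λ i → g i + (s - g zero)) (λ i j eq → g-distinct i j (x-y≈0⇒x≈y
              (trans (solve 3 (λ a b c → a :- b := (a :+ c) :- (b :+ c)) (g i) (g j) (s - g zero)) (x≈y⇒x-y≈0 eq)))))
            where
            same-trace : ∀ {x y} → Tr₃ x ≈ Tr₃ y → Tr₃ (x - y) ≈ 0#
            same-trace {x} {y} eq = trans (solve 2 (λ a b → a := a :+ b :- b) _ (Tr₃ y))
              (x≈y⇒x-y≈0 (trans (sym (Tr₃-+ (x - y) y)) (trans (Tr₃-cong (solve 2 (λ x y → x :- y :+ y := x) x y)) eq)))
          cases : ∀ P R → ¬ Proportional P R → Position (Zero.x₀ P) (Zero.x₁ P) → Position (Zero.x₀ R) (Zero.x₁ R) → ⊥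
          cases P R P≁R (finite _ s _ s∈ _ _) _                        = refute s s∈
          cases P R P≁R (infinite _ _ _)      (finite _ s _ s∈ _ _)    = refute s s∈
          cases P R P≁R (infinite u p r)      (infinite v p′ r′)       = P≁R (proportional-pairs p r p′ r′)
          go : (∃₂ λ P R → ¬ Proportional P R) → ⊥
          go (P , R , P≁R) = cases P R P≁R (position-of P) (position-of R)

        -- Here β vanishes too, by `βδ`, and the value at f + s e is α + δ N(s), while ⟨e⟩ is not a
        -- zero. Of two different zeros one has s ≠ 0, and a large fibre of the norm can be scaled
        -- to contain this s.
        ¬norm-case : γ ≈ 0# → ¬ (δ ≉ 0#)
        ¬norm-case γ≈0 δ≉0 = go two-zeros
          where
          drop : ∀ {x} y → x ≈ 0# → y * x ≈ 0#
          drop y x≈0 = trans (*-congˡ x≈0) (zeroʳ y)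
          φγ≈0 = trans (φ-cong γ≈0) φ-0
          β≈0 : β ≈ 0#
          β≈0 = *-zeroʳ⁻ δ≉0 (trans (*-comm δ β) (trans βδ (trans (*-congʳ φγ≈0) (zeroˡ _))))
          φβ≈0 = trans (φ-cong β≈0) φ-0
          value-norm : ∀ s → value (f₀ + s * e₀) (f₁ + s * e₁) ≈ α + norm s * δ
          value-norm s = trans (value-frame s) (+-congʳ (trans
            (+-cong (+-cong (+-cong (+-cong (+-cong (+-congˡ (drop _ β≈0)) (drop _ φβ≈0)) (drop _ (trans (φ-cong φβ≈0) φ-0))) (drop _ γ≈0)) (drop _ φγ≈0)) (drop _ (trans (φ-cong φγ≈0) φ-0)))
            (solve 1 (λ a → let z = con (+ 0) in a :+ z :+ z :+ z :+ z :+ z :+ z := a) α)))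
          infinite-impossible : ∀ P v → Zero.x₀ P ≈ v * e₀ → Zero.x₁ P ≈ v * e₁ → ⊥
          infinite-impossible P v p r = v≉0 (norm-zero⁻ (*-zeroʳ⁻ δ≉0 (trans (*-comm _ _) (begin
            norm v * δ             ≈⟨ *-congˡ (pairing-tensor B e₀ e₁ (φ e₀) (φ e₁) (φ₂ e₀) (φ₂ e₁)) ⟨
            norm v * value e₀ e₁   ≈⟨ value-scale v e₀ e₁ ⟨
            value (v * e₀) (v * e₁)  ≈⟨ value-cong p r ⟨
            value (Zero.x₀ P) (Zero.x₁ P)  ≈⟨ Zero.value≈0 P ⟩
            0#                     ∎))))
            where
            v≉0 : v ≉ 0#
            v≉0 v≈0 = pureTensor-nonzero (Zero.normalized P) (λ j → trans (pureTensor-cong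
              (trans p (trans (*-congʳ v≈0) (zeroˡ _))) (trans r (trans (*-congʳ v≈0) (zeroˡ _))) j) (zero-tensor j))
              where
              zero-tensor : ∀ j → pureTensor 0# 0# j ≈ 0#
              zero-tensor = λ { 0F → z ; 1F → z ; 2F → z ; 3F → z ; 4F → z ; 5F → z ; 6F → z ; 7F → z }
                where
                z : ∀ {x y} → 0# * x * y ≈ 0#
                z = trans (*-congʳ (zeroˡ _)) (zeroˡ _)
          refute : ∀ s → s ≉ 0# → value (f₀ + s * e₀) (f₁ + s * e₁) ≈ 0# → ⊥
          refute s s≉0 s∈ = from-fibre (fibre norm φ-norm)
            where
            from-fibre : (∃ λ (g : Vector Carrier (suc N)) → Distinct g × (∀ i j → norm (g i) ≈ norm (g j))) → ⊥
            from-fibre (g , g-distinct , g-const) = no-family σ σ-distinct (λ i → trans (value-norm (σ i)) (trans (+-congˡ (*-congʳ (norm-σ i))) (trans (sym (value-norm s)) s∈)))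
              where
              -- A second element shows that the fibre lies over a nonzero norm, since 0 is the only
              -- element of norm 0; this allows division by the first element.
              second : Fin (suc N)
              second = suc (Fin.inject≤ {1} zero (ℕₚ.≤-trans (ℕₚ.n≤1+n 1) 2≤N))
              g₀≉0 : g zero ≉ 0#
              g₀≉0 g₀≈0 = Finₚ.0≢1+n (g-distinct zero second (trans g₀≈0 (sym (norm-zero⁻ (trans (g-const second zero)
                (trans (norm-cong g₀≈0) (trans (*-congʳ (zeroˡ _)) (zeroˡ _))))))))
              σ : Vector Carrier (suc N)
              σ i = g i * (g zero ⁻¹ * s)
              σ-distinct : Distinct σ
              σ-distinct i j eq = g-distinct i j (*-cancelˡ (*-nonzero (λ i≈0 → 1≉0 (trans (sym (⁻¹-inverseʳ g₀≉0)) (trans (*-congˡ i≈0) (zeroʳ _)))) s≉0)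
                (trans (*-comm _ _) (trans eq (*-comm _ _))))
              norm-σ : ∀ i → norm (σ i) ≈ norm s
              norm-σ i = begin
                norm (g i * (g zero ⁻¹ * s))          ≈⟨ norm-* _ _ ⟩
                norm (g i) * norm (g zero ⁻¹ * s)     ≈⟨ *-congʳ (g-const i zero) ⟩
                norm (g zero) * norm (g zero ⁻¹ * s)  ≈⟨ norm-* _ _ ⟨
                norm (g zero * (g zero ⁻¹ * s))
                  ≈⟨ norm-cong (trans (sym (*-assoc _ _ _)) (trans (*-congʳ (⁻¹-inverseʳ g₀≉0)) (*-identityˡ s))) ⟩
                norm s                                ∎
          go : (∃₂ λ P R → ¬ Proportional P R) → ⊥
          go (P , R , P≁R) = cases (position-of P) (position-of R)
            where
            at : ∀ {z u s f e} → z ≈ u * (f + s * e) → s ≈ 0# → z ≈ u * f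
            at eq s≈0 = trans eq (*-congˡ (trans (+-congˡ (trans (*-congʳ s≈0) (zeroˡ _))) (+-identityʳ _)))
            cases : Position (Zero.x₀ P) (Zero.x₁ P) → Position (Zero.x₀ R) (Zero.x₁ R) → ⊥
            cases (infinite v p r) _ = infinite-impossible P v p r
            cases (finite _ _ _ _ _ _) (infinite v p r) = infinite-impossible R v p r
            cases (finite u s u≉0 s∈ p r) (finite v s′ v≉0 s′∈ p′ r′) = decide (s ≟ 0#) (s′ ≟ 0#)
              where
              decide : Dec (s ≈ 0#) → Dec (s′ ≈ 0#) → ⊥
              decide (no s≉0)  _          = refute s s≉0 s∈
              decide (yes _)   (no s′≉0)  = refute s′ s′≉0 s′∈
              decide (yes s≈0) (yes s′≈0) = P≁R (proportional-pairs {g₀ = f₀} {f₁} (at p s≈0) (at r s≈0) (at p′ s′≈0) (at r′ s′≈0))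

      -- A root e of the covariant leads to one of the two cases: δ = 0 implies γ = 0 through `βδ`,
      -- and δ ≠ 0 allows a change of f which makes γ vanish.
      det-nonzero : ∀ e₀ e₁ f₀ f₁ → f₀ * e₁ - f₁ * e₀ ≉ 0# → det (contract₁ B e₀ e₁) ≉ 0#
      det-nonzero e₀ e₁ f₀ f₁ Δ≉0 det≈0 with Frame.δ e₀ e₁ f₀ f₁ Δ≉0 det≈0 ≟ 0#
      ... | yes δ≈0 = Frame.¬trace-case e₀ e₁ f₀ f₁ Δ≉0 det≈0 γ≈0 δ≈0
        where
        open Frame e₀ e₁ f₀ f₁ Δ≉0 det≈0 using (γ; δ; β; βδ)
        γ≈0 : γ ≈ 0#
        γ≈0 = [ φ-zero⁻ , (λ eq → φ-zero⁻ (φ-zero⁻ eq)) ]′ (*-zero (trans (sym βδ) (trans (*-congˡ δ≈0) (zeroʳ β))))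
      ... | no δ≉0 = Frame.¬norm-case e₀ e₁ g₀ g₁ Δ′≉0 det≈0 γ′≈0 δ≉0
        where
        open Frame e₀ e₁ f₀ f₁ Δ≉0 det≈0 using (γ; δ)
        -- Since γ is linear in f, replacing f by f + s e turns γ into γ + sδ and does not affect δ.
        s = - (γ * δ ⁻¹)
        g₀ = f₀ + s * e₀
        g₁ = f₁ + s * e₁
        Δ′≉0 : g₀ * e₁ - g₁ * e₀ ≉ 0#
        Δ′≉0 eq = Δ≉0 (trans (solve 5 (λ e₀ e₁ f₀ f₁ s → f₀ :* e₁ :- f₁ :* e₀ := (f₀ :+ s :* e₀) :* e₁ :- (f₁ :+ s :* e₁) :* e₀) e₀ e₁ f₀ f₁ s) eq)
        γ′≈0 : Frame.γ e₀ e₁ g₀ g₁ Δ′≉0 det≈0 ≈ 0#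
        γ′≈0 = trans (tri-linear₁ B s f₀ f₁ e₀ e₁ (φ e₀) (φ e₁) (φ₂ e₀) (φ₂ e₁))
          (trans (solve 3 (λ g i d → g :+ :- (g :* i) :* d := g :- g :* (i :* d)) γ (δ ⁻¹) δ)
            (x≈y⇒x-y≈0 (sym (trans (*-congˡ (⁻¹-inverseˡ δ≉0)) (*-identityʳ γ)))))

-- Passage to the quadratic extension

module OverExtension (E : FieldExtension c ℓ c′ ℓ′) (4≤q : 4 ≤ FieldExtension.q E)
  (n≡q³ : FieldExtension.n E ≡ FieldExtension.q E ℕ.^ 3) where

  open FieldExtension E using (q; q-primePower; K; K-finite; ι; ι-hom) renaming (F to Lᴿ; F-finite to L-finite)
  open Extension.WithEmbedding K Lᴿ ι-hom q
  private
    module L = Frobenius E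
    module G = L.Geometry n≡q³

  module _ (H : Subspace 6) (H-cyclic : ∀ i → L.IsCyclic (basis H i))
    (B : Vector L.Carrier 8) (B-annihilates : G.Annihilates H H-cyclic B)
    (M : CommutativeRing c′ ℓ′) where

    private
      module M = CommutativeRing M
      Q R S : L.Carrier
      Q = B 4F L.* B 7F L.- B 5F L.* B 6F
      R = B 0F L.* B 7F L.+ B 4F L.* B 3F L.- B 1F L.* B 6F L.- B 5F L.* B 2F
      S = B 0F L.* B 3F L.- B 1F L.* B 2F

    -- The extension is given only through ρ and its equation, so the arithmetic of pairs stays out
    -- of the computations.
    module _ {k} (M-finite : IsFiniteField k M) (k≡q⁶ : k ≡ q ℕ.^ 6)
      (embed : L.Carrier → M.Carrier) (embed-hom : Extension.IsEmbedding Lᴿ M embed)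
      (leading≉0 : Q L.≉ L.0#) (ρ : M.Carrier) (ρ-not-embedded : ∀ a → embed a M.≉ ρ)
      (ρ-equation : ρ M.* ρ M.≈ embed (L.- (Q L.⁻¹ L.* R)) M.* ρ M.+ embed (L.- (Q L.⁻¹ L.* S))) where

      private
        -- Makes M over 𝔽_{q³} another field extension, whose Frobenius map is φ₃. Its fixed
        -- elements are those embedded from 𝔽_{q³}, and ρ is not among them.
        q³-primePower : IsPrimePower (FieldExtension.n E)
        q³-primePower = let p , k , p-prime , 1≤k , q≡p^k = q-primePower in p , k ℕ.* 3 , p-prime , ℕₚ.≤-trans 1≤k (ℕₚ.m≤m*n k 3) ,
          ≡.trans n≡q³ (≡.trans (≡.cong (ℕ._^ 3) q≡p^k) (ℕₚ.^-*-assoc p k 3))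

        M/K : FieldExtension c ℓ c′ ℓ′
        M/K = record { q-primePower = q-primePower ; K = K ; K-finite = K-finite ; F = M ; F-finite = M-finite ; ι = embed ∘ ι
                     ; ι-hom = MorphismComposition.isRingHomomorphism (CommutativeRing.trans M) ι-hom embed-hom }

        M/L : FieldExtension c′ ℓ′ c′ ℓ′
        M/L = record { q-primePower = q³-primePower ; K = Lᴿ ; K-finite = L-finite ; F = M ; F-finite = M-finite ; ι = embed ; ι-hom = embed-hom }

      open Frobenius M/K
      open Hexagon k≡q⁶
      open KLinear (space 8)
      open SetoidReasoning setoid
      private
        module FM = Frobenius M/L

        φ-embed : ∀ x → φ (embed x) ≈ embed (L.φ x)
        φ-embed x = sym (FM.ι-^ x q)

        φ₃-embed : ∀ x → φ₃ (embed x) ≈ embed x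
        φ₃-embed x = trans (φ-cong (φ-cong (φ-embed x))) (trans (φ-cong (φ-embed _)) (trans (φ-embed _) (FM.ι-cong (G.φ₃-id x))))

        φ₃≈^q³ : ∀ x → φ₃ x ≈ x ^ (q ℕ.^ 3)
        φ₃≈^q³ x = trans (Exp.^-assocʳ semiring (x ^ q) q q) (trans (Exp.^-assocʳ semiring x q (q ℕ.* q))
          (reflexive (≡.cong (λ m → x ^ (q ℕ.* (q ℕ.* m))) (≡.sym (ℕₚ.*-identityʳ q)))))

        φ₃-fixed⇒embedded : ∀ x → φ₃ x ≈ x → ∃ λ a → embed a ≈ x
        φ₃-fixed⇒embedded x eq = FM.fixed x (trans (reflexive (≡.cong (x ^_) n≡q³)) (trans (sym (φ₃≈^q³ x)) eq))

        ρ≉φ₃ρ : ¬ (ρ ≈ φ₃ ρ)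
        ρ≉φ₃ρ eq = let a , ea = φ₃-fixed⇒embedded ρ (sym eq) in ρ-not-embedded a ea

        lift : Vector L.Carrier 8 → Vector Carrier 8
        lift v i = embed (v i)

        lift-cyclic : ∀ {v} → L.IsCyclic v → IsCyclic (lift v)
        lift-cyclic C = record { φ000 = l φ000 ; φ100 = l φ100 ; φ010 = l φ010 ; φ001 = l φ001 ; φ011 = l φ011 ; φ101 = l φ101 ; φ110 = l φ110 ; φ111 = l φ111 }
          where
          open L.IsCyclic C
          l : ∀ {x y} → L.φ x L.≈ y → φ (embed x) ≈ embed y
          l eq = trans (φ-embed _) (FM.ι-cong eq)

        embed-pairing : ∀ u v → embed (L.pairing u v) ≈ pairing (lift u) (lift v)
        embed-pairing u v = plus (plus (plus (plus (plus (plus (plus (FM.ι-* _ _) (FM.ι-* _ _)) (FM.ι-* _ _)) (FM.ι-* _ _)) (FM.ι-* _ _)) (FM.ι-* _ _)) (FM.ι-* _ _)) (FM.ι-* _ _)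
          where
          plus : ∀ {x y x′ y′} → embed x ≈ x′ → embed y ≈ y′ → embed (x L.+ y) ≈ x′ + y′
          plus p r = trans (FM.ι-+ _ _) (+-cong p r)

        Bᴹ : Vector Carrier 8
        Bᴹ = lift B

        embed-Q : embed Q ≈ Bᴹ 4F * Bᴹ 7F - Bᴹ 5F * Bᴹ 6F
        embed-Q = trans (FM.ι-sub _ _) (+-cong (FM.ι-* (B 4F) (B 7F)) (-‿cong (FM.ι-* (B 5F) (B 6F))))

        embed-R : embed R ≈ Bᴹ 0F * Bᴹ 7F + Bᴹ 4F * Bᴹ 3F - Bᴹ 1F * Bᴹ 6F - Bᴹ 5F * Bᴹ 2F
        embed-R = trans (FM.ι-sub _ _) (+-cong (trans (FM.ι-sub _ _) (+-cong (trans (FM.ι-+ _ _) (+-cong (FM.ι-* (B 0F) (B 7F)) (FM.ι-* (B 4F) (B 3F))))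
          (-‿cong (FM.ι-* (B 1F) (B 6F))))) (-‿cong (FM.ι-* (B 5F) (B 2F))))

        embed-S : embed S ≈ Bᴹ 0F * Bᴹ 3F - Bᴹ 1F * Bᴹ 2F
        embed-S = trans (FM.ι-sub _ _) (+-cong (FM.ι-* (B 0F) (B 3F)) (-‿cong (FM.ι-* (B 1F) (B 2F))))

        leadingᴹ≉0 : Bᴹ 4F * Bᴹ 7F - Bᴹ 5F * Bᴹ 6F ≉ 0#
        leadingᴹ≉0 eq = leading≉0 (FM.ι-zero⁻ {Q} (trans embed-Q eq))

        det-root : det (contract₁ Bᴹ 1# ρ) ≈ 0#
        det-root = begin
          det (contract₁ Bᴹ 1# ρ)
            ≈⟨ solve 9 (λ a b c d e f g h x → (a :* con (+ 1) :+ e :* x) :* (d :* con (+ 1) :+ h :* x) :- (b :* con (+ 1) :+ f :* x) :* (c :* con (+ 1) :+ g :* x) :=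
                 (e :* h :- f :* g) :* (x :* x) :+ (a :* h :+ e :* d :- b :* g :- f :* c) :* x :+ (a :* d :- b :* c))
                 (Bᴹ 0F) (Bᴹ 1F) (Bᴹ 2F) (Bᴹ 3F) (Bᴹ 4F) (Bᴹ 5F) (Bᴹ 6F) (Bᴹ 7F) ρ ⟩
          (Bᴹ 4F * Bᴹ 7F - Bᴹ 5F * Bᴹ 6F) * (ρ * ρ) + (Bᴹ 0F * Bᴹ 7F + Bᴹ 4F * Bᴹ 3F - Bᴹ 1F * Bᴹ 6F - Bᴹ 5F * Bᴹ 2F) * ρ + (Bᴹ 0F * Bᴹ 3F - Bᴹ 1F * Bᴹ 2F)
            ≈⟨ +-cong (+-cong (*-cong embed-Q (sym ρ-equation)) (*-congʳ embed-R)) embed-S ⟨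
          embed Q * (embed (L.- (Q L.⁻¹ L.* R)) * ρ + embed (L.- (Q L.⁻¹ L.* S))) + embed R * ρ + embed S
            ≈⟨ +-congʳ (+-congʳ (*-congˡ (+-cong (*-congʳ (neg* R)) (neg* S)))) ⟩
          embed Q * (- (i * embed R) * ρ + - (i * embed S)) + embed R * ρ + embed S
            ≈⟨ solve 5 (λ Q i R S x → Q :* (:- (i :* R) :* x :+ :- (i :* S)) :+ R :* x :+ S := R :* x :- Q :* i :* (R :* x) :+ (S :- Q :* i :* S)) (embed Q) i (embed R) (embed S) ρ ⟩
          embed R * ρ - embed Q * i * (embed R * ρ) + (embed S - embed Q * i * embed S)
            ≈⟨ +-cong (cancel (embed R * ρ)) (cancel (embed S)) ⟩
          0# + 0#                    ≈⟨ +-identityʳ 0# ⟩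
          0#                         ∎
          where
          i = embed (Q L.⁻¹)
          neg* : ∀ y → embed (L.- (Q L.⁻¹ L.* y)) ≈ - (i * embed y)
          neg* y = trans (FM.ι-neg (Q L.⁻¹ L.* y)) (-‿cong (FM.ι-* (Q L.⁻¹) y))
          Qi≈1 : embed Q * i ≈ 1#
          Qi≈1 = trans (sym (FM.ι-* Q (Q L.⁻¹))) (trans (FM.ι-cong (L.⁻¹-inverseʳ leading≉0)) FM.ι-1)
          cancel : ∀ x → x - embed Q * i * x ≈ 0#
          cancel x = x≈y⇒x-y≈0 (sym (trans (*-congʳ Qi≈1) (*-identityˡ x)))

        Bᴹ-cyclic : IsCyclic Bᴹ
        Bᴹ-cyclic = lift-cyclic (proj₁ B-annihilates)

        module NF = Diagonal Bᴹ Bᴹ-cyclic ρ det-root leadingᴹ≉0 ρ≉φ₃ρ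
        open NF using (r; r≉0; φ₂r≈r; scalar; product; linear; AtPoint)

      tri-lift-linear : ∀ x₀ x₁ y₀ y₁ z₀ z₁ → IsLinear (λ v → tri (lift v) x₀ x₁ y₀ y₁ z₀ z₁)
      tri-lift-linear x₀ x₁ y₀ y₁ z₀ z₁ = record
        { resp = λ {u} {v} u≈v → tri-cong {lift u} {lift v} (λ i → FM.ι-cong (u≈v i)) refl refl refl refl refl refl
        ; +-homo = λ u v → trans (tri-cong {lift (λ i → u i L.+ v i)} {λ i → lift u i + lift v i} (λ i → FM.ι-+ (u i) (v i)) refl refl refl refl refl refl)
            (trans (sym (asPairing (λ i → lift u i + lift v i))) (trans (pairing-+ S′ (lift u) (lift v)) (+-cong (asPairing (lift u)) (asPairing (lift v)))))
        ; *-homo = λ k v → trans (tri-cong {lift (λ i → ι k L.* v i)} {λ i → embed (ι k) * lift v i} (λ i → FM.ι-* (ι k) (v i)) refl refl refl refl refl refl)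
            (trans (sym (asPairing (λ i → embed (ι k) * lift v i))) (trans (pairing-scale S′ (lift v) (embed (ι k))) (*-congˡ (asPairing (lift v)))))
        }
        where
        S′ = tensor x₀ x₁ y₀ y₁ z₀ z₁
        asPairing : ∀ V → pairing S′ V ≈ tri V x₀ x₁ y₀ y₁ z₀ z₁
        asPairing V = trans (pairing-comm S′ V) (pairing-tensor V x₀ x₁ y₀ y₁ z₀ z₁)

      f g : Vector L.Carrier 8 → Carrier
      f v = scalar (lift v)
      g v = product (lift v)

      g-linear : IsLinear g
      g-linear = tri-lift-linear (- φ₃ ρ) 1# (- φ₄ ρ) 1# (- φ₅ ρ) 1#

      f-linear : IsLinear f
      f-linear = record
        { resp = λ u≈v → *-congˡ (IsLinear.resp h u≈v)
        ; +-homo = λ u v → trans (*-congˡ (IsLinear.+-homo h u v)) (distribˡ r _ _)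
        ; *-homo = λ k v → trans (*-congˡ (IsLinear.*-homo h k v)) (solve 3 (λ r k x → r :* (k :* x) := k :* (r :* x)) r (embed (ι k)) _)
        }
        where
        h = tri-lift-linear (- φ₃ ρ) 1# (- φ ρ) 1# (- φ₅ ρ) 1#

      f-fixed : ∀ {v} → Span (basis H) v → φ (f v) ≈ f v
      f-fixed {v} v∈ = NF.scalar-fixed (lift-cyclic (G.Span-cyclic H H-cyclic {v} v∈))
        (trans (sym (embed-pairing B v)) (trans (FM.ι-cong (G.Span-annihilated H H-cyclic B B-annihilates {v} v∈)) FM.ι-0))

      lift-pureTensor : ∀ x₀ x₁ i → lift (G.pureTensor x₀ x₁) i ≈
        tensor (embed x₀) (embed x₁) (φ (embed x₀)) (φ (embed x₁)) (φ₂ (embed x₀)) (φ₂ (embed x₁)) i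
      lift-pureTensor x₀ x₁ = λ { 0F → term x₀ x₀ x₀ ; 1F → term x₀ x₀ x₁ ; 2F → term x₀ x₁ x₀ ; 3F → term x₀ x₁ x₁
                                ; 4F → term x₁ x₀ x₀ ; 5F → term x₁ x₀ x₁ ; 6F → term x₁ x₁ x₀ ; 7F → term x₁ x₁ x₁ }
        where
        term : ∀ a b d → embed (a L.* L.φ b L.* G.φ₂ d) ≈ embed a * φ (embed b) * φ₂ (embed d)
        term a b d = trans (FM.ι-* _ _) (*-cong (trans (FM.ι-* _ _) (*-congˡ (sym (φ-embed b))))
          (sym (trans (φ-cong (φ-embed d)) (φ-embed (L.φ d)))))

      module _ {p : Point} (P : G.Representative p) where
        private
          module P = G.Representative P
          x₀ = embed P.x₀
          x₁ = embed P.x₁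

        X : Carrier
        X = linear x₀ x₁

        -- At an affine point X = 0 would mean that φ₃(ρ) lies in 𝔽_{q³}, so that φ₃ fixes it and
        -- therefore ρ; at infinity X is 1.
        X≉0 : X ≉ 0#
        X≉0 X≈0 = go P.normalized
          where
          go : G.Normalized P.x₀ P.x₁ → ⊥
          go (G.affine x₀≈1) = ρ≉φ₃ρ (sym (trans (sym (trans (φ-cong (φ-cong (φ-cong ρ₃≈x₁))) (trans (φ₃-embed P.x₁) (sym ρ₃≈x₁)))) (φ₆-id ρ)))
            where
            ρ₃≈x₁ : φ₃ ρ ≈ x₁
            ρ₃≈x₁ = x-y≈0⇒x≈y (trans (solve 2 (λ ρ x → ρ :- x := :- (:- ρ :* con (+ 1) :+ con (+ 1) :* x)) (φ₃ ρ) x₁)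
              (trans (-‿cong (trans (+-congʳ (*-congˡ (sym (trans (FM.ι-cong x₀≈1) FM.ι-1)))) X≈0)) -0#≈0#))
          go (G.infinity x₀≈0 x₁≈1) = 1≉0 (trans (solve 1 (λ ρ → con (+ 1) := :- ρ :* con (+ 0) :+ con (+ 1) :* con (+ 1)) (φ₃ ρ))
            (trans (sym (+-cong (*-congˡ (trans (FM.ι-cong x₀≈0) FM.ι-0)) (*-congˡ (trans (FM.ι-cong x₁≈1) FM.ι-1)))) X≈0))

        atPoint : AtPoint (f (vec p)) (g (vec p)) X
        atPoint = record
          { κ = embed (ι P.scalar)
          ; κ-fixed = φ-ι P.scalar
          ; κ-nonzero = λ eq → P.scalar≉0 (FM.ι-zero⁻ eq)
          ; f≈ = trans (sym (IsLinear.resp f-linear P.spans)) (trans (IsLinear.*-homo f-linear P.scalar (G.pureTensor P.x₀ P.x₁)) (*-congˡ (trans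
              (*-congˡ (tri-cong {lift (G.pureTensor P.x₀ P.x₁)} {pt} (lift-pureTensor P.x₀ P.x₁) refl refl refl refl refl refl))
              (NF.scalar-tensor (φ₃-embed P.x₀) (φ₃-embed P.x₁)))))
          ; g≈ = trans (sym (IsLinear.resp g-linear P.spans)) (trans (IsLinear.*-homo g-linear P.scalar (G.pureTensor P.x₀ P.x₁)) (*-congˡ (trans
              (tri-cong {lift (G.pureTensor P.x₀ P.x₁)} {pt} (lift-pureTensor P.x₀ P.x₁) refl refl refl refl refl refl)
              (NF.product-tensor (φ₃-embed P.x₀) (φ₃-embed P.x₁)))))
          ; X≉0 = X≉0
          }
          where pt = tensor x₀ x₁ (φ x₀) (φ x₁) (φ₂ x₀) (φ₂ x₁)

      separated : ∀ {p s} → G.Representative p → G.Representative s → g (vec p) * f (vec p) ⁻¹ ≈ g (vec s) * f (vec s) ⁻¹ → p ≈ₚ s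
      separated {p} {s} P S eq = G.same-point P S (FM.ι-injective (trans (FM.ι-* _ _) (trans
        (NF.cross (φ₃-embed _) (φ₃-embed _) (φ₃-embed _) (φ₃-embed _)
          (NF.same-ratio (atPoint P) (atPoint S) eq))
        (sym (FM.ι-* _ _)))))

      ν : Carrier
      ν = r ⁻¹

      ν≉0 : ν ≉ 0#
      ν≉0 ν≈0 = 1≉0 (trans (sym (⁻¹-inverseʳ r≉0)) (trans (*-congˡ ν≈0) (zeroʳ r)))

      φ₂ν≈ν : φ₂ ν ≈ ν
      φ₂ν≈ν = *-cancelˡ r≉0 (begin
        r * φ₂ ν        ≈⟨ *-congʳ φ₂r≈r ⟨
        φ₂ r * φ₂ ν     ≈⟨ φ₂-* r ν ⟨
        φ₂ (r * ν)      ≈⟨ φ₂-cong (⁻¹-inverseʳ r≉0) ⟩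
        φ₂ 1#           ≈⟨ trans (φ-cong φ-1) φ-1 ⟩
        1#              ≈⟨ ⁻¹-inverseʳ r≉0 ⟨
        r * ν           ∎)

      is⟨6,4⟩-set : HasAtLeast (q ℕ.^ 2 ℕ.∸ q ℕ.+ 1) (⟦ H ⟧ ∩ O₁) → Is⟨ 6 , 4 ⟩-SetOf H (⟦ H ⟧ ∩ O₁)
      is⟨6,4⟩-set points = Section.is⟨6,4⟩-set 4≤q (space 8)
        ν ν≉0 φ₂ν≈ν H (⟦ H ⟧ ∩ O₁) proj₁ f g f-linear g-linear (λ {v} → f-fixed {v})
        (λ x x∈ → NF.AtPoint.f≉0 (atPoint (rep x x∈)))
        (λ x x∈ → NF.AtPoint.w≉0 (atPoint (rep x x∈)) , NF.AtPoint.surface-equation (atPoint (rep x x∈)) (f-fixed {vec x} (proj₁ x∈)))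
        (λ x y x∈ y∈ → separated (rep x x∈) (rep y y∈))
        points
        where
        rep : ∀ x → (⟦ H ⟧ ∩ O₁) x → G.Representative x
        rep x x∈ = G.representative {x} (proj₂ x∈)

-- Adjoining a root of the irreducible covariant

module Nondegenerate (E : FieldExtension c ℓ c′ ℓ′) (4≤q : 4 ≤ FieldExtension.q E)
  (n≡q³ : FieldExtension.n E ≡ FieldExtension.q E ℕ.^ 3) (B : Vector (CommutativeRing.Carrier (FieldExtension.F E)) 8) where

  open FieldExtension E using (q; n; K; ι-hom) renaming (F to L; F-finite to L-finite)
  open FiniteField L L-finite
  open Trilinear L using (det; contract₁)
  open SetoidReasoning setoid

  private
    Q R S : Carrier
    Q = B 4F * B 7F - B 5F * B 6F
    R = B 0F * B 7F + B 4F * B 3F - B 1F * B 6F - B 5F * B 2F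
    S = B 0F * B 3F - B 1F * B 2F

    module M = QuadraticExtension L L-finite (- (Q ⁻¹ * R)) (- (Q ⁻¹ * S))

    n*n≡q⁶ : n ℕ.* n ≡ q ℕ.^ 6
    n*n≡q⁶ = ≡.trans (≡.cong₂ ℕ._*_ n≡q³ n≡q³) (≡.sym (ℕₚ.^-distribˡ-+-* q 3 3))

  module _ (leading≉0 : Q ≉ 0#) (det≉0 : ∀ x → det (contract₁ B 1# x) ≉ 0#) where
    private
      irreducible : ∀ x → x * x ≉ - (Q ⁻¹ * R) * x + - (Q ⁻¹ * S)
      irreducible x eq = det≉0 x (begin
        det (contract₁ B 1# x)
          ≈⟨ solve 9 (λ a b c d e f g h x → (a :* con (+ 1) :+ e :* x) :* (d :* con (+ 1) :+ h :* x) :- (b :* con (+ 1) :+ f :* x) :* (c :* con (+ 1) :+ g :* x) :=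
               (e :* h :- f :* g) :* (x :* x) :+ (a :* h :+ e :* d :- b :* g :- f :* c) :* x :+ (a :* d :- b :* c))
               (B 0F) (B 1F) (B 2F) (B 3F) (B 4F) (B 5F) (B 6F) (B 7F) x ⟩
        Q * (x * x) + R * x + S                       ≈⟨ +-congʳ (+-congʳ (*-congˡ eq)) ⟩
        Q * (- (Q ⁻¹ * R) * x + - (Q ⁻¹ * S)) + R * x + S
          ≈⟨ solve 5 (λ Q i R S x → Q :* (:- (i :* R) :* x :+ :- (i :* S)) :+ R :* x :+ S := R :* x :- Q :* i :* (R :* x) :+ (S :- Q :* i :* S)) Q (Q ⁻¹) R S x ⟩
        R * x - Q * Q ⁻¹ * (R * x) + (S - Q * Q ⁻¹ * S)
          ≈⟨ +-cong (x≈y⇒x-y≈0 (sym (trans (*-congʳ (⁻¹-inverseʳ leading≉0)) (*-identityˡ _)))) (x≈y⇒x-y≈0 (sym (trans (*-congʳ (⁻¹-inverseʳ leading≉0)) (*-identityˡ _)))) ⟩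
        0# + 0#                                       ≈⟨ +-identityʳ 0# ⟩
        0#                                            ∎)

    open Extension.WithEmbedding K L ι-hom q
    private module G = Frobenius.Geometry E n≡q³

    is⟨6,4⟩-set : (H : Subspace 6) (H-cyclic : ∀ i → Frobenius.IsCyclic E (basis H i)) → G.Annihilates H H-cyclic B →
                  HasAtLeast (q ℕ.^ 2 ℕ.∸ q ℕ.+ 1) (⟦ H ⟧ ∩ O₁) → Is⟨ 6 , 4 ⟩-SetOf H (⟦ H ⟧ ∩ O₁)
    is⟨6,4⟩-set H H-cyclic B-annihilates = OverExtension.is⟨6,4⟩-set E 4≤q n≡q³ H H-cyclic B B-annihilates
      M.extension (M.isFiniteField irreducible) n*n≡q⁶ M.embed M.embed-hom leading≉0 M.root M.root-not-embedded M.root-equation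

open import Data.Nat.Base using (_+_; _∸_; _^_)

mainTheorem11 : ∀ {c ℓ c′ ℓ′} (q : ℕ) → IsPrimePower q → 4 ≤ q →
    (K : CommutativeRing c ℓ) → IsFiniteField q K →
    (L : CommutativeRing c′ ℓ′) → IsFiniteField (q ^ 3) L →
    (ι : CommutativeRing.Carrier K → CommutativeRing.Carrier L) →
    (ι-hom : Extension.IsEmbedding K L ι) →
    let open Extension.WithEmbedding K L ι-hom q in
    (H₁ : Subspace 6) → ⟦ H₁ ⟧ ⊆ Points U₁ →
    HasExactly (q ^ 2 ∸ q + 1) (⟦ H₁ ⟧ ∩ O₁) →
    Is⟨ 6 , 4 ⟩-SetOf H₁ (⟦ H₁ ⟧ ∩ O₁)
mainTheorem11 q q-primePower 4≤q K K-finite L L-finite ι ι-hom H₁ H₁⊆U₁ exactly =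
  Nondegenerate.is⟨6,4⟩-set E 4≤q ≡.refl B leading≉0 det≉0 H₁ H₁-cyclic B-annihilates (proj₁ exactly , proj₁ (proj₂ exactly))
  where
  E = record { q-primePower = q-primePower ; K = K ; K-finite = K-finite ; F = L ; F-finite = L-finite ; ι = ι ; ι-hom = ι-hom }
  module G = Frobenius.Geometry E ≡.refl
  H₁-cyclic = G.basis-cyclic H₁ (λ {x} → H₁⊆U₁ {x})
  B = proj₁ (G.annihilating-tensor H₁ H₁-cyclic)
  B-annihilates = proj₂ (G.annihilating-tensor H₁ H₁-cyclic)
  det-nonzero = G.Degenerate.det-nonzero 4≤q H₁ H₁-cyclic B B-annihilates exactly
  open FiniteField L L-finite hiding (_+_; _^_)
  open Trilinear L using (det; contract₁)
  -- The leading coefficient is the value of the covariant at (0, 1), with (1, 0) completing the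
  -- frame. The remaining points (1, x) are treated in `det≉0` with (0, 1) as the second vector.
  leading≉0 : B 4F * B 7F - B 5F * B 6F ≉ 0#
  leading≉0 eq = det-nonzero 0# 1# 1# 0#
    (λ 1≈0 → 1≉0 (trans (solve 0 (con (ℤ.+ 1) := con (ℤ.+ 1) :* con (ℤ.+ 1) :- con (ℤ.+ 0) :* con (ℤ.+ 0))) 1≈0))
    (trans (solve 8 (λ a b c d e f g h → let z = con (ℤ.+ 0) ; o = con (ℤ.+ 1) in
      (a :* z :+ e :* o) :* (d :* z :+ h :* o) :- (b :* z :+ f :* o) :* (c :* z :+ g :* o) := e :* h :- f :* g)
      (B 0F) (B 1F) (B 2F) (B 3F) (B 4F) (B 5F) (B 6F) (B 7F)) eq)
  det≉0 : ∀ x → det (contract₁ B 1# x) ≉ 0#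
  det≉0 x = det-nonzero 1# x 0# 1#
    (λ -1≈0 → 1≉0 (trans (solve 1 (λ x → con (ℤ.+ 1) := :- (con (ℤ.+ 0) :* x :- con (ℤ.+ 1) :* con (ℤ.+ 1))) x) (trans (-‿cong -1≈0) -0#≈0#)))
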